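{- Let $k\ge 1$ be an integer, let $N(k)=4k(4k+1)$, and let $X_{1,t},X_{2,t},Y_t$ ($t=1,2,\dots,4k-1$) be indeterminates. Define \begin{align*} f_0(t,j)&=((N(k)+j)Y_t-X_{2,t})(-4)^k,\\ f_1(t,j)&=-((4N(k)+4j+2)Y_t-4X_{1,t})(-4)^k,\\ g_0(t,j)&=X_{2,t}-jY_t,\\ g_1(t,j)&=-(4X_{1,t}-(4j+2)Y_t). \end{align*} For $\ell=1,2,\dots,4k$ let $F^X_\ell$ (resp.\ $G^X_\ell$) be the $(4k-1)\times(4k)$ matrix whose only nonzero entries are, for $t=1,\dots,4k-1$, the $(t,t)$-entry $f_1(t,4(\ell-1)k+t)$ and the $(t,t+1)$-entry $f_0(t,4(\ell-1)k+t+1)$ (resp.\ the $(t,t)$-entry $g_1(t,4(\ell-1)k+t)$ and the $(t,t+1)$-entry $g_0(t,4(\ell-1)k+t+1)$). For $\ell=1,\dots,4k$ let $x_\ell$ be the row vector of length $4k$ whose entries are all zero except the last one, which equals $$u_\ell=(-1)^{\ell-1}(-4)^{(\ell+1)k}\,8k(4k+1)\left(\prod_{i=1}^{4k-\ell}(4ik-1)\right)\left(\prod_{i=1}^{\ell-1}(4ik+1)\right).$$ Let $M^X$ be the $16k^2\times 16k^2$ block matrix $$M^X=\begin{pmatrix} x_1&x_2&x_3&\dots&x_{4k}\\ F^X_1&0&0&\dots&0\\ G^X_1&F^X_2&0&\dots&0\\ 0&G^X_2&F^X_3&\dots&0\\ \vdots&&\ddots&\ddots&\vdots\\ & & &G^X_{4k-1}&F^X_{4k}\\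 0& \dots& &0 & G^X_{4k} \end{pmatrix},$$ i.e.\ a first row $(x_1,\dots,x_{4k})$ followed by $4k+1$ block rows, the $r$-th of which has $F^X_r$ in block column $r$ (for $r\le 4k$) and $G^X_{r-1}$ in block column $r-1$ (for $r\ge 2$), all other blocks zero. Then \begin{multline*} \det M^X=(-1)^{k-1}4^{2k(4k^2+7k+2)}k^{2k(4k+1)} \prod _{i=1} ^{4k}(i+1)_{4k-i+1} \times \prod _{a=1}^{4k-1}\left(2X_{1,a}-(32k^2+2a-1)Y_a\right)\\ \times \prod _{1\le a\le b\le 4k-1} (2X_{2,b}Y_a-2X_{1,a}Y_b-(2b-2a+1)Y_aY_b), \end{multline*} where $(\alpha)_k:=\alpha(\alpha+1)\cdots(\alpha+k-1)$ for $k\ge1$ and $(\alpha)_0:=1$ (shifted factorials).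
   Context: This determinant arises in proving that, for every $k\ge1$, a series $\pi=\sum_{n\ge0} S_k(n)/\big(\binom{8kn}{4kn}(-4)^{kn}\big)$ with $S_k$ a polynomial of degree $4k$ exists: the coefficient matrix of the linear system determining $S_k$ has determinant equal (up to nonzero factors) to $\det M^X$ specialized at $X_{1,t}=X_{2,t}=N(k)$, $Y_t=1$, which is nonzero by the formula. -}

module Defs where

open import Algebra.Bundles using (CommutativeRing; Semiring)
open import Data.Bool.Base using (if_then_else_)
open import Data.Fin.Base using (Fin; zero; suc; toℕ; cast; remQuot)
open import Data.Integer.Base as ℤ using (ℤ; +_; -[1+_]; -1ℤ; 1ℤ)
open import Data.Nat as ℕ using (ℕ; zero; suc; NonZero)
open import Data.Nat.Tactic.RingSolver using (solve-∀)
open import Data.Product.Base using (_×_; _,_)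
open import Data.Vec.Functional using (Vector; removeAt)
open import Relation.Binary.PropositionalEquality using (_≡_)
open import Relation.Nullary.Decidable using (does)
import Algebra.Definitions.RawSemiring as RawSemiring
import Algebra.Properties.Monoid.Sum as MonoidSum
import Data.Integer.Properties as ℤₚ

-- Fin counts from 0; indices in formulas count from 1.
pos₁ : ∀ {n} → Fin n → ℕ
pos₁ i = suc (toℕ i)

-- ∏ℤ n f = f 1 * f 2 * ⋯ * f n
∏ℤ : ℕ → (ℕ → ℤ) → ℤ
∏ℤ n f = MonoidSum.sum ℤₚ.*-1-monoid {n} (λ i → f (pos₁ i))

-- shifted factorial (α)ₙ = α (α + 1) ⋯ (α + n - 1)
poch : ℕ → ℕ → ℕ
poch α zero    = 1
poch α (suc n) = α ℕ.* poch (suc α) n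

N : ℕ → ℕ
N k = 4 ℕ.* k ℕ.* (4 ℕ.* k ℕ.+ 1)

-4^ : ℕ → ℤ
-4^ n = -[1+ 3 ] ℤ.^ n

-- ℓ ranges over 1 , … , 4k
u : ℕ → ℕ → ℤ
u k ℓ =
  -1ℤ ℤ.^ (ℓ ℕ.∸ 1) ℤ.* -4^ ((ℓ ℕ.+ 1) ℕ.* k) ℤ.* + (8 ℕ.* k ℕ.* (4 ℕ.* k ℕ.+ 1))
  ℤ.* ∏ℤ (4 ℕ.* k ℕ.∸ ℓ) (λ i → + (4 ℕ.* i ℕ.* k) ℤ.- 1ℤ)
  ℤ.* ∏ℤ (ℓ ℕ.∸ 1)       (λ i → + (4 ℕ.* i ℕ.* k) ℤ.+ 1ℤ)

columns : ∀ k → 16 ℕ.* k ℕ.^ 2 ≡ (4 ℕ.* k) ℕ.* (4 ℕ.* k)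
columns = lemma
  where
  -- the ring solver does not recognise _^_ on ℕ
  lemma : ∀ k → 16 ℕ.* (k ℕ.* (k ℕ.* 1)) ≡ (4 ℕ.* k) ℕ.* (4 ℕ.* k)
  lemma = solve-∀

rows : ∀ k .{{_ : NonZero k}} → 16 ℕ.* k ℕ.^ 2 ≡ 1 ℕ.+ (4 ℕ.* k ℕ.+ 1) ℕ.* (4 ℕ.* k ℕ.∸ 1)
rows (suc m) = lemma m
  where
  lemma : ∀ m → 16 ℕ.* ((1 ℕ.+ m) ℕ.* ((1 ℕ.+ m) ℕ.* 1)) ≡
                1 ℕ.+ (4 ℕ.* (1 ℕ.+ m) ℕ.+ 1) ℕ.* (m ℕ.+ 3 ℕ.* (1 ℕ.+ m))
  lemma = solve-∀

module OverRing {c r} (R : CommutativeRing c r) where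

  open CommutativeRing R hiding (zero)
  open RawSemiring (Semiring.rawSemiring semiring) using (_^_) renaming (_×_ to _·_)
  open MonoidSum +-monoid using (sum)

  -- the canonical map from the integers
  ι : ℤ → Carrier
  ι (+ n)    = n · 1#
  ι -[1+ n ] = - (suc n · 1#)

  ∏ : ∀ {n} → Vector Carrier n → Carrier
  ∏ = MonoidSum.sum *-monoid

  Matrix : ℕ → ℕ → Set c
  Matrix m n = Fin m → Fin n → Carrier

  -- Laplace expansion along the first row
  det : ∀ {n} → Matrix n n → Carrier
  det {zero}  A = 1#
  det {suc n} A =
    sum (λ j → (- 1#) ^ toℕ j * A zero j * det (λ i → removeAt (A (suc i)) j))

  module BlockMatrix (k : ℕ) (X₁ X₂ Y : Vector Carrier (4 ℕ.* k ℕ.∸ 1)) where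

    f₀ f₁ g₀ g₁ : Fin (4 ℕ.* k ℕ.∸ 1) → ℕ → Carrier
    f₀ t j = (ι (+ (N k ℕ.+ j)) * Y t - X₂ t) * ι (-4^ k)
    f₁ t j = - (ι (+ (4 ℕ.* N k ℕ.+ 4 ℕ.* j ℕ.+ 2)) * Y t - ι (+ 4) * X₁ t) * ι (-4^ k)
    g₀ t j = X₂ t - ι (+ j) * Y t
    g₁ t j = - (ι (+ 4) * X₁ t - ι (+ (4 ℕ.* j ℕ.+ 2)) * Y t)

    bidiagonal : ∀ {m n} (diag super : Fin m → Carrier) → Matrix m n
    bidiagonal diag super s t =
      if does (pos₁ t ℕ.≟ pos₁ s) then diag s
      else if does (pos₁ t ℕ.≟ pos₁ s ℕ.+ 1) then super s
      else 0#

    F G : ℕ → Matrix (4 ℕ.* k ℕ.∸ 1) (4 ℕ.* k)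
    F ℓ = bidiagonal (λ t → f₁ t (4 ℕ.* (ℓ ℕ.∸ 1) ℕ.* k ℕ.+ pos₁ t))
                     (λ t → f₀ t (4 ℕ.* (ℓ ℕ.∸ 1) ℕ.* k ℕ.+ pos₁ t ℕ.+ 1))
    G ℓ = bidiagonal (λ t → g₁ t (4 ℕ.* (ℓ ℕ.∸ 1) ℕ.* k ℕ.+ pos₁ t))
                     (λ t → g₀ t (4 ℕ.* (ℓ ℕ.∸ 1) ℕ.* k ℕ.+ pos₁ t ℕ.+ 1))

    x : ℕ → Vector Carrier (4 ℕ.* k)
    x ℓ t = if does (pos₁ t ℕ.≟ 4 ℕ.* k) then ι (u k ℓ) else 0#

    -- block in block row ρ and block column ℓ (counted from 1, below the first row)
    block : ℕ → ℕ → Matrix (4 ℕ.* k ℕ.∸ 1) (4 ℕ.* k)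
    block ρ ℓ =
      if does (ρ ℕ.≟ ℓ) then F ℓ
      else if does (ρ ℕ.≟ ℓ ℕ.+ 1) then G ℓ
      else λ _ _ → 0#

    entry : Fin (1 ℕ.+ (4 ℕ.* k ℕ.+ 1) ℕ.* (4 ℕ.* k ℕ.∸ 1)) →
            Fin (4 ℕ.* k) × Fin (4 ℕ.* k) → Carrier
    entry zero    (ℓ , t) = x (pos₁ ℓ) t
    entry (suc i) (ℓ , t) =
      let (ρ , s) = remQuot {4 ℕ.* k ℕ.+ 1} (4 ℕ.* k ℕ.∸ 1) i
      in block (pos₁ ρ) (pos₁ ℓ) s t

    M : .{{_ : NonZero k}} → Matrix (16 ℕ.* k ℕ.^ 2) (16 ℕ.* k ℕ.^ 2)
    M i j = entry (cast (rows k) i) (remQuot {4 ℕ.* k} (4 ℕ.* k) (cast (columns k) j))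

{-# OPTIONS --safe #-}
module Submission where

-- Put n = 4k, C = (-4)^k and read a column block as the coefficients of polynomials V_1, …, V_n of degree < n.
-- Below the first row, M says T_{α_s} V_s + T_{β_s} V_{s+1} = 0 for s < n, where for a pair α = (p , a)
--   T_α = (C − z) (p n z d/dz + a) + C n (n + 1) p,
-- with α_s = (−4 Y_s , 4 X_{1,s} − (4s + 2) Y_s) and β_s = (Y_s , (s + 1) Y_s − X_{2,s}). The first row is, up to
-- a scalar, a functional attached in the same way to β_n = (1 , 1 − n²).
--
-- For S = multiplication by C − z the operator T′_α = S⁻¹ T_α S has the same shape, and T_β T′_α = T_α T′_β.
-- Substituting V_s = T′_{α_1} V′_s for s ≥ 2 therefore makes all equations divisible by T_{α_1}. The cokernel of
-- T_{α_1} splits off the factors [α_1 , β_s] := p b − q a, and what remains is the same determinant of size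
-- (n − 1)² for α_2, α_3, … and the V′_s. Hence the determinant is a constant times the product of all [α_s , β_t]
-- with s ≤ t ≤ n. The substitution has to be cancelled, which is possible after replacing the ring R by
-- R[x] and each a_s by a_s + x.

open import Algebra.Bundles using (CommutativeRing; Semiring)
open import Algebra.Morphism.Structures using (module RingMorphisms)
open import Algebra.Solver.Ring.AlmostCommutativeRing using (fromCommutativeRing; _-Raw-AlmostCommutative⟶_)
open import Algebra.Structures using (IsCommutativeRing)
open import Data.Bool.Base using (Bool; true; false; if_then_else_)
open import Data.Fin.Base as Fin using (Fin; toℕ; cast; remQuot; _↑ˡ_; _↑ʳ_)
open import Data.Integer.Base as ℤ using (ℤ; +_; -[1+_]; -1ℤ; 1ℤ)
open import Data.Integer.Tactic.RingSolver using (solve-∀)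
open import Data.List.Base using (List; []; _∷_; _++_; map; length; applyUpTo; tabulate)
open import Data.List.Membership.Propositional using (_∈_)
open import Data.List.Membership.Propositional.Properties using (∈-++⁺ˡ; ∈-++⁺ʳ; ∈-++⁻; ∈-applyUpTo⁺)
open import Data.List.Relation.Binary.Pointwise as Pointwise using (Pointwise; []; _∷_; ++⁺)
open import Data.List.Relation.Unary.All as All using (All; []; _∷_)
open import Data.List.Relation.Unary.Any using (here; there)
open import Data.Maybe.Base using (Maybe; just; nothing)
open import Data.Nat as ℕ using (ℕ; zero; suc; NonZero; _≡ᵇ_)
open import Data.Product.Base using (_×_; _,_; proj₁; proj₂)
open import Data.Sum.Base using (inj₁; inj₂)
open import Data.Unit.Base using (⊤; tt)
open import Data.Vec.Functional using (Vector; removeAt)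
open import Function.Base using (_∘_; flip; id)
open import Level using (Level; _⊔_)
open import Relation.Nullary.Decidable using (does; yes; no)
import Algebra.Definitions.RawSemiring as RawSemiring
import Algebra.Properties.AbelianGroup as AbelianGroupProperties
import Algebra.Properties.Group as GroupProperties
import Algebra.Properties.Monoid.Sum as MonoidSum
import Algebra.Properties.Ring as RingProperties
import Algebra.Properties.Semiring.Mult as Mult
import Algebra.Solver.Ring as RingSolver
import Data.Fin.Properties as Finₚ
import Data.Integer.Properties as ℤₚ
import Data.List.Properties as Listₚ
import Data.List.Relation.Unary.All.Properties as Allₚ
import Data.Nat.Properties as ℕₚ
import Data.Nat.Tactic.RingSolver as ℕSolver
import Relation.Binary.PropositionalEquality as ≡
import Relation.Binary.Reasoning.Setoid as SetoidReasoning
open ≡ using (_≡_)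
open import Defs

-- Write T_α z^j = C η_j(α) z^j - ξ_j(α) z^(j+1). One identity carries the proof: the minor η_i(α)
-- ξ_i(β) - ξ_i(α) η_i(β) equals δ [α , β] and so does not depend on i. It gives the commutation T_β
-- T′_α = T_α T′_β as well as the brackets that split off. The functional λ of the first row
-- vanishes on the image of T′_β for β = β_n. Since T′_α T″_β = T′_β T″_α, the functional λ T′_α
-- vanishes on the image of T″_β, so it is expected to be a multiple of the functional of the next
-- smaller chain; the multiple turns out to be C δ′ [α , β_n]. The substitution scales columns by
-- the factors -ξ_i(α), and passing to the basis 1, T_α 1, T_α z, ... of the target scales rows by
-- the same factors. Hence one product of powers of them stands on both sides of the recursion. In R
-- it may well be a zero divisor, for instance when all X and Y are 0; after adjoining x every ξ_i
-- is x plus a constant, which can be cancelled, and the result is specialised at x = 0.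

private
  variable
    ℓ ℓ′ ℓ″ : Level

-- Integer coefficients in a commutative ring

module IntegerCoefficients {c r} (R : CommutativeRing c r) where
  open CommutativeRing R hiding (zero)
  open OverRing R using (ι)
  open Mult semiring using (×-homo-+) renaming (_×_ to _·_)
  open RingProperties ring using (-‿distribˡ-*; -‿distribʳ-*; -0#≈0#)
  open AbelianGroupProperties +-abelianGroup using (⁻¹-∙-comm)
  open GroupProperties +-group using (⁻¹-involutive)
  open SetoidReasoning setoid

  ι-⊖ : ∀ m n → ι (m ℤ.⊖ n) ≈ m · 1# - n · 1#
  ι-⊖ zero    zero    = sym (-‿inverseʳ 0#)
  ι-⊖ (suc m) zero    = sym (trans (+-congˡ -0#≈0#) (+-identityʳ _))
  ι-⊖ zero    (suc n) = sym (+-identityˡ _)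
  ι-⊖ (suc m) (suc n) = begin
    ι (suc m ℤ.⊖ suc n)                   ≡⟨ ≡.cong ι (ℤₚ.[1+m]⊖[1+n]≡m⊖n m n) ⟩
    ι (m ℤ.⊖ n)                           ≈⟨ ι-⊖ m n ⟩
    m · 1# - n · 1#                       ≈⟨ +-congʳ (+-identityʳ _) ⟨
    m · 1# + 0# - n · 1#                  ≈⟨ +-congʳ (+-congˡ (-‿inverseʳ 1#)) ⟨
    m · 1# + (1# - 1#) - n · 1#           ≈⟨ +-congʳ (+-assoc _ _ _) ⟨
    m · 1# + 1# - 1# - n · 1#             ≈⟨ +-assoc _ _ _ ⟩
    m · 1# + 1# + (- 1# - n · 1#)         ≈⟨ +-cong (+-comm _ _) (⁻¹-∙-comm _ _) ⟩
    suc m · 1# - suc n · 1#               ∎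

  ι-neg : ∀ x → ι (ℤ.- x) ≈ - ι x
  ι-neg (+ zero)  = sym -0#≈0#
  ι-neg (+ suc n) = refl
  ι-neg -[1+ n ]  = sym (⁻¹-involutive _)

  ι-+ : ∀ x y → ι (x ℤ.+ y) ≈ ι x + ι y
  ι-+ (+ m)    (+ n)    = ×-homo-+ 1# m n
  ι-+ (+ m)    -[1+ n ] = ι-⊖ m (suc n)
  ι-+ -[1+ m ] (+ n)    = trans (ι-⊖ n (suc m)) (+-comm _ _)
  ι-+ -[1+ m ] -[1+ n ] = begin
    - (suc (suc (m ℕ.+ n)) · 1#)  ≡⟨ ≡.cong (λ z → - (suc z · 1#)) (ℕₚ.+-suc m n) ⟨
    - ((suc m ℕ.+ suc n) · 1#)    ≈⟨ -‿cong (×-homo-+ 1# (suc m) (suc n)) ⟩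
    - (suc m · 1# + suc n · 1#)   ≈⟨ ⁻¹-∙-comm _ _ ⟨
    - (suc m · 1#) - suc n · 1#   ∎

  ι-+* : ∀ m y → ι (+ m ℤ.* y) ≈ m · 1# * ι y
  ι-+* zero    y = trans (reflexive (≡.cong ι (ℤₚ.*-zeroˡ y))) (sym (zeroˡ _))
  ι-+* (suc m) y = begin
    ι (+ suc m ℤ.* y)          ≡⟨ ≡.cong ι (ℤₚ.suc-* (+ m) y) ⟩
    ι (y ℤ.+ + m ℤ.* y)        ≈⟨ ι-+ y (+ m ℤ.* y) ⟩
    ι y + ι (+ m ℤ.* y)        ≈⟨ +-cong (sym (*-identityˡ _)) (ι-+* m y) ⟩
    1# * ι y + m · 1# * ι y    ≈⟨ distribʳ _ _ _ ⟨
    suc m · 1# * ι y           ∎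

  ι-* : ∀ x y → ι (x ℤ.* y) ≈ ι x * ι y
  ι-* (+ m)    y = ι-+* m y
  ι-* -[1+ m ] y = begin
    ι (ℤ.- (+ suc m) ℤ.* y)     ≡⟨ ≡.cong ι (ℤₚ.neg-distribˡ-* (+ suc m) y) ⟨
    ι (ℤ.- (+ suc m ℤ.* y))     ≈⟨ ι-neg (+ suc m ℤ.* y) ⟩
    - ι (+ suc m ℤ.* y)         ≈⟨ -‿cong (ι-+* (suc m) y) ⟩
    - (suc m · 1# * ι y)        ≈⟨ -‿distribˡ-* _ _ ⟩
    - (suc m · 1#) * ι y        ∎

  ι-1 : ι 1ℤ ≈ 1#
  ι-1 = +-identityʳ 1#

  ι-morphism : CommutativeRing.rawRing ℤₚ.+-*-commutativeRing -Raw-AlmostCommutative⟶ fromCommutativeRing R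
  ι-morphism = record
    { ⟦_⟧ = ι ; +-homo = ι-+ ; *-homo = ι-* ; -‿homo = ι-neg ; 0-homo = refl ; 1-homo = ι-1 }

  private
    ι-dec : ∀ x y → Maybe (ι x ≈ ι y)
    ι-dec x y with x ℤₚ.≟ y
    ... | yes ≡.refl = just refl
    ... | no _       = nothing

  module Solver = RingSolver (CommutativeRing.rawRing ℤₚ.+-*-commutativeRing)
                             (fromCommutativeRing R) ι-morphism ι-dec

-- Determinants

grid : ∀ {A : Set ℓ} → (ℕ → ℕ → A) → ℕ → ℕ → List A
grid f zero    n = []
grid f (suc m) n = applyUpTo (f 0) n ++ grid (f ∘ suc) m n

map-grid : ∀ {A : Set ℓ} {B : Set ℓ′} (g : A → B) (f : ℕ → ℕ → A) m n →
           map g (grid f m n) ≡ grid (λ i j → g (f i j)) m n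
map-grid g f zero    n = ≡.refl
map-grid g f (suc m) n = ≡.trans (Listₚ.map-++ g (applyUpTo (f 0) n) _)
  (≡.cong₂ _++_ (Listₚ.map-applyUpTo (f 0) g n) (map-grid g (f ∘ suc) m n))

length-grid : ∀ {A : Set ℓ} (f : ℕ → ℕ → A) m n → length (grid f m n) ≡ m ℕ.* n
length-grid f zero    n = ≡.refl
length-grid f (suc m) n = ≡.trans (Listₚ.length-++ (applyUpTo (f 0) n))
  (≡.cong₂ ℕ._+_ (Listₚ.length-applyUpTo (f 0) n) (length-grid (f ∘ suc) m n))

All-grid : ∀ {A : Set ℓ} {P : A → Set ℓ″} (f : ℕ → ℕ → A) m n →
           (∀ {i j} → i ℕ.< m → j ℕ.< n → P (f i j)) → All P (grid f m n)
All-grid f zero    n h = []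
All-grid f (suc m) n h = Allₚ.++⁺ (Allₚ.applyUpTo⁺₁ (f 0) n (h (ℕ.s≤s ℕ.z≤n)))
                                  (All-grid (f ∘ suc) m n (λ i<m → h (ℕ.s≤s i<m)))

Pointwise-grid : ∀ {A : Set ℓ} {B : Set ℓ′} {_~_ : A → B → Set ℓ″} (f : ℕ → ℕ → A) (g : ℕ → ℕ → B) m n →
                 (∀ i j → f i j ~ g i j) → Pointwise _~_ (grid f m n) (grid g m n)
Pointwise-grid f g zero    n h = []
Pointwise-grid {_~_ = _~_} f g (suc m) n h = ++⁺ (go (f 0) (g 0) n (h 0)) (Pointwise-grid (f ∘ suc) (g ∘ suc) m n (h ∘ suc))
  where
  go : ∀ f g n → (∀ j → f j ~ g j) → Pointwise _~_ (applyUpTo f n) (applyUpTo g n)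
  go f g zero    h = []
  go f g (suc n) h = h 0 ∷ go (f ∘ suc) (g ∘ suc) n (h ∘ suc)

-- Number of transpositions in `D-pull`: from m groups of n + 1 rows the heads are moved behind all
-- the groups, keeping their order. The head of a group passes the n other rows of its own group and
-- of each later one.
pullLength : ℕ → ℕ → ℕ
pullLength zero    n = 0
pullLength (suc m) n = suc m ℕ.* n ℕ.+ pullLength m n

-- The reorderings of one reduction step: the top row passes m + 1 rows, then the remaining rows of
-- the first equation and the columns of the first polynomial are pulled to the end.
signExponent : ℕ → ℕ
signExponent m = suc m ℕ.+ (pullLength (suc (suc m)) m ℕ.+ pullLength (suc (suc m)) (suc m))

module Determinants {c r} (R : CommutativeRing c r) where
  open CommutativeRing R hiding (zero)
  open IntegerCoefficients R using (module Solver)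
  open Solver using (solve; _:=_; _:+_; _:*_; _:-_; :-_; con)
  open SetoidReasoning setoid
  open RingProperties ring using (-0#≈0#; -‿distribˡ-*; -‿distribʳ-*)

  private
    variable
      I : Set ℓ
      J : Set ℓ′

  Row : Set ℓ → Set _
  Row J = J → Carrier

  -- ∂ a is the interior product with a on alternating forms in the columns. In D, rows are vectors and
  -- columns are labels of an arbitrary type, so that minors are sublists and nothing is reindexed.
  ∂ : Row J → (List J → Carrier) → List J → Carrier
  ∂ a φ []       = 0#
  ∂ a φ (j ∷ js) = a j * φ js - ∂ a (φ ∘ (j ∷_)) js

  D : List (Row J) → List J → Carrier
  D []       []      = 1#
  D []       (_ ∷ _) = 0#
  D (a ∷ as) js      = ∂ a (D as) js

  -- The predicate `P` passes to sublists of labels. Rows therefore have to be compared only on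
  -- labels that can occur, which matters for degree bounds on the columns.
  ∂-cong : {P : J → Set ℓ″} {a b : Row J} {φ ψ : List J → Carrier} →
           (∀ j → P j → a j ≈ b j) → (∀ js → All P js → φ js ≈ ψ js) →
           ∀ {js} → All P js → ∂ a φ js ≈ ∂ b ψ js
  ∂-cong ab φψ []         = refl
  ∂-cong ab φψ (pj ∷ pjs) = +-cong (*-cong (ab _ pj) (φψ _ pjs))
    (-‿cong (∂-cong ab (λ js q → φψ _ (pj ∷ q)) pjs))

  ∂-congʳ : (a : Row J) {φ ψ : List J → Carrier} → (∀ js → φ js ≈ ψ js) →
            ∀ js → ∂ a φ js ≈ ∂ a ψ js
  ∂-congʳ a φψ []       = refl
  ∂-congʳ a φψ (j ∷ js) = +-cong (*-congˡ (φψ js)) (-‿cong (∂-congʳ a (φψ ∘ (j ∷_)) js))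

  ∂-vanishes : (a : Row J) {φ : List J → Carrier} (js : List J) →
               (∀ ks → suc (length ks) ≡ length js → φ ks ≈ 0#) → ∂ a φ js ≈ 0#
  ∂-vanishes a []       φ0 = refl
  ∂-vanishes a {φ} (j ∷ js) φ0 = begin
    a j * φ js - ∂ a (φ ∘ (j ∷_)) js
      ≈⟨ +-cong (*-congˡ (φ0 js ≡.refl))
                (-‿cong (∂-vanishes a js (λ ks e → φ0 (j ∷ ks) (≡.cong suc e)))) ⟩
    a j * 0# - 0#
      ≈⟨ solve 1 (λ x → x :* con (+ 0) :- con (+ 0) := con (+ 0)) refl (a j) ⟩
    0# ∎

  ∂-subʳ : (a : Row J) (w : Carrier) (φ ψ : List J → Carrier) → ∀ js →
           ∂ a (λ ks → w * φ ks - ψ ks) js ≈ w * ∂ a φ js - ∂ a ψ js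
  ∂-subʳ a w φ ψ []       = solve 1 (λ w → con (+ 0) := w :* con (+ 0) :- con (+ 0)) refl w
  ∂-subʳ a w φ ψ (j ∷ js) = begin
    a j * (w * φ js - ψ js) - ∂ a (λ ks → w * φ (j ∷ ks) - ψ (j ∷ ks)) js
      ≈⟨ +-congˡ (-‿cong (∂-subʳ a w _ _ js)) ⟩
    a j * (w * φ js - ψ js) - (w * ∂ a (φ ∘ (j ∷_)) js - ∂ a (ψ ∘ (j ∷_)) js)
      ≈⟨ solve 6 (λ a w f g x y → a :* (w :* f :- g) :- (w :* x :- y)
                              := w :* (a :* f :- x) :- (a :* g :- y)) refl
               (a j) w (φ js) (ψ js) _ _ ⟩
    w * (a j * φ js - ∂ a (φ ∘ (j ∷_)) js) - (a j * ψ js - ∂ a (ψ ∘ (j ∷_)) js) ∎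

  ∂-*ʳ : (a : Row J) (w : Carrier) (φ : List J → Carrier) → ∀ js →
         ∂ a (λ ks → w * φ ks) js ≈ w * ∂ a φ js
  ∂-*ʳ a w φ []       = sym (zeroʳ w)
  ∂-*ʳ a w φ (j ∷ js) = trans (+-congˡ (-‿cong (∂-*ʳ a w _ js)))
    (solve 4 (λ a w f x → a :* (w :* f) :- w :* x := w :* (a :* f :- x)) refl (a j) w (φ js) _)

  ∂-linearˡ : (a b : Row J) (w v : Carrier) (φ : List J → Carrier) → ∀ js →
              ∂ (λ j → w * a j + v * b j) φ js ≈ w * ∂ a φ js + v * ∂ b φ js
  ∂-linearˡ a b w v φ []       = solve 2 (λ w v → con (+ 0) := w :* con (+ 0) :+ v :* con (+ 0)) refl w v
  ∂-linearˡ a b w v φ (j ∷ js) = trans (+-congˡ (-‿cong (∂-linearˡ a b w v _ js)))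
    (solve 7 (λ a b w v f x y → (w :* a :+ v :* b) :* f :- (w :* x :+ v :* y)
                             := w :* (a :* f :- x) :+ v :* (b :* f :- y)) refl
           (a j) (b j) w v (φ js) _ _)

  ∂-∂ : (a b : Row J) (φ : List J → Carrier) (j : J) (js : List J) →
        ∂ a (∂ b φ) (j ∷ js) ≈
        a j * ∂ b φ js - b j * ∂ a φ js + ∂ a (∂ b (φ ∘ (j ∷_))) js
  ∂-∂ a b φ j js = begin
    a j * ∂ b φ js - ∂ a (λ ks → b j * φ ks - ∂ b (φ ∘ (j ∷_)) ks) js
      ≈⟨ +-congˡ (-‿cong (∂-subʳ a (b j) φ _ js)) ⟩
    a j * ∂ b φ js - (b j * ∂ a φ js - ∂ a (∂ b (φ ∘ (j ∷_))) js)
      ≈⟨ solve 3 (λ x y z → x :- (y :- z) := x :- y :+ z) refl _ _ _ ⟩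
    a j * ∂ b φ js - b j * ∂ a φ js + ∂ a (∂ b (φ ∘ (j ∷_))) js ∎

  -- By `∂-∂` the terms that use the first column are antisymmetric in a and b, and the rest is the
  -- same expression for fewer columns. All sign rules for rows come from here, without
  -- permutations.
  ∂-anticomm : (a b : Row J) (φ : List J → Carrier) → ∀ js → ∂ a (∂ b φ) js ≈ - ∂ b (∂ a φ) js
  ∂-anticomm a b φ []       = sym -0#≈0#
  ∂-anticomm a b φ (j ∷ js) = begin
    ∂ a (∂ b φ) (j ∷ js)
      ≈⟨ ∂-∂ a b φ j js ⟩
    a j * ∂ b φ js - b j * ∂ a φ js + ∂ a (∂ b (φ ∘ (j ∷_))) js
      ≈⟨ +-congˡ (∂-anticomm a b _ js) ⟩
    a j * ∂ b φ js - b j * ∂ a φ js - ∂ b (∂ a (φ ∘ (j ∷_))) js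
      ≈⟨ solve 3 (λ x y z → x :- y :- z := :- (y :- x :+ z)) refl _ _ _ ⟩
    - (b j * ∂ a φ js - a j * ∂ b φ js + ∂ b (∂ a (φ ∘ (j ∷_))) js)
      ≈⟨ -‿cong (∂-∂ b a φ j js) ⟨
    - ∂ b (∂ a φ) (j ∷ js) ∎

  -- Anticommutation would only show that twice the value is 0, so the square needs its own
  -- induction.
  ∂-square : (a : Row J) (φ : List J → Carrier) → ∀ js → ∂ a (∂ a φ) js ≈ 0#
  ∂-square a φ []       = refl
  ∂-square a φ (j ∷ js) = begin
    ∂ a (∂ a φ) (j ∷ js)
      ≈⟨ ∂-∂ a a φ j js ⟩
    a j * ∂ a φ js - a j * ∂ a φ js + ∂ a (∂ a (φ ∘ (j ∷_))) js
      ≈⟨ +-cong (-‿inverseʳ _) (∂-square a _ js) ⟩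
    0# + 0#
      ≈⟨ +-identityˡ 0# ⟩
    0# ∎

  sgn : ℕ → Carrier
  sgn zero    = 1#
  sgn (suc n) = - sgn n

  sgn-+ : ∀ m n → sgn (m ℕ.+ n) ≈ sgn m * sgn n
  sgn-+ zero    n = sym (*-identityˡ _)
  sgn-+ (suc m) n = trans (-‿cong (sgn-+ m n)) (-‿distribˡ-* _ _)

  D-move : (a : Row J) (ys zs : List (Row J)) → ∀ js →
           D (a ∷ ys ++ zs) js ≈ sgn (length ys) * D (ys ++ a ∷ zs) js
  D-move a []       zs js = sym (*-identityˡ _)
  D-move a (b ∷ ys) zs js = begin
    ∂ a (∂ b (D (ys ++ zs))) js                  ≈⟨ ∂-anticomm a b _ js ⟩
    - ∂ b (∂ a (D (ys ++ zs))) js                ≈⟨ -‿cong (∂-congʳ b (D-move a ys zs) js) ⟩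
    - ∂ b (λ ks → sgn (length ys) * D (ys ++ a ∷ zs) ks) js
                                                 ≈⟨ -‿cong (∂-*ʳ b _ _ js) ⟩
    - (sgn (length ys) * ∂ b (D (ys ++ a ∷ zs)) js)
                                                 ≈⟨ -‿distribˡ-* _ _ ⟩
    - sgn (length ys) * ∂ b (D (ys ++ a ∷ zs)) js ∎

  D-move-pre : (pre : List (Row J)) (a : Row J) (ys zs : List (Row J)) → ∀ js →
               D (pre ++ a ∷ ys ++ zs) js ≈ sgn (length ys) * D (pre ++ ys ++ a ∷ zs) js
  D-move-pre []        a ys zs js = D-move a ys zs js
  D-move-pre (b ∷ pre) a ys zs js =
    trans (∂-congʳ b (D-move-pre pre a ys zs) js) (∂-*ʳ b _ _ js)

  ∂-repeated : {a : Row J} {as : List (Row J)} → a ∈ as → ∀ js → ∂ a (D as) js ≈ 0#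
  ∂-repeated {as = a ∷ as} (here ≡.refl) js = ∂-square a (D as) js
  ∂-repeated {a = a} {as = b ∷ as} (there m) js = begin
    ∂ a (∂ b (D as)) js     ≈⟨ ∂-anticomm a b _ js ⟩
    - ∂ b (∂ a (D as)) js   ≈⟨ -‿cong (∂-vanishes b js (λ ks _ → ∂-repeated m ks)) ⟩
    - 0#                    ≈⟨ -0#≈0# ⟩
    0#                      ∎

  D-repeated : (pre : List (Row J)) {a : Row J} (post : List (Row J)) → a ∈ pre ++ post →
               ∀ js → D (pre ++ a ∷ post) js ≈ 0#
  D-repeated pre {a} post m js = begin
    D (pre ++ a ∷ post) js                                       ≈⟨ *-identityˡ _ ⟨
    1# * D (pre ++ a ∷ post) js                                  ≈⟨ *-congʳ (sgn² (length pre)) ⟨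
    sgn (length pre) * sgn (length pre) * D (pre ++ a ∷ post) js ≈⟨ *-assoc _ _ _ ⟩
    sgn (length pre) * (sgn (length pre) * D (pre ++ a ∷ post) js)
                                                                 ≈⟨ *-congˡ (D-move a pre post js) ⟨
    sgn (length pre) * ∂ a (D (pre ++ post)) js                  ≈⟨ *-congˡ (∂-repeated m js) ⟩
    sgn (length pre) * 0#                                        ≈⟨ zeroʳ _ ⟩
    0#                                                           ∎
    where
    sgn² : ∀ n → sgn n * sgn n ≈ 1#
    sgn² zero    = *-identityˡ 1#
    sgn² (suc n) = trans (solve 1 (λ x → (:- x) :* (:- x) := x :* x) refl (sgn n)) (sgn² n)

  D-cong-row : {P : J → Set ℓ″} (pre : List (Row J)) {a b : Row J} {post : List (Row J)} →
               (∀ j → P j → a j ≈ b j) → ∀ {js} → All P js →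
               D (pre ++ a ∷ post) js ≈ D (pre ++ b ∷ post) js
  D-cong-row []        ab pjs = ∂-cong ab (λ _ _ → refl) pjs
  D-cong-row (_ ∷ pre) ab pjs = ∂-cong (λ _ _ → refl) (λ _ → D-cong-row pre ab) pjs

  D-linear : (pre : List (Row J)) (a b : Row J) (w v : Carrier) (post : List (Row J)) → ∀ js →
             D (pre ++ (λ j → w * a j + v * b j) ∷ post) js ≈
             w * D (pre ++ a ∷ post) js + v * D (pre ++ b ∷ post) js
  D-linear []        a b w v post js = ∂-linearˡ a b w v (D post) js
  D-linear (d ∷ pre) a b w v post js = begin
    ∂ d (D (pre ++ (λ j → w * a j + v * b j) ∷ post)) js
      ≈⟨ ∂-congʳ d (λ ks → trans (D-linear pre a b w v post ks)
           (solve 2 (λ x y → x :+ y := x :- (:- y)) refl _ _)) js ⟩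
    ∂ d (λ ks → w * D (pre ++ a ∷ post) ks - - (v * D (pre ++ b ∷ post) ks)) js
      ≈⟨ ∂-subʳ d w _ _ js ⟩
    w * ∂ d (D (pre ++ a ∷ post)) js - ∂ d (λ ks → - (v * D (pre ++ b ∷ post) ks)) js
      ≈⟨ +-congˡ (-‿cong (trans (∂-congʳ d (λ ks → -‿distribˡ-* v _) js) (∂-*ʳ d (- v) _ js))) ⟩
    w * ∂ d (D (pre ++ a ∷ post)) js - - v * ∂ d (D (pre ++ b ∷ post)) js
      ≈⟨ solve 3 (λ x v y → x :- (:- v) :* y := x :+ v :* y) refl _ v _ ⟩
    w * ∂ d (D (pre ++ a ∷ post)) js + v * ∂ d (D (pre ++ b ∷ post)) js ∎

  D-row-operation : {P : J → Set ℓ″} (pre : List (Row J)) {a b u : Row J} (post : List (Row J))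
                    (w v : Carrier) → (∀ j → P j → b j ≈ w * a j + v * u j) →
                    u ∈ pre ++ post → ∀ {js} → All P js →
                    D (pre ++ b ∷ post) js ≈ w * D (pre ++ a ∷ post) js
  D-row-operation pre {a} {b} {u} post w v e m {js} pjs = begin
    D (pre ++ b ∷ post) js
      ≈⟨ D-cong-row pre e pjs ⟩
    D (pre ++ (λ j → w * a j + v * u j) ∷ post) js
      ≈⟨ D-linear pre a u w v post js ⟩
    w * D (pre ++ a ∷ post) js + v * D (pre ++ u ∷ post) js
      ≈⟨ +-congˡ (*-congˡ (D-repeated pre post m js)) ⟩
    w * D (pre ++ a ∷ post) js + v * 0#
      ≈⟨ solve 2 (λ x v → x :+ v :* con (+ 0) := x) refl _ v ⟩
    w * D (pre ++ a ∷ post) js ∎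

  D-row-scaling : {P : J → Set ℓ″} (pre : List (Row J)) {a b : Row J} (post : List (Row J))
                  (w : Carrier) → (∀ j → P j → b j ≈ w * a j) → ∀ {js} → All P js →
                  D (pre ++ b ∷ post) js ≈ w * D (pre ++ a ∷ post) js
  D-row-scaling pre {a} {b} post w e {js} pjs = begin
    D (pre ++ b ∷ post) js
      ≈⟨ D-cong-row pre (λ j q → trans (e j q)
           (solve 2 (λ w x → w :* x := w :* x :+ con (+ 0) :* x) refl w (a j))) pjs ⟩
    D (pre ++ (λ j → w * a j + 0# * a j) ∷ post) js
      ≈⟨ D-linear pre a a w 0# post js ⟩
    w * D (pre ++ a ∷ post) js + 0# * D (pre ++ a ∷ post) js
      ≈⟨ solve 2 (λ w x → w :* x :+ con (+ 0) :* x := w :* x) refl w _ ⟩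
    w * D (pre ++ a ∷ post) js ∎

  pow : Carrier → ℕ → Carrier
  pow w zero    = 1#
  pow w (suc n) = w * pow w n

  private
    snoc : ∀ {A : Set ℓ} (xs : List A) (x : A) (ys : List A) →
           (xs ++ x ∷ []) ++ ys ≡ xs ++ x ∷ ys
    snoc xs x ys = Listₚ.++-assoc xs (x ∷ []) ys

  D-block-scaling : {P : J → Set ℓ″} (pre : List (Row J)) (f g : ℕ → Row J) (n : ℕ)
                    (post : List (Row J)) (w : Carrier) →
                    (∀ t j → P j → g t j ≈ w * f t j) → ∀ {js} → All P js →
                    D (pre ++ applyUpTo g n ++ post) js ≈
                    pow w n * D (pre ++ applyUpTo f n ++ post) js
  D-block-scaling pre f g zero    post w e pjs = sym (*-identityˡ _)
  D-block-scaling pre f g (suc n) post w e {js} pjs = begin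
    D (pre ++ g 0 ∷ applyUpTo (g ∘ suc) n ++ post) js
      ≈⟨ D-row-scaling pre _ w (e 0) pjs ⟩
    w * D (pre ++ f 0 ∷ applyUpTo (g ∘ suc) n ++ post) js
      ≡⟨ ≡.cong (λ z → w * D z js) (snoc pre (f 0) _) ⟨
    w * D ((pre ++ f 0 ∷ []) ++ applyUpTo (g ∘ suc) n ++ post) js
      ≈⟨ *-congˡ (D-block-scaling (pre ++ f 0 ∷ []) (f ∘ suc) (g ∘ suc) n post w (e ∘ suc) pjs) ⟩
    w * (pow w n * D ((pre ++ f 0 ∷ []) ++ applyUpTo (f ∘ suc) n ++ post) js)
      ≈⟨ *-assoc _ _ _ ⟨
    w * pow w n * D ((pre ++ f 0 ∷ []) ++ applyUpTo (f ∘ suc) n ++ post) js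
      ≡⟨ ≡.cong (λ z → w * pow w n * D z js) (snoc pre (f 0) _) ⟩
    w * pow w n * D (pre ++ f 0 ∷ applyUpTo (f ∘ suc) n ++ post) js ∎

  -- The added rows lie outside the block, so they are still present while the rows of the block are
  -- replaced one after the other.
  D-block-operation : {P : J → Set ℓ″} (pre : List (Row J)) (f g u : ℕ → Row J) (n : ℕ)
                      (post : List (Row J)) (w v : Carrier) →
                      (∀ t j → P j → g t j ≈ w * f t j + v * u t j) →
                      (∀ {t} → t ℕ.< n → u t ∈ pre ++ post) → ∀ {js} → All P js →
                      D (pre ++ applyUpTo g n ++ post) js ≈
                      pow w n * D (pre ++ applyUpTo f n ++ post) js
  D-block-operation pre f g u zero    post w v e m pjs = sym (*-identityˡ _)
  D-block-operation pre f g u (suc n) post w v e m {js} pjs = begin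
    D (pre ++ g 0 ∷ applyUpTo (g ∘ suc) n ++ post) js
      ≈⟨ D-row-operation pre _ w v (e 0) (weaken (m ℕₚ.0<1+n)) pjs ⟩
    w * D (pre ++ f 0 ∷ applyUpTo (g ∘ suc) n ++ post) js
      ≡⟨ ≡.cong (λ z → w * D z js) (snoc pre (f 0) _) ⟨
    w * D ((pre ++ f 0 ∷ []) ++ applyUpTo (g ∘ suc) n ++ post) js
      ≈⟨ *-congˡ (D-block-operation (pre ++ f 0 ∷ []) (f ∘ suc) (g ∘ suc) (u ∘ suc) n post w v
                   (e ∘ suc) (λ t<n → weaken′ (m (ℕ.s≤s t<n))) pjs) ⟩
    w * (pow w n * D ((pre ++ f 0 ∷ []) ++ applyUpTo (f ∘ suc) n ++ post) js)
      ≈⟨ *-assoc _ _ _ ⟨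
    w * pow w n * D ((pre ++ f 0 ∷ []) ++ applyUpTo (f ∘ suc) n ++ post) js
      ≡⟨ ≡.cong (λ z → w * pow w n * D z js) (snoc pre (f 0) _) ⟩
    w * pow w n * D (pre ++ f 0 ∷ applyUpTo (f ∘ suc) n ++ post) js ∎
    where
    weaken : ∀ {x} → x ∈ pre ++ post → x ∈ pre ++ applyUpTo (g ∘ suc) n ++ post
    weaken q with ∈-++⁻ pre q
    ... | inj₁ q₁ = ∈-++⁺ˡ q₁
    ... | inj₂ q₂ = ∈-++⁺ʳ pre (∈-++⁺ʳ (applyUpTo (g ∘ suc) n) q₂)
    weaken′ : ∀ {x} → x ∈ pre ++ post → x ∈ (pre ++ f 0 ∷ []) ++ post
    weaken′ q with ∈-++⁻ pre q
    ... | inj₁ q₁ = ∈-++⁺ˡ (∈-++⁺ˡ q₁)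
    ... | inj₂ q₂ = ∈-++⁺ʳ (pre ++ f 0 ∷ []) q₂

  -- The two contractions act on different lists, so no sign appears, in contrast to `∂-anticomm`.
  ∂-comm-two-variable : {I : Set ℓ} {J : Set ℓ′} (a : Row J) (b : Row I) (φ : List I → List J → Carrier) → ∀ is js →
          ∂ a (λ ks → ∂ b (λ ms → φ ms ks) is) js ≈ ∂ b (λ ms → ∂ a (φ ms) js) is
  ∂-comm-two-variable a b φ []       js = ∂-vanishes a js (λ _ _ → refl)
  ∂-comm-two-variable a b φ (i ∷ is) js = begin
    ∂ a (λ ks → b i * φ is ks - ∂ b (λ ms → φ (i ∷ ms) ks) is) js
      ≈⟨ ∂-subʳ a (b i) (φ is) _ js ⟩
    b i * ∂ a (φ is) js - ∂ a (λ ks → ∂ b (λ ms → φ (i ∷ ms) ks) is) js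
      ≈⟨ +-congˡ (-‿cong (∂-comm-two-variable a b (φ ∘ (i ∷_)) is js)) ⟩
    b i * ∂ a (φ is) js - ∂ b (λ ms → ∂ a (φ (i ∷ ms)) js) is ∎

  D-column-expansion : (A : I → J → Carrier) (is : List I) (j : J) (js : List J) →
                       D (map A is) (j ∷ js) ≈ ∂ (flip A j) (λ ks → D (map A ks) js) is
  D-column-expansion A []       j js = refl
  D-column-expansion A (i ∷ is) j js = +-congˡ (-‿cong (begin
    ∂ (A i) (D (map A is) ∘ (j ∷_)) js
      ≈⟨ ∂-congʳ (A i) (D-column-expansion A is j) js ⟩
    ∂ (A i) (λ ks → ∂ (flip A j) (λ ms → D (map A ms) ks) is) js
      ≈⟨ ∂-comm-two-variable (A i) (flip A j) (λ ms ks → D (map A ms) ks) is js ⟩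
    ∂ (flip A j) (λ ms → ∂ (A i) (D (map A ms)) js) is ∎))

  -- Expansion along the first column of one matrix is expansion along the first row of the other;
  -- both reduce to the same minors. Column operations are later performed as row operations through
  -- this lemma.
  D-transpose : (A : I → J → Carrier) (is : List I) (js : List J) →
                D (map A is) js ≈ D (map (flip A) js) is
  D-transpose A []       []       = refl
  D-transpose A (i ∷ is) []       = refl
  D-transpose A is       (j ∷ js) = trans (D-column-expansion A is j js)
    (∂-congʳ (flip A j) (λ ks → D-transpose A ks js) is)

  D-length : (as : List (Row J)) (js : List J) → length as ℕ.< length js → D as js ≈ 0#
  D-length []       (_ ∷ _)  lt = refl
  D-length (a ∷ as) js lt = ∂-vanishes a js (λ ks e →
    D-length as ks (ℕ.s≤s⁻¹ (≡.subst (suc (suc (length as)) ℕ.≤_) (≡.sym e) lt)))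

  ∂-++ : (a : Row J) (φ : List J → Carrier) (js ks : List J) → All (λ k → a k ≈ 0#) ks →
         ∂ a φ (js ++ ks) ≈ ∂ a (λ ms → φ (ms ++ ks)) js
  ∂-++ a φ []       []       []       = refl
  ∂-++ a φ []       (k ∷ ks) (z ∷ zs) = begin
    a k * φ ks - ∂ a (φ ∘ (k ∷_)) ks  ≈⟨ +-cong (*-congʳ z) (-‿cong (∂-++ a (φ ∘ (k ∷_)) [] ks zs)) ⟩
    0# * φ ks - 0#                    ≈⟨ solve 1 (λ x → con (+ 0) :* x :- con (+ 0) := con (+ 0)) refl (φ ks) ⟩
    0#                                ∎
  ∂-++ a φ (j ∷ js) ks       zs       = +-congˡ (-‿cong (∂-++ a (φ ∘ (j ∷_)) js ks zs))

  -- The rows `as` can only be paired with labels in `js`. If a label of `js` is left over, the rows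
  -- `bs` are too few for the remaining labels and the term is 0; otherwise the factor D bs ks
  -- remains.
  D-block-triangular : (as bs : List (Row J)) (js ks : List J) →
    length as ≡ length js → length bs ≡ length ks → All (λ a → All (λ k → a k ≈ 0#) ks) as →
    D (as ++ bs) (js ++ ks) ≈ D as js * D bs ks
  D-block-triangular as bs js ks e₁ e₂ z = trans (split as js z) (scale as js)
    where
    -- `D` with an arbitrary form in place of `D []` at the end, so that the contraction with `as`
    -- can be separated from what the other rows do.
    D[_] : List (Row _) → (List _ → Carrier) → List _ → Carrier
    D[ []     ] φ = φ
    D[ a ∷ as ] φ = ∂ a (D[ as ] φ)

    final : ∀ ms → D bs (ms ++ ks) ≈ D bs ks * D [] ms
    final []       = sym (*-identityʳ _)
    final (m ∷ ms) = trans
      (D-length bs (m ∷ ms ++ ks) (ℕ.s≤s (≡.subst₂ ℕ._≤_ (≡.sym e₂) (≡.sym (Listₚ.length-++ ms)) (ℕₚ.m≤n+m _ _))))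
      (sym (zeroʳ _))

    split : ∀ as js → All (λ a → All (λ k → a k ≈ 0#) ks) as →
            D (as ++ bs) (js ++ ks) ≈ D[ as ] (λ ms → D bs (ms ++ ks)) js
    split []       js []       = refl
    split (a ∷ as) js (z ∷ zs) = trans (∂-++ a _ js ks z) (∂-congʳ a (λ ms → split as ms zs) js)

    scale : ∀ as js → D[ as ] (λ ms → D bs (ms ++ ks)) js ≈ D as js * D bs ks
    scale []       js = trans (final js) (*-comm _ _)
    scale (a ∷ as) js = begin
      ∂ a (D[ as ] (λ ms → D bs (ms ++ ks))) js  ≈⟨ ∂-congʳ a (scale as) js ⟩
      ∂ a (λ ms → D as ms * D bs ks) js          ≈⟨ ∂-congʳ a (λ _ → *-comm _ _) js ⟩
      ∂ a (λ ms → D bs ks * D as ms) js          ≈⟨ ∂-*ʳ a _ _ js ⟩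
      D bs ks * ∂ a (D as) js                    ≈⟨ *-comm _ _ ⟩
      ∂ a (D as) js * D bs ks                    ∎

  ∏< : ℕ → (ℕ → Carrier) → Carrier
  ∏< zero    f = 1#
  ∏< (suc n) f = f 0 * ∏< n (f ∘ suc)

  ∏<-cong : ∀ n {f g : ℕ → Carrier} → (∀ i → f i ≈ g i) → ∏< n f ≈ ∏< n g
  ∏<-cong zero    h = refl
  ∏<-cong (suc n) h = *-cong (h 0) (∏<-cong n (h ∘ suc))

  D-triangular : (f : ℕ → Row J) (g : ℕ → J) (n : ℕ) → (∀ {s t} → s ℕ.< t → f s (g t) ≈ 0#) →
                 D (applyUpTo f n) (applyUpTo g n) ≈ ∏< n (λ i → f i (g i))
  D-triangular f g zero    z = refl
  D-triangular f g (suc n) z = begin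
    D (applyUpTo f (suc n)) (applyUpTo g (suc n))
      ≈⟨ D-block-triangular (f 0 ∷ []) (applyUpTo (f ∘ suc) n) (g 0 ∷ []) (applyUpTo (g ∘ suc) n) ≡.refl
           (≡.trans (Listₚ.length-applyUpTo (f ∘ suc) n) (≡.sym (Listₚ.length-applyUpTo (g ∘ suc) n)))
           (zeros (g ∘ suc) (λ t → z (ℕ.s≤s ℕ.z≤n)) n ∷ []) ⟩
    (f 0 (g 0) * 1# - 0#) * D (applyUpTo (f ∘ suc) n) (applyUpTo (g ∘ suc) n)
      ≈⟨ *-cong (trans (+-cong (*-identityʳ _) -0#≈0#) (+-identityʳ _))
                (D-triangular (f ∘ suc) (g ∘ suc) n (λ s<t → z (ℕ.s≤s s<t))) ⟩
    f 0 (g 0) * ∏< n (λ i → f (suc i) (g (suc i))) ∎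
    where
    zeros : ∀ (g : ℕ → _) → (∀ t → f 0 (g t) ≈ 0#) → ∀ n → All (λ k → f 0 k ≈ 0#) (applyUpTo g n)
    zeros g h zero    = []
    zeros g h (suc n) = h 0 ∷ zeros (g ∘ suc) (h ∘ suc) n

  D-cong : {P : J → Set ℓ″} {as bs : List (Row J)} →
           Pointwise (λ a b → ∀ j → P j → a j ≈ b j) as bs →
           ∀ {js} → All P js → D as js ≈ D bs js
  D-cong []         []       = refl
  D-cong []         (_ ∷ _)  = refl
  D-cong (ab ∷ asbs) pjs     = ∂-cong ab (λ _ → D-cong asbs) pjs

  D-relabel : {I : Set ℓ} {J : Set ℓ′} (g : I → J) (as : List (Row J)) (is : List I) →
              D as (map g is) ≈ D (map (_∘ g) as) is
  D-relabel g []       []      = refl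
  D-relabel g []       (_ ∷ _) = refl
  D-relabel g (a ∷ as) is      = trans (∂-relabel (D as) is) (∂-congʳ (a ∘ g) (D-relabel g as) is)
    where
    ∂-relabel : ∀ φ is → ∂ a φ (map g is) ≈ ∂ (a ∘ g) (φ ∘ map g) is
    ∂-relabel φ []       = refl
    ∂-relabel φ (i ∷ is) = +-congˡ (-‿cong (∂-relabel (φ ∘ (g i ∷_)) is))

  D-pull : (pre : List (Row J)) (f : ℕ → ℕ → Row J) (m n : ℕ) (post : List (Row J)) → ∀ js →
           D (pre ++ grid f m (suc n) ++ post) js ≈
           sgn (pullLength m n) *
           D (pre ++ grid (λ i j → f i (suc j)) m n ++ applyUpTo (λ i → f i 0) m ++ post) js
  D-pull pre f zero    n post js = sym (*-identityˡ _)
  D-pull pre f (suc m) n post js = begin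
    D (pre ++ (f 0 0 ∷ A ++ grid (f ∘ suc) m (suc n)) ++ post) js
      ≡⟨ ≡.cong (λ z → D z js) (≡.trans (≡.cong (λ z → pre ++ f 0 0 ∷ z) (Listₚ.++-assoc A _ post))
                                        (≡.sym (Listₚ.++-assoc pre (f 0 0 ∷ A) _))) ⟩
    D ((pre ++ f 0 0 ∷ A) ++ grid (f ∘ suc) m (suc n) ++ post) js
      ≈⟨ D-pull (pre ++ f 0 0 ∷ A) (f ∘ suc) m n post js ⟩
    sgn (pullLength m n) * D ((pre ++ f 0 0 ∷ A) ++ G ++ B ++ post) js
      ≡⟨ ≡.cong (λ z → sgn (pullLength m n) * D z js)
           (≡.trans (Listₚ.++-assoc pre (f 0 0 ∷ A) _)
                    (≡.cong (λ z → pre ++ f 0 0 ∷ z) (≡.sym (Listₚ.++-assoc A G _)))) ⟩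
    sgn (pullLength m n) * D (pre ++ f 0 0 ∷ (A ++ G) ++ B ++ post) js
      ≈⟨ *-congˡ (D-move-pre pre (f 0 0) (A ++ G) (B ++ post) js) ⟩
    sgn (pullLength m n) * (sgn (length (A ++ G)) * D (pre ++ (A ++ G) ++ f 0 0 ∷ B ++ post) js)
      ≈⟨ trans (sym (*-assoc _ _ _)) (*-congʳ (*-comm _ _)) ⟩
    sgn (length (A ++ G)) * sgn (pullLength m n) * D (pre ++ (A ++ G) ++ f 0 0 ∷ B ++ post) js
      ≈⟨ *-congʳ (sgn-+ (length (A ++ G)) (pullLength m n)) ⟨
    sgn (length (A ++ G) ℕ.+ pullLength m n) * D (pre ++ (A ++ G) ++ f 0 0 ∷ B ++ post) js
      ≡⟨ ≡.cong (λ z → sgn (z ℕ.+ pullLength m n) * D (pre ++ (A ++ G) ++ f 0 0 ∷ B ++ post) js)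
           (length-grid (λ i j → f i (suc j)) (suc m) n) ⟩
    sgn (suc m ℕ.* n ℕ.+ pullLength m n) * D (pre ++ (A ++ G) ++ f 0 0 ∷ B ++ post) js ∎
    where
    A = applyUpTo (λ j → f 0 (suc j)) n
    B = applyUpTo (λ i → f (suc i) 0) m
    G = grid (λ i j → f (suc i) (suc j)) m n

  open RawSemiring (Semiring.rawSemiring semiring) using (_^_)
  open MonoidSum +-monoid using (sum; sum-cong-≋)
  open OverRing R using (det)

  -- The nested minus signs of `∂` accumulate to the powers of -1 in the Laplace expansion.
  det≈D : ∀ {n} (a : Fin n → Row J) (j : Fin n → J) →
          det (λ i k → a i (j k)) ≈ D (tabulate a) (tabulate j)
  det≈D {n = zero}  a j = refl
  det≈D {n = suc n} a j = begin
    sum (λ k → (- 1#) ^ toℕ k * a Fin.zero (j k) * det (λ i → removeAt (λ l → a (Fin.suc i) (j l)) k))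
      ≈⟨ sum-cong-≋ (λ k → *-congˡ {x = (- 1#) ^ toℕ k * a Fin.zero (j k)} (det≈D (a ∘ Fin.suc) (removeAt j k))) ⟩
    sum (λ k → (- 1#) ^ toℕ k * a Fin.zero (j k) * D (tabulate (a ∘ Fin.suc)) (tabulate (removeAt j k)))
      ≈⟨ expand n j (D (tabulate (a ∘ Fin.suc))) ⟨
    ∂ (a Fin.zero) (D (tabulate (a ∘ Fin.suc))) (tabulate j) ∎
    where
    sum-neg : ∀ n (f : Fin n → Carrier) → sum (λ k → - f k) ≈ - sum f
    sum-neg zero    f = sym -0#≈0#
    sum-neg (suc n) f = trans (+-congˡ (sum-neg n (f ∘ Fin.suc)))
      (solve 2 (λ x y → :- x :+ :- y := :- (x :+ y)) refl _ _)

    neg-head : ∀ x y z → - (x * y * z) ≈ - 1# * x * y * z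
    neg-head x y z = trans (-‿distribˡ-* _ z) (*-congʳ (trans (-‿distribˡ-* x y)
      (*-congʳ (trans (-‿cong (sym (*-identityˡ x))) (-‿distribˡ-* 1# x)))))

    expand : ∀ n (j : Fin (suc n) → _) φ → ∂ (a Fin.zero) φ (tabulate j) ≈
             sum (λ k → (- 1#) ^ toℕ k * a Fin.zero (j k) * φ (tabulate (removeAt j k)))
    expand zero    j φ = trans (+-congˡ -0#≈0#) (+-congʳ (*-congʳ (sym (*-identityˡ _))))
    expand (suc n) j φ = +-cong (*-congʳ (sym (*-identityˡ _))) (begin
      - ∂ (a Fin.zero) (φ ∘ (j Fin.zero ∷_)) (tabulate (j ∘ Fin.suc))
        ≈⟨ -‿cong (expand n (j ∘ Fin.suc) (φ ∘ (j Fin.zero ∷_))) ⟩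
      - sum (λ k → (- 1#) ^ toℕ k * a Fin.zero (j (Fin.suc k)) * φ (j Fin.zero ∷ tabulate (removeAt (j ∘ Fin.suc) k)))
        ≈⟨ sum-neg (suc n) (λ k → (- 1#) ^ toℕ k * a Fin.zero (j (Fin.suc k)) * φ (j Fin.zero ∷ tabulate (removeAt (j ∘ Fin.suc) k))) ⟨
      sum (λ k → - ((- 1#) ^ toℕ k * a Fin.zero (j (Fin.suc k)) * φ (j Fin.zero ∷ tabulate (removeAt (j ∘ Fin.suc) k))))
        ≈⟨ sum-cong-≋ {suc n} (λ k → neg-head ((- 1#) ^ toℕ k) (a Fin.zero (j (Fin.suc k))) (φ (j Fin.zero ∷ tabulate (removeAt (j ∘ Fin.suc) k)))) ⟩
      sum (λ k → - 1# * (- 1#) ^ toℕ k * a Fin.zero (j (Fin.suc k)) * φ (j Fin.zero ∷ tabulate (removeAt (j ∘ Fin.suc) k))) ∎)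

-- Row and column operations on doubly indexed families

module GridOperations {c r} (R : CommutativeRing c r) where
  open CommutativeRing R hiding (zero)
  open Determinants R
  open SetoidReasoning setoid

  private
    variable
      J : Set ℓ

  -- The blocks are restored from the top: once block i is f (i + 1), it joins `pre` and can be
  -- subtracted from the block below it.
  D-add-previous : (pre : List (Row J)) (f g : ℕ → ℕ → Row J) (w v : ℕ → Carrier) (m n : ℕ) →
                   (∀ {t} → t ℕ.< n → f 0 (suc t) ∈ pre) →
                   (∀ i j → g i 0 j ≈ f (suc i) 0 j) →
                   (∀ i t j → g i (suc t) j ≈ w i * f (suc i) (suc t) j + v i * f i (suc t) j) → ∀ js →
                   D (pre ++ grid g m (suc n)) js ≈
                   ∏< m (λ i → pow (w i) n) * D (pre ++ grid (f ∘ suc) m (suc n)) js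
  D-add-previous pre f g w v zero    n mem e₀ e js = sym (*-identityˡ _)
  D-add-previous pre f g w v (suc m) n mem e₀ e js = begin
    D (pre ++ g 0 0 ∷ applyUpTo (g 0 ∘ suc) n ++ G) js
      ≈⟨ D-cong-row pre {b = f 1 0} (λ j _ → e₀ 0 j) (All.universal {P = λ _ → ⊤} (λ _ → tt) js) ⟩
    D (pre ++ f 1 0 ∷ applyUpTo (g 0 ∘ suc) n ++ G) js
      ≡⟨ ≡.cong (λ z → D z js) (Listₚ.++-assoc pre (f 1 0 ∷ []) _) ⟨
    D ((pre ++ f 1 0 ∷ []) ++ applyUpTo (g 0 ∘ suc) n ++ G) js
      ≈⟨ D-block-operation (pre ++ f 1 0 ∷ []) (f 1 ∘ suc) (g 0 ∘ suc) (f 0 ∘ suc) n G (w 0) (v 0)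
           (λ t j _ → e 0 t j) (λ t<n → ∈-++⁺ˡ (∈-++⁺ˡ (mem t<n)))
           (All.universal {P = λ _ → ⊤} (λ _ → tt) js) ⟩
    pow (w 0) n * D ((pre ++ f 1 0 ∷ []) ++ applyUpTo (f 1 ∘ suc) n ++ G) js
      ≡⟨ ≡.cong (λ z → pow (w 0) n * D z js) (≡.trans (Listₚ.++-assoc pre (f 1 0 ∷ []) _)
           (≡.sym (Listₚ.++-assoc pre (applyUpTo (f 1) (suc n)) G))) ⟩
    pow (w 0) n * D ((pre ++ applyUpTo (f 1) (suc n)) ++ G) js
      ≈⟨ *-congˡ (D-add-previous (pre ++ applyUpTo (f 1) (suc n)) (f ∘ suc) (g ∘ suc) (w ∘ suc) (v ∘ suc) m n
           (λ t<n → ∈-++⁺ʳ pre (∈-applyUpTo⁺ (f 1) (ℕ.s≤s t<n))) (e₀ ∘ suc) (e ∘ suc) js) ⟩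
    pow (w 0) n * (∏< m (λ i → pow (w (suc i)) n) *
      D ((pre ++ applyUpTo (f 1) (suc n)) ++ grid (f ∘ suc ∘ suc) m (suc n)) js)
      ≈⟨ *-assoc _ _ _ ⟨
    pow (w 0) n * ∏< m (λ i → pow (w (suc i)) n) *
      D ((pre ++ applyUpTo (f 1) (suc n)) ++ grid (f ∘ suc ∘ suc) m (suc n)) js
      ≡⟨ ≡.cong (λ z → pow (w 0) n * ∏< m (λ i → pow (w (suc i)) n) * D z js)
           (Listₚ.++-assoc pre (applyUpTo (f 1) (suc n)) _) ⟩
    pow (w 0) n * ∏< m (λ i → pow (w (suc i)) n) *
      D (pre ++ applyUpTo (f 1) (suc n) ++ grid (f ∘ suc ∘ suc) m (suc n)) js ∎
    where
    G = grid (g ∘ suc) m (suc n)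

  -- Here the blocks are restored from the bottom. The last one refers to a block outside the grid,
  -- which has to vanish on the labels that occur.
  D-add-next : {P : J → Set ℓ″} (pre : List (Row J)) (f g : ℕ → ℕ → Row J) (w v : ℕ → Carrier) (m n : ℕ) →
               (∀ i t j → P j → g i t j ≈ w i * f i t j + v i * f (suc i) t j) →
               (∀ t j → P j → f (suc m) t j ≈ 0#) → ∀ {js} → All P js →
               D (pre ++ grid g (suc m) n) js ≈
               ∏< (suc m) (λ i → pow (w i) n) * D (pre ++ grid f (suc m) n) js
  D-add-next pre f g w v zero n e z {js} pjs = begin
    D (pre ++ applyUpTo (g 0) n ++ []) js
      ≈⟨ D-block-scaling pre (f 0) (g 0) n [] (w 0)
           (λ t j q → trans (e 0 t j q) (trans (+-congˡ (trans (*-congˡ (z t j q)) (zeroʳ _))) (+-identityʳ _))) pjs ⟩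
    pow (w 0) n * D (pre ++ applyUpTo (f 0) n ++ []) js
      ≈⟨ *-congʳ (sym (*-identityʳ _)) ⟩
    pow (w 0) n * 1# * D (pre ++ applyUpTo (f 0) n ++ []) js ∎
  D-add-next pre f g w v (suc m) n e z {js} pjs = begin
    D (pre ++ applyUpTo (g 0) n ++ grid (g ∘ suc) (suc m) n) js
      ≡⟨ ≡.cong (λ z → D z js) (Listₚ.++-assoc pre (applyUpTo (g 0) n) _) ⟨
    D ((pre ++ applyUpTo (g 0) n) ++ grid (g ∘ suc) (suc m) n) js
      ≈⟨ D-add-next (pre ++ applyUpTo (g 0) n) (f ∘ suc) (g ∘ suc) (w ∘ suc) (v ∘ suc) m n (e ∘ suc) z pjs ⟩
    W * D ((pre ++ applyUpTo (g 0) n) ++ F) js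
      ≡⟨ ≡.cong (λ z → W * D z js) (Listₚ.++-assoc pre (applyUpTo (g 0) n) _) ⟩
    W * D (pre ++ applyUpTo (g 0) n ++ F) js
      ≈⟨ *-congˡ (D-block-operation pre (f 0) (g 0) (f 1) n F (w 0) (v 0) (e 0)
           (λ t<n → ∈-++⁺ʳ pre (∈-++⁺ˡ (∈-applyUpTo⁺ (f 1) t<n))) pjs) ⟩
    W * (pow (w 0) n * D (pre ++ applyUpTo (f 0) n ++ F) js)
      ≈⟨ trans (sym (*-assoc _ _ _)) (*-congʳ (*-comm _ _)) ⟩
    pow (w 0) n * W * D (pre ++ applyUpTo (f 0) n ++ F) js ∎
    where
    F = grid (f ∘ suc) (suc m) n
    W = ∏< (suc m) (λ i → pow (w (suc i)) n)

  -- In the transposed determinant a column label becomes the row that evaluates each given row at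
  -- this label, and `D-pull` applies.
  D-column-pull : (as : List (Row J)) (g : ℕ → ℕ → J) (m n : ℕ) →
                  D as (grid g m (suc n)) ≈
                  sgn (pullLength m n) *
                  D as (grid (λ i j → g i (suc j)) m n ++ applyUpTo (λ i → g i 0) m)
  D-column-pull as g m n = begin
    D as (grid g m (suc n))
      ≡⟨ ≡.cong (λ z → D z (grid g m (suc n))) (Listₚ.map-id as) ⟨
    D (map id as) (grid g m (suc n))
      ≈⟨ D-transpose id as (grid g m (suc n)) ⟩
    D (map (flip id) (grid g m (suc n))) as
      ≡⟨ ≡.cong (λ z → D z as) (≡.trans (map-grid (flip id) g m (suc n)) (≡.sym (Listₚ.++-identityʳ _))) ⟩
    D (grid (λ i j a → a (g i j)) m (suc n) ++ []) as
      ≈⟨ D-pull [] (λ i j a → a (g i j)) m n [] as ⟩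
    sgn (pullLength m n) *
      D (grid (λ i j a → a (g i (suc j))) m n ++ applyUpTo (λ i a → a (g i 0)) m ++ []) as
      ≡⟨ ≡.cong (λ z → sgn (pullLength m n) * D z as)
           (≡.cong₂ _++_ (≡.sym (map-grid (flip id) (λ i j → g i (suc j)) m n))
             (≡.trans (Listₚ.++-identityʳ _) (≡.sym (Listₚ.map-applyUpTo (λ i → g i 0) (flip id) m)))) ⟩
    sgn (pullLength m n) * D (map (flip id) G ++ map (flip id) L) as
      ≡⟨ ≡.cong (λ z → sgn (pullLength m n) * D z as) (Listₚ.map-++ (flip id) G L) ⟨
    sgn (pullLength m n) * D (map (flip id) (G ++ L)) as
      ≈⟨ *-congˡ (D-transpose id as (G ++ L)) ⟨
    sgn (pullLength m n) * D (map id as) (G ++ L)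
      ≡⟨ ≡.cong (λ z → sgn (pullLength m n) * D z (G ++ L)) (Listₚ.map-id as) ⟩
    sgn (pullLength m n) * D as (G ++ L) ∎
    where
    G = grid (λ i j → g i (suc j)) m n
    L = applyUpTo (λ i → g i 0) m

-- The reduction of the chain determinant

module Chain {c r} (R : CommutativeRing c r) (C : CommutativeRing.Carrier R) where
  open CommutativeRing R hiding (zero)
  open IntegerCoefficients R using (module Solver)
  open Solver using (solve; _:=_; _:+_; _:*_; _:-_; :-_; con)
  open Determinants R
  open GridOperations R
  open SetoidReasoning setoid

  -- Column (j , t) stands for z ^ j in the t-th polynomial of the chain. T is the matrix of the operator
  -- z ^ j ↦ C η_j z ^ j − ξ_j z ^ (j + 1), and equation i s is the z ^ i coefficient of
  -- T_(p s, a s) V_s + T_(q s, b s) V_(s+1). With q and b fixed, cokernel spans the functionals vanishing on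
  -- the image of the operator T of the next smaller chain.
  ξ η : (l : ℕ → Carrier) (δ p a : Carrier) → ℕ → Carrier
  ξ l δ p a i = p * l i + a
  η l δ p a i = p * (l i + δ) + a

  -- The bidiagonal pattern is defined by recursion, so that lowering both indices, which is what a
  -- reduction step does, is a definitional equality. `T` has its form for the same reason.
  sel : ℕ → ℕ → Carrier → Carrier → Carrier
  sel zero    zero          u v = u
  sel zero    (suc zero)    u v = v
  sel zero    (suc (suc t)) u v = 0#
  sel (suc s) zero          u v = 0#
  sel (suc s) (suc t)       u v = sel s t u v

  T : (l : ℕ → Carrier) (δ p a : Carrier) → ℕ → ℕ → Carrier
  T l δ p a zero    zero    = C * η l δ p a 0
  T l δ p a (suc i) zero    = sel i 0 (- ξ l δ p a 0) 0#
  T l δ p a zero    (suc j) = 0#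
  T l δ p a (suc i) (suc j) = T (l ∘ suc) δ p a i j

  equation : (l : ℕ → Carrier) (δ : Carrier) (p a q b : ℕ → Carrier) → ℕ → ℕ → Row (ℕ × ℕ)
  equation l δ p a q b i s (j , t) = sel s t (T l δ (p s) (a s) i j) (T l δ (q s) (b s) i j)

  cokernel : (l : ℕ → Carrier) (δ q b : Carrier) → ℕ → ℕ → Carrier
  cokernel l δ q b e       zero    = ∏< e (λ i → ξ l δ q b (suc i))
  cokernel l δ q b zero    (suc j) = 0#
  cokernel l δ q b (suc e) (suc j) = C * η l δ q b 0 * cokernel (l ∘ suc) δ q b e j

  top : (l : ℕ → Carrier) (δ q b : Carrier) → ℕ → Row (ℕ × ℕ)
  top l δ q b e (j , t) = sel e t (cokernel l δ q b e j) 0#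

  -- `T` raises the degree by one, so each of the e equations has e + 2 coefficients; together with
  -- the functional this makes e (e + 2) + 1 = (e + 1)² rows, as many as the columns.
  chain : (l : ℕ → Carrier) (δ : Carrier) (p a q b : ℕ → Carrier) (qₑ bₑ : Carrier) → ℕ → Carrier
  chain l δ p a q b qₑ bₑ e =
    D (top l δ qₑ bₑ e ∷ grid (equation l δ p a q b) (suc (suc e)) e) (grid _,_ (suc e) (suc e))

  sel-linear : ∀ s t {k k′ w w′ u u′ v v′ f f′ g g′} →
               k * u + k′ * u′ ≈ w * f + w′ * f′ → k * v + k′ * v′ ≈ w * g + w′ * g′ →
               k * sel s t u v + k′ * sel s t u′ v′ ≈ w * sel s t f g + w′ * sel s t f′ g′
  sel-linear zero    zero          hu hv = hu
  sel-linear zero    (suc zero)    hu hv = hv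
  sel-linear zero    (suc (suc t)) hu hv =
    solve 4 (λ a b c d → a :* con (+ 0) :+ b :* con (+ 0) := c :* con (+ 0) :+ d :* con (+ 0)) refl _ _ _ _
  sel-linear (suc s) zero          hu hv =
    solve 4 (λ a b c d → a :* con (+ 0) :+ b :* con (+ 0) := c :* con (+ 0) :+ d :* con (+ 0)) refl _ _ _ _
  sel-linear (suc s) (suc t)       hu hv = sel-linear s t hu hv

  sel-below : ∀ {s t} → s ℕ.< t → ∀ {u} → sel s t u 0# ≈ 0#
  sel-below {zero}  {suc zero}    _           = refl
  sel-below {zero}  {suc (suc t)} _           = refl
  sel-below {suc s} {suc t}       (ℕ.s≤s s<t) = sel-below s<t

  sel-beyond : ∀ {s t} → suc s ℕ.< t → ∀ {u v} → sel s t u v ≈ 0#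
  sel-beyond {zero}  {suc (suc t)} _           = refl
  sel-beyond {zero}  {suc zero}    (ℕ.s≤s ())
  sel-beyond {suc s} {suc t}       (ℕ.s≤s s<t) = sel-beyond s<t

  sel-diagonal : ∀ s {u v} → sel s s u v ≡ u
  sel-diagonal zero    = ≡.refl
  sel-diagonal (suc s) = sel-diagonal s

  sel-superdiagonal : ∀ s {u v} → sel s (suc s) u v ≡ v
  sel-superdiagonal zero    = ≡.refl
  sel-superdiagonal (suc s) = sel-superdiagonal s

  sel-0 : ∀ s t {u v} → u ≈ 0# → v ≈ 0# → sel s t u v ≈ 0#
  sel-0 zero    zero          hu hv = hu
  sel-0 zero    (suc zero)    hu hv = hv
  sel-0 zero    (suc (suc t)) hu hv = refl
  sel-0 (suc s) zero          hu hv = refl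
  sel-0 (suc s) (suc t)       hu hv = sel-0 s t hu hv

  module Substitution (p a δ δ′ : Carrier) where

    -- Apart from the column of z ^ 0, the new columns t + 1 form the image of the smaller operator
    -- T′ (l shifted, δ′ for δ) of (p , a). Since T_β T′_α = T_α T′_β, the equations become divisible by T_α;
    -- σ gives the coordinates of the columns in the basis 1, T_α 1, T_α z, ….
    hat : (l : ℕ → Carrier) → Row (ℕ × ℕ) → Row (ℕ × ℕ)
    hat l ρ (j     , zero)  = ρ (j , 0)
    hat l ρ (zero  , suc t) = - ξ l δ p a 0 * ρ (0 , suc t)
    hat l ρ (suc j , suc t) = - ξ l δ p a (suc j) * ρ (suc j , suc t) + C * η l δ p a j * ρ (j , suc t)

    -- Leading coefficients of the basis 1, T_α 1, T_α z, ..., that is, the diagonal of the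
    -- triangular change of basis.
    w : (l : ℕ → Carrier) → ℕ → Carrier
    w l zero    = 1#
    w l (suc i) = - ξ l δ p a i

    σ₀ : ℕ → ℕ → Carrier
    σ₀ zero    j = 0#
    σ₀ (suc i) j = sel i j 1# 0#

    σ : (l : ℕ → Carrier) (q b : Carrier) → ℕ → ℕ → Carrier
    σ l q b zero          zero    = C * δ * (p * b - q * a)
    σ l q b zero          (suc j) = 0#
    σ l q b (suc i)       zero    = sel i 0 (- ξ l δ q b 0) 0#
    σ l q b (suc i)       (suc j) = T (l ∘ suc) δ′ q b i j

    -- T_α z^j is itself the basis vector number j + 1.
    T-σ₀ : ∀ l i j → T l δ p a i j ≈ w l i * σ₀ i j + C * η l δ p a i * σ₀ (suc i) j
    T-σ₀ l zero          zero    = sym (trans (+-cong (zeroʳ _) (*-identityʳ _)) (+-identityˡ _))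
    T-σ₀ l zero          (suc j) = sym (trans (+-cong (zeroʳ _) (trans (*-congˡ (sel-below {0} {suc j} (ℕ.s≤s ℕ.z≤n))) (zeroʳ _)))
      (+-identityˡ _))
    T-σ₀ l (suc zero)    zero    = sym (trans (+-cong (*-identityʳ _) (zeroʳ _)) (+-identityʳ _))
    T-σ₀ l (suc (suc i)) zero    = sym (trans (+-cong (zeroʳ _) (zeroʳ _)) (+-identityˡ _))
    T-σ₀ l (suc zero)    (suc j) = trans (T-σ₀ (l ∘ suc) zero j)
      (+-congʳ (trans (zeroʳ _) (sym (trans (*-congˡ (sel-below {0} {suc j} (ℕ.s≤s ℕ.z≤n))) (zeroʳ _)))))
    T-σ₀ l (suc (suc i)) (suc j) = T-σ₀ (l ∘ suc) (suc i) j

    -- Conjugating T_α with multiplication by C - z replaces ξ_i by ξ_(i+1) and keeps η_i. In terms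
    -- of the parameters this is a shift of l that is compensated in δ.
    Step : (ℕ → Carrier) → Set _
    Step l = ∀ i → l (suc i) + δ′ ≈ l i + δ

    y-shift : ∀ {l} → Step l → ∀ q b → η (l ∘ suc) δ′ q b 0 ≈ η l δ q b 0
    y-shift H q b = +-congʳ (*-congˡ (H 0))

    -- This is T_β T′_α = T_α T′_β, applied to z^j and read at z^i. Only the coefficient of z^(j+1)
    -- is not immediate: it says that η_i(α) ξ_i(β) - ξ_i(α) η_i(β) has the same value for i = j and
    -- i = j + 1.
    T-σ-suc : ∀ {l} → Step l → ∀ q b i j →
              - ξ l δ p a (suc j) * T l δ q b i (suc j) + C * η l δ p a j * T l δ q b i j ≈
              w l i * σ l q b i (suc j) + C * η l δ p a i * σ l q b (suc i) (suc j)
    T-σ-suc {l} H q b zero zero = begin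
      - ξ l δ p a 1 * 0# + C * η l δ p a 0 * (C * η l δ q b 0)
        ≈⟨ +-cong (zeroʳ _) (*-congˡ (*-congˡ (sym (y-shift {l} H q b)))) ⟩
      0# + C * η l δ p a 0 * (C * η (l ∘ suc) δ′ q b 0)
        ≈⟨ +-congʳ (sym (zeroʳ _)) ⟩
      1# * 0# + C * η l δ p a 0 * (C * η (l ∘ suc) δ′ q b 0) ∎
    T-σ-suc {l} H q b (suc zero) zero = begin
      - (p * l 1 + a) * (C * (q * (l 1 + δ) + b)) + C * (p * (l 0 + δ) + a) * - (q * l 0 + b)
        ≈⟨ solve 8 (λ l₀ l₁ δ p a q b C →
             :- (p :* l₁ :+ a) :* (C :* (q :* (l₁ :+ δ) :+ b)) :+ C :* (p :* (l₀ :+ δ) :+ a) :* :- (q :* l₀ :+ b)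
             := :- (p :* l₀ :+ a) :* (C :* (q :* (l₀ :+ δ) :+ b)) :+ C :* (p :* (l₁ :+ δ) :+ a) :* :- (q :* l₁ :+ b))
             refl (l 0) (l 1) δ p a q b C ⟩
      - (p * l 0 + a) * (C * (q * (l 0 + δ) + b)) + C * (p * (l 1 + δ) + a) * - (q * l 1 + b)
        ≈⟨ +-congʳ (*-congˡ (*-congˡ (y-shift {l} H q b))) ⟨
      - ξ l δ p a 0 * (C * η (l ∘ suc) δ′ q b 0) + C * η l δ p a 1 * - ξ (l ∘ suc) δ′ q b 0 ∎
    T-σ-suc {l} H q b (suc (suc zero)) zero =
      trans (+-congˡ (zeroʳ _)) (+-congˡ (sym (zeroʳ _)))
    T-σ-suc {l} H q b (suc (suc (suc i))) zero =
      solve 4 (λ a b c d → a :* con (+ 0) :+ b :* con (+ 0) := c :* con (+ 0) :+ d :* con (+ 0)) refl _ _ _ _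
    T-σ-suc {l} H q b zero (suc j) =
      solve 4 (λ a b c d → a :* con (+ 0) :+ b :* con (+ 0) := c :* con (+ 0) :+ d :* con (+ 0)) refl _ _ _ _
    T-σ-suc {l} H q b (suc zero) (suc j) = trans (T-σ-suc {l ∘ suc} (H ∘ suc) q b zero j)
      (+-congʳ (trans (zeroʳ _) (sym (zeroʳ _))))
    T-σ-suc {l} H q b (suc (suc i)) (suc j) = T-σ-suc {l ∘ suc} (H ∘ suc) q b (suc i) j

    -- The constant 1 is not in the image of T′_α, so here T_β 1 is not divisible by T_α. The factor
    -- -ξ_0 of the column permits eliminating z with T_α 1, and the remainder is the constant C δ
    -- [α , β].
    T-σ-zero : ∀ l q b i →
               - ξ l δ p a 0 * T l δ q b i 0 ≈ w l i * σ l q b i 0 + C * η l δ p a i * σ l q b (suc i) 0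
    T-σ-zero l q b zero = trans (solve 7 (λ l δ p a q b C →
      :- (p :* l :+ a) :* (C :* (q :* (l :+ δ) :+ b)) :=
      C :* δ :* (p :* b :- q :* a) :+ C :* (p :* (l :+ δ) :+ a) :* :- (q :* l :+ b))
      refl (l 0) δ p a q b C) (+-congʳ (sym (*-identityˡ _)))
    T-σ-zero l q b (suc zero)    = sym (trans (+-congˡ (zeroʳ _)) (+-identityʳ _))
    T-σ-zero l q b (suc (suc i)) = trans (zeroʳ _) (sym (trans (+-cong (zeroʳ _) (zeroʳ _)) (+-identityʳ _)))

    -- The polynomial with t = 0 is not substituted and occurs only in the equation s = 0, through
    -- T_α itself; hence the unit vectors `σ₀`.
    new : (l : ℕ → Carrier) (p a q b : ℕ → Carrier) → ℕ → ℕ → Row (ℕ × ℕ)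
    new l p a q b i s (j , zero)  = sel s 0 (σ₀ i j) 0#
    new l p a q b i s (j , suc t) = sel s (suc t) (σ l (p s) (a s) i j) (σ l (q s) (b s) i j)

    -- Neighbouring coefficients of the functional have ratio C η_j(β) : ξ_(j+1)(β), which makes it
    -- vanish on T′_β z^j. On T′_α z^j the common factors leave the minor of α and β at index j of
    -- the shifted l, which is δ′ [α , β].
    cokernel-recursion : ∀ {l} → Step l → ∀ q b e j → j ℕ.≤ e →
      - ξ l δ p a (suc j) * cokernel l δ q b (suc e) (suc j) + C * η l δ p a j * cokernel l δ q b (suc e) j ≈
      C * δ′ * (p * b - q * a) * cokernel (l ∘ suc) δ′ q b e j
    cokernel-recursion {l} H q b e zero _ = begin
      - (p * l 1 + a) * (C * (q * (l 0 + δ) + b) * K) + C * (p * (l 0 + δ) + a) * ((q * l 1 + b) * K)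
        ≈⟨ +-cong (*-congˡ (*-congʳ (*-congˡ (+-congʳ (*-congˡ (H 0))))))
                  (*-congʳ (*-congˡ (+-congʳ (*-congˡ (H 0))))) ⟨
      - (p * l 1 + a) * (C * (q * (l 1 + δ′) + b) * K) + C * (p * (l 1 + δ′) + a) * ((q * l 1 + b) * K)
        ≈⟨ solve 8 (λ l δ p a q b C K →
             :- (p :* l :+ a) :* (C :* (q :* (l :+ δ) :+ b) :* K) :+ C :* (p :* (l :+ δ) :+ a) :* ((q :* l :+ b) :* K)
             := C :* δ :* (p :* b :- q :* a) :* K) refl (l 1) δ′ p a q b C K ⟩
      C * δ′ * (p * b - q * a) * K ∎
      where
      K = ∏< e (λ i → ξ l δ q b (suc (suc i)))
    cokernel-recursion {l} H q b (suc e) (suc j) (ℕ.s≤s j≤e) = begin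
      - X * (Y * k₁) + Y′ * (Y * k₀)
        ≈⟨ solve 5 (λ X Y Y′ k₁ k₀ → :- X :* (Y :* k₁) :+ Y′ :* (Y :* k₀) := Y :* (:- X :* k₁ :+ Y′ :* k₀))
             refl X Y Y′ k₁ k₀ ⟩
      Y * (- X * k₁ + Y′ * k₀)
        ≈⟨ *-cong (*-congˡ (sym (y-shift {l} H q b))) (cokernel-recursion {l ∘ suc} (H ∘ suc) q b e j j≤e) ⟩
      C * η (l ∘ suc) δ′ q b 0 * (C * δ′ * (p * b - q * a) * k′)
        ≈⟨ solve 3 (λ a b c → a :* (b :* c) := b :* (a :* c)) refl _ _ k′ ⟩
      C * δ′ * (p * b - q * a) * (C * η (l ∘ suc) δ′ q b 0 * k′) ∎
      where
      X = ξ l δ p a (suc (suc j))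
      Y = C * η l δ q b 0
      Y′ = C * η l δ p a (suc j)
      k₁ = cokernel (l ∘ suc) δ q b (suc e) (suc j)
      k₀ = cokernel (l ∘ suc) δ q b (suc e) j
      k′ = cokernel (l ∘ suc ∘ suc) δ′ q b e j

  module Reduction (l : ℕ → Carrier) (δ δ′ : Carrier) (H : ∀ i → l (suc i) + δ′ ≈ l i + δ)
                   (p a q b : ℕ → Carrier) (qₑ bₑ : Carrier) (m : ℕ) where
    open Substitution (p 0) (a 0) δ δ′

    d = suc (suc m)

    xs : ℕ → Carrier
    xs = ξ l δ (p 0) (a 0)

    -- Determinant of the column substitution: -ξ_i once for each degree i and each of the m + 1
    -- polynomials after the first. The change of basis of the rows, for m + 1 equations, has the
    -- same determinant.
    weight : Carrier
    weight = ∏< d (λ i → pow (- xs i) (suc m))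

    tp : Row (ℕ × ℕ)
    tp = top l δ qₑ bₑ (suc m)

    eq nw : ℕ → ℕ → Row (ℕ × ℕ)
    eq = equation l δ p a q b
    nw = new l p a q b

    cols : List (ℕ × ℕ)
    cols = grid _,_ d d

    column-operations : weight * chain l δ p a q b qₑ bₑ (suc m) ≈
                        D (hat l tp ∷ grid (λ i s → hat l (eq i s)) (suc d) (suc m)) cols
    column-operations = begin
      weight * D ρs cols
        ≡⟨ ≡.cong (λ z → weight * D z cols) (Listₚ.map-id ρs) ⟨
      weight * D (map id ρs) cols
        ≈⟨ *-congˡ (D-transpose id ρs cols) ⟩
      weight * D (map (flip id) cols) ρs
        ≡⟨ ≡.cong (λ z → weight * D z ρs) (map-grid (flip id) _,_ d d) ⟩
      weight * D (grid f d d) ρs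
        ≈⟨ *-assoc _ _ _ ⟩
      pow (- xs 0) (suc m) * (∏< (suc m) (λ i → pow (- xs (suc i)) (suc m)) * D (grid f d d) ρs)
        -- The columns of z^0 enter the new columns of degree 1 in their unscaled form, so their own
        -- scaling by -ξ_0 is a separate operation.
        ≈⟨ *-congˡ (D-add-previous (applyUpTo (f 0) d) f (g ∘ suc)
             (λ i → - xs (suc i)) (λ i → C * η l δ (p 0) (a 0) i) (suc m) (suc m)
             (λ t<n → ∈-applyUpTo⁺ (f 0) (ℕ.s≤s t<n)) (λ _ _ → refl) (λ _ _ _ → refl) ρs) ⟨
      pow (- xs 0) (suc m) * D (f 0 0 ∷ applyUpTo (f 0 ∘ suc) (suc m) ++ grid (g ∘ suc) (suc m) d) ρs
        ≈⟨ D-block-scaling (f 0 0 ∷ []) (f 0 ∘ suc) (g 0 ∘ suc) (suc m) (grid (g ∘ suc) (suc m) d) (- xs 0)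
             (λ _ _ _ → refl) (All.universal {P = λ _ → ⊤} (λ _ → tt) ρs) ⟨
      D (grid g d d) ρs
        ≡⟨ ≡.cong (λ z → D z ρs) (map-grid (flip (hat l)) _,_ d d) ⟨
      D (map (flip (hat l)) cols) ρs
        ≈⟨ D-transpose (hat l) ρs cols ⟨
      D (map (hat l) ρs) cols
        ≡⟨ ≡.cong (λ z → D (hat l tp ∷ z) cols) (map-grid (hat l) eq (suc d) (suc m)) ⟩
      D (hat l tp ∷ grid (λ i s → hat l (eq i s)) (suc d) (suc m)) cols ∎
      where
      ρs = tp ∷ grid eq (suc d) (suc m)
      f g : ℕ → ℕ → Row (Row (ℕ × ℕ))
      f j t ρ = ρ (j , t)
      g j t ρ = hat l ρ (j , t)

    hat-equation : ∀ i s j → hat l (eq i s) j ≈ w l i * nw i s j + C * η l δ (p 0) (a 0) i * nw (suc i) s j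
    hat-equation i zero    (j , zero)      = T-σ₀ l i j
    hat-equation i (suc s) (j , zero)      = sym (trans (+-cong (zeroʳ _) (zeroʳ _)) (+-identityʳ _))
    -- A column of degree 0 has only one term; a zero term is added to reach the two-term form of
    -- `sel-linear`.
    hat-equation i s       (zero , suc t)  = trans (sym (+-identityʳ _)) (trans (+-congˡ (sym (zeroˡ _)))
      (sel-linear s (suc t) {k′ = 0#} {u′ = 0#} {v′ = 0#}
        (trans (trans (+-congˡ (zeroˡ _)) (+-identityʳ _)) (T-σ-zero l (p s) (a s) i))
        (trans (trans (+-congˡ (zeroˡ _)) (+-identityʳ _)) (T-σ-zero l (q s) (b s) i))))
    hat-equation i s       (suc j , suc t) =
      sel-linear s (suc t) (T-σ-suc {l} H (p s) (a s) i j) (T-σ-suc {l} H (q s) (b s) i j)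

    row-operations : D (hat l tp ∷ grid (λ i s → hat l (eq i s)) (suc d) (suc m)) cols ≈
                     weight * D (hat l tp ∷ grid nw (suc d) (suc m)) cols
    row-operations = begin
      D (hat l tp ∷ grid (λ i s → hat l (eq i s)) (suc d) (suc m)) cols
        -- The basis of the target ends with number d. A coordinate number d + 1 would belong to T_α
        -- z^d, and it vanishes on all labels of degree below d.
        ≈⟨ D-add-next {P = λ (j , _) → j ℕ.< d} (hat l tp ∷ []) nw (λ i s → hat l (eq i s)) (w l)
             (λ i → C * η l δ (p 0) (a 0) i) d (suc m)
             (λ i s j _ → hat-equation i s j) outside (All-grid _,_ d d (λ j<d _ → j<d)) ⟩
      pow 1# (suc m) * weight * D (hat l tp ∷ grid nw (suc d) (suc m)) cols
        ≈⟨ *-congʳ (trans (*-congʳ (pow-1 (suc m))) (*-identityˡ _)) ⟩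
      weight * D (hat l tp ∷ grid nw (suc d) (suc m)) cols ∎
      where
      pow-1 : ∀ n → pow 1# n ≈ 1#
      pow-1 zero    = refl
      pow-1 (suc n) = trans (*-identityˡ _) (pow-1 n)

      sel-< : ∀ {i j} → j ℕ.< i → ∀ {u v} → sel i j u v ≈ 0#
      sel-< {suc i} {zero}  _           = refl
      sel-< {suc i} {suc j} (ℕ.s≤s j<i) = sel-< j<i

      T-< : ∀ {i j} → suc j ℕ.< i → ∀ l {δ q b} → T l δ q b i j ≈ 0#
      T-< {suc (suc i)} {zero}  _           l = refl
      T-< {suc i}       {suc j} (ℕ.s≤s j<i) l = T-< j<i (l ∘ suc)
      T-< {suc zero}    {zero}  (ℕ.s≤s ())  l

      outside : ∀ s ((j , t) : ℕ × ℕ) → j ℕ.< d → nw (suc d) s (j , t) ≈ 0#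
      outside s (j     , zero)  j<d           = sel-0 s 0 (sel-< j<d) refl
      outside s (zero  , suc t) j<d           = sel-0 s (suc t) refl refl
      outside s (suc j , suc t) j<d = sel-0 s (suc t) (T-< j<d (l ∘ suc)) (T-< j<d (l ∘ suc))

    -- In this order the matrix is block lower triangular. `first` collects the coordinates along 1,
    -- that is, along the cokernel of T_α, and `last` the other coordinates of the equation s = 0,
    -- which determine the unsubstituted polynomial.
    first inner last : List (Row (ℕ × ℕ))
    first = applyUpTo (nw 0) (suc m)
    inner = hat l tp ∷ grid (λ i s → nw (suc i) (suc s)) d m
    last  = applyUpTo (λ i → nw (suc i) 0) d

    first′ inner′ last′ : List (ℕ × ℕ)
    first′ = applyUpTo (λ t → 0 , suc t) (suc m)
    inner′ = grid (λ j t → suc j , suc t) (suc m) (suc m)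
    last′  = applyUpTo (λ j → j , 0) d

    reordering : D (hat l tp ∷ grid nw (suc d) (suc m)) cols ≈
                 sgn (signExponent m) * D (first ++ inner ++ last) (first′ ++ inner′ ++ last′)
    reordering = begin
      D (hat l tp ∷ first ++ grid (nw ∘ suc) d (suc m)) cols
        ≈⟨ D-move (hat l tp) first (grid (nw ∘ suc) d (suc m)) cols ⟩
      sgn (length first) * D (first ++ hat l tp ∷ grid (nw ∘ suc) d (suc m)) cols
        ≡⟨ ≡.cong₂ (λ k z → sgn k * D z cols) (Listₚ.length-applyUpTo (nw 0) (suc m))
             (≡.trans (≡.cong (λ z → first ++ hat l tp ∷ z) (≡.sym (Listₚ.++-identityʳ _)))
                      (≡.sym (Listₚ.++-assoc first (hat l tp ∷ []) _))) ⟩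
      sgn (suc m) * D ((first ++ hat l tp ∷ []) ++ grid (nw ∘ suc) d (suc m) ++ []) cols
        ≈⟨ *-congˡ (D-pull (first ++ hat l tp ∷ []) (nw ∘ suc) d m [] cols) ⟩
      sgn (suc m) * (sgn (pullLength d m) * D ((first ++ hat l tp ∷ []) ++
        grid (λ i s → nw (suc i) (suc s)) d m ++ last ++ []) cols)
        ≡⟨ ≡.cong (λ z → sgn (suc m) * (sgn (pullLength d m) * D z cols))
             (≡.trans (Listₚ.++-assoc first (hat l tp ∷ []) _)
                      (≡.cong (λ z → first ++ inner ++ z) (Listₚ.++-identityʳ last))) ⟩
      sgn (suc m) * (sgn (pullLength d m) * D (first ++ inner ++ last) cols)
        ≈⟨ *-congˡ (*-congˡ (D-column-pull (first ++ inner ++ last) _,_ d (suc m))) ⟩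
      sgn (suc m) * (sgn (pullLength d m) * (sgn (pullLength d (suc m)) *
        D (first ++ inner ++ last) ((first′ ++ inner′) ++ last′)))
        ≡⟨ ≡.cong (λ z → sgn (suc m) * (sgn (pullLength d m) * (sgn (pullLength d (suc m)) *
             D (first ++ inner ++ last) z))) (Listₚ.++-assoc first′ inner′ last′) ⟩
      sgn (suc m) * (sgn (pullLength d m) * (sgn (pullLength d (suc m)) *
        D (first ++ inner ++ last) (first′ ++ inner′ ++ last′)))
        ≈⟨ solve 4 (λ a b c x → a :* (b :* (c :* x)) := a :* (b :* c) :* x) refl _ _ _ _ ⟩
      sgn (suc m) * (sgn (pullLength d m) * sgn (pullLength d (suc m))) *
        D (first ++ inner ++ last) (first′ ++ inner′ ++ last′)
        ≈⟨ *-congʳ (trans (sgn-+ (suc m) _) (*-congˡ (sgn-+ (pullLength d m) _))) ⟨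
      sgn (signExponent m) * D (first ++ inner ++ last) (first′ ++ inner′ ++ last′) ∎

    -- The columns start with the second polynomial. Hence the diagonal consists of the
    -- superdiagonal entries, with the brackets [α_0 , β_s], while the brackets [α_0 , α_s] fall
    -- below it.
    D-first : D first first′ ≈ ∏< (suc m) (λ s → C * δ * (p 0 * b s - q s * a 0))
    D-first = trans
      (D-triangular (nw 0) (λ t → 0 , suc t) (suc m) (λ {s} {t} s<t → sel-beyond {s} {suc t} (ℕ.s≤s s<t)))
      (∏<-cong (suc m) {g = λ s → C * δ * (p 0 * b s - q s * a 0)} (λ s → reflexive
        (sel-superdiagonal s {C * δ * (p 0 * a s - p s * a 0)} {C * δ * (p 0 * b s - q s * a 0)})))

    D-last : D last last′ ≈ 1#
    D-last = trans
      (D-triangular (λ i → nw (suc i) 0) (λ j → j , 0) d (λ {s} {t} s<t → sel-below {s} {t} s<t))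
      (∏<-1 d (λ i → reflexive (sel-diagonal i {1#} {0#})))
      where
      ∏<-1 : ∀ n {f} → (∀ i → f i ≈ 1#) → ∏< n f ≈ 1#
      ∏<-1 zero    h = refl
      ∏<-1 (suc n) h = trans (*-cong (h 0) (∏<-1 n (h ∘ suc))) (*-identityˡ _)

    smaller : Carrier
    smaller = chain (l ∘ suc) δ′ (p ∘ suc) (a ∘ suc) (q ∘ suc) (b ∘ suc) qₑ bₑ m

    factorₑ : Carrier
    factorₑ = C * δ′ * (p 0 * bₑ - qₑ * a 0)

    D-inner : D inner inner′ ≈ factorₑ * smaller
    D-inner = begin
      D inner inner′
        ≡⟨ ≡.cong (D inner) (map-grid shift _,_ (suc m) (suc m)) ⟨
      D inner (map shift (grid _,_ (suc m) (suc m)))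
        ≈⟨ D-relabel shift inner (grid _,_ (suc m) (suc m)) ⟩
      D (hat l tp ∘ shift ∷ map (_∘ shift) (grid (λ i s → nw (suc i) (suc s)) d m)) (grid _,_ (suc m) (suc m))
        ≡⟨ ≡.cong (λ z → D (hat l tp ∘ shift ∷ z) (grid _,_ (suc m) (suc m)))
             (map-grid (_∘ shift) (λ i s → nw (suc i) (suc s)) d m) ⟩
      D (hat l tp ∘ shift ∷ grid (λ i s → nw (suc i) (suc s) ∘ shift) d m) (grid _,_ (suc m) (suc m))
        ≈⟨ D-row-scaling {P = λ (j , _) → j ℕ.< suc m} [] (grid (λ i s → nw (suc i) (suc s) ∘ shift) d m)
             factorₑ hat-top (All-grid _,_ (suc m) (suc m) (λ j<m _ → j<m)) ⟩
      factorₑ * smaller ∎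
      where
      shift : ℕ × ℕ → ℕ × ℕ
      shift (j , t) = suc j , suc t

      hat-top : ∀ ((j , t) : ℕ × ℕ) → j ℕ.< suc m →
                hat l tp (suc j , suc t) ≈ factorₑ * top (l ∘ suc) δ′ qₑ bₑ m (j , t)
      hat-top (j , t) (ℕ.s≤s j≤m) = trans
        (sel-linear m t {w = factorₑ} {w′ = 0#} {f′ = 0#} {g′ = 0#}
          (trans (cokernel-recursion {l} H qₑ bₑ m j j≤m) (trans (sym (+-identityʳ _)) (+-congˡ (sym (zeroˡ _)))))
          (solve 3 (λ a b c → a :* con (+ 0) :+ b :* con (+ 0) := c :* con (+ 0) :+ con (+ 0) :* con (+ 0)) refl _ _ _))
        (trans (+-congˡ (zeroˡ _)) (+-identityʳ _))

    -- Stated with `weight` on both sides, because over an arbitrary ring it cannot be cancelled.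
    reduction : weight * chain l δ p a q b qₑ bₑ (suc m) ≈
                weight * (sgn (signExponent m) * (∏< (suc m) (λ s → C * δ * (p 0 * b s - q s * a 0)) * (factorₑ * smaller)))
    reduction = trans column-operations (trans row-operations (*-congˡ (trans reordering (*-congˡ (begin
      D (first ++ inner ++ last) (first′ ++ inner′ ++ last′)
        ≈⟨ D-block-triangular first (inner ++ last) first′ (inner′ ++ last′) length-first
             (≡.trans (Listₚ.length-++ inner) (≡.trans (≡.cong₂ ℕ._+_ length-inner length-last)
               (≡.sym (Listₚ.length-++ inner′))))
             (Allₚ.applyUpTo⁺₂ (nw 0) (suc m) (λ s → Allₚ.++⁺
               (All-grid (λ j t → suc j , suc t) (suc m) (suc m) (λ {_} {t} _ _ → sel-0 s (suc t) refl refl))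
               (Allₚ.applyUpTo⁺₂ (λ j → j , 0) d (λ j → sel-0 s 0 refl refl)))) ⟩
      D first first′ * D (inner ++ last) (inner′ ++ last′)
        ≈⟨ *-cong D-first (D-block-triangular inner last inner′ last′ length-inner length-last
             (Allₚ.applyUpTo⁺₂ (λ j → j , 0) d (λ j → refl) ∷
              All-grid (λ i s → nw (suc i) (suc s)) d m (λ _ _ → Allₚ.applyUpTo⁺₂ (λ j → j , 0) d (λ j → refl)))) ⟩
      ∏< (suc m) (λ s → C * δ * (p 0 * b s - q s * a 0)) * (D inner inner′ * D last last′)
        ≈⟨ *-congˡ (trans (*-cong D-inner D-last) (*-identityʳ _)) ⟩
      ∏< (suc m) (λ s → C * δ * (p 0 * b s - q s * a 0)) * (factorₑ * smaller) ∎)))))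
      where
      length-first : length first ≡ length first′
      length-first = ≡.trans (Listₚ.length-applyUpTo (nw 0) (suc m))
                             (≡.sym (Listₚ.length-applyUpTo (λ t → 0 , suc t) (suc m)))
      length-last : length last ≡ length last′
      length-last = ≡.trans (Listₚ.length-applyUpTo (λ i → nw (suc i) 0) d)
                            (≡.sym (Listₚ.length-applyUpTo (λ j → j , 0) d))
      length-inner : length inner ≡ length inner′
      length-inner = ≡.trans (≡.trans (≡.cong suc (length-grid (λ i s → nw (suc i) (suc s)) d m)) (arithmetic m))
                             (≡.sym (length-grid (λ j t → suc j , suc t) (suc m) (suc m)))
        where
        arithmetic : ∀ m → suc (suc (suc m) ℕ.* m) ≡ suc m ℕ.* suc m
        arithmetic = ℕSolver.solve-∀

-- Cancelling the substitution

module Regularity {c r} (R : CommutativeRing c r) where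
  open CommutativeRing R hiding (zero)
  open IntegerCoefficients R using (module Solver)
  open Solver using (solve; _:=_; _:*_; :-_)
  open Determinants R using (pow; ∏<)
  open SetoidReasoning setoid

  Regular : Carrier → Set _
  Regular u = ∀ v w → u * v ≈ u * w → v ≈ w

  regular-* : ∀ {u v} → Regular u → Regular v → Regular (u * v)
  regular-* {u} {v} hu hv s t e = hv s t (hu (v * s) (v * t)
    (trans (sym (*-assoc u v s)) (trans e (*-assoc u v t))))

  regular-1 : Regular 1#
  regular-1 s t e = trans (sym (*-identityˡ s)) (trans e (*-identityˡ t))

  regular-neg : ∀ {u} → Regular u → Regular (- u)
  regular-neg {u} hu s t e = hu s t (begin
    u * s        ≈⟨ solve 2 (λ u s → u :* s := :- (:- u :* s)) refl u s ⟩
    - (- u * s)  ≈⟨ -‿cong e ⟩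
    - (- u * t)  ≈⟨ solve 2 (λ u s → u :* s := :- (:- u :* s)) refl u t ⟨
    u * t        ∎)

  regular-pow : ∀ {u} n → Regular u → Regular (pow u n)
  regular-pow zero    hu = regular-1
  regular-pow (suc n) hu = regular-* hu (regular-pow n hu)

  regular-∏< : ∀ n {f} → (∀ i → Regular (f i)) → Regular (∏< n f)
  regular-∏< zero    h = regular-1
  regular-∏< (suc n) h = regular-* (h 0) (regular-∏< n (h ∘ suc))

module RegularChain {c r} (R : CommutativeRing c r) (C : CommutativeRing.Carrier R) where
  open CommutativeRing R hiding (zero)
  open Determinants R
  open Regularity R
  open Chain R C
  open RingProperties ring using (-0#≈0#)

  -- What the iteration of `reduction` leaves once every `weight` is cancelled. δ has become a
  -- sequence, since it changes at each step.
  value : (δ : ℕ → Carrier) (p a q b : ℕ → Carrier) (qₑ bₑ : Carrier) → ℕ → Carrier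
  value δ p a q b qₑ bₑ zero    = 1#
  value δ p a q b qₑ bₑ (suc m) =
    sgn (signExponent m) * (∏< (suc m) (λ s → C * δ (suc m) * (p 0 * b s - q s * a 0)) *
      (C * δ m * (p 0 * bₑ - qₑ * a 0) * value δ (p ∘ suc) (a ∘ suc) (q ∘ suc) (b ∘ suc) qₑ bₑ m))

  chain-regular : ∀ e (l δ p a q b : ℕ → Carrier) (qₑ bₑ : Carrier) →
                  (∀ i m → l (suc i) + δ m ≈ l i + δ (suc m)) →
                  (∀ s i → Regular (p s * l i + a s)) →
                  chain l (δ e) p a q b qₑ bₑ e ≈ value δ p a q b qₑ bₑ e
  chain-regular zero    l δ p a q b qₑ bₑ H reg =
    trans (+-cong (*-identityʳ _) -0#≈0#) (+-identityʳ _)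
  chain-regular (suc m) l δ p a q b qₑ bₑ H reg = trans
    (regular-∏< (suc (suc m)) {λ i → pow (- xs i) (suc m)} (λ i → regular-pow (suc m) (regular-neg (reg 0 i))) _ _ reduction)
    (*-congˡ (*-congˡ (*-congˡ
      (chain-regular m (l ∘ suc) δ (p ∘ suc) (a ∘ suc) (q ∘ suc) (b ∘ suc) qₑ bₑ (H ∘ suc) (λ s → reg (suc s) ∘ suc)))))
    where open Reduction l (δ (suc m)) (δ m) (λ i → H i m) p a q b qₑ bₑ m

-- Compatibility with ring homomorphisms

module ChainHomomorphism {c₁ r₁ c₂ r₂} (S : CommutativeRing c₁ r₁) (R : CommutativeRing c₂ r₂)
  (f : CommutativeRing.Carrier S → CommutativeRing.Carrier R)
  (f-hom : RingMorphisms.IsRingHomomorphism (CommutativeRing.rawRing S) (CommutativeRing.rawRing R) f) where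
  private
    module S where
      open CommutativeRing S public
      open Determinants S public
      open RegularChain S public
      open Chain S public
  open CommutativeRing R hiding (zero)
  open Determinants R
  open RegularChain R using (value)
  open Chain R
  open RingMorphisms.IsRingHomomorphism f-hom

  private
    variable
      J : Set ℓ

  infix 4 _~_
  -- The relation is preserved by every construction above, since all are ring expressions in their
  -- parameters. It serves both the specialisation of R[x] to R and the passage from the integers to
  -- R.
  _~_ : S.Carrier → Carrier → Set r₂
  u ~ v = f u ≈ v

  ~-+ : ∀ {u v u′ v′} → u ~ u′ → v ~ v′ → u S.+ v ~ u′ + v′
  ~-+ h h′ = trans (+-homo _ _) (+-cong h h′)

  ~-* : ∀ {u v u′ v′} → u ~ u′ → v ~ v′ → u S.* v ~ u′ * v′
  ~-* h h′ = trans (*-homo _ _) (*-cong h h′)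

  ~-neg : ∀ {u u′} → u ~ u′ → S.- u ~ - u′
  ~-neg h = trans (-‿homo _) (-‿cong h)

  ~-- : ∀ {u v u′ v′} → u ~ u′ → v ~ v′ → u S.- v ~ u′ - v′
  ~-- h h′ = ~-+ h (~-neg h′)

  ~-∂ : (a : S.Row J) (b : Row J) → (∀ j → a j ~ b j) →
        (φ : List J → S.Carrier) (ψ : List J → Carrier) → (∀ js → φ js ~ ψ js) →
        ∀ js → S.∂ a φ js ~ ∂ b ψ js
  ~-∂ a b ab φ ψ φψ []       = 0#-homo
  ~-∂ a b ab φ ψ φψ (j ∷ js) =
    ~-- (~-* (ab j) (φψ js)) (~-∂ a b ab (φ ∘ (j ∷_)) (ψ ∘ (j ∷_)) (φψ ∘ (j ∷_)) js)

  ~-D : {as : List (S.Row J)} {bs : List (Row J)} → Pointwise (λ a b → ∀ j → a j ~ b j) as bs →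
        ∀ js → S.D as js ~ D bs js
  ~-D []                        []      = 1#-homo
  ~-D []                        (_ ∷ _) = 0#-homo
  ~-D {as = a ∷ as} {b ∷ bs} (ab ∷ asbs) js      = ~-∂ a b ab (S.D as) (D bs) (~-D asbs) js

  ~-∏< : ∀ n {g h} → (∀ i → g i ~ h i) → S.∏< n g ~ ∏< n h
  ~-∏< zero    gh = 1#-homo
  ~-∏< (suc n) gh = ~-* (gh 0) (~-∏< n (gh ∘ suc))

  ~-sgn : ∀ n → S.sgn n ~ sgn n
  ~-sgn zero    = 1#-homo
  ~-sgn (suc n) = ~-neg (~-sgn n)

  module _ {C C′} (hC : C ~ C′) where

    ~-sel : ∀ s t {u v u′ v′} → u ~ u′ → v ~ v′ → S.sel C s t u v ~ sel C′ s t u′ v′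
    ~-sel zero    zero          hu hv = hu
    ~-sel zero    (suc zero)    hu hv = hv
    ~-sel zero    (suc (suc t)) hu hv = 0#-homo
    ~-sel (suc s) zero          hu hv = 0#-homo
    ~-sel (suc s) (suc t)       hu hv = ~-sel s t hu hv

    ~-T : ∀ {l l′ δ δ′ p p′ a a′} → (∀ i → l i ~ l′ i) → δ ~ δ′ → p ~ p′ → a ~ a′ →
          ∀ i j → S.T C l δ p a i j ~ T C′ l′ δ′ p′ a′ i j
    ~-T hl hδ hp ha zero    zero    = ~-* hC (~-+ (~-* hp (~-+ (hl 0) hδ)) ha)
    ~-T hl hδ hp ha (suc i) zero    = ~-sel i 0 (~-neg (~-+ (~-* hp (hl 0)) ha)) 0#-homo
    ~-T hl hδ hp ha zero    (suc j) = 0#-homo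
    ~-T hl hδ hp ha (suc i) (suc j) = ~-T (hl ∘ suc) hδ hp ha i j

    ~-cokernel : ∀ {l l′ δ δ′ q q′ b b′} → (∀ i → l i ~ l′ i) → δ ~ δ′ → q ~ q′ → b ~ b′ →
                 ∀ e j → S.cokernel C l δ q b e j ~ cokernel C′ l′ δ′ q′ b′ e j
    ~-cokernel hl hδ hq hb e       zero    = ~-∏< e (λ i → ~-+ (~-* hq (hl (suc i))) hb)
    ~-cokernel hl hδ hq hb zero    (suc j) = 0#-homo
    ~-cokernel hl hδ hq hb (suc e) (suc j) =
      ~-* (~-* hC (~-+ (~-* hq (~-+ (hl 0) hδ)) hb)) (~-cokernel (hl ∘ suc) hδ hq hb e j)

    ~-chain : ∀ {l l′ δ δ′ p p′ a a′ q q′ b b′ qₑ qₑ′ bₑ bₑ′} →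
              (∀ i → l i ~ l′ i) → δ ~ δ′ → (∀ i → p i ~ p′ i) → (∀ i → a i ~ a′ i) →
              (∀ i → q i ~ q′ i) → (∀ i → b i ~ b′ i) → qₑ ~ qₑ′ → bₑ ~ bₑ′ → ∀ e →
              S.chain C l δ p a q b qₑ bₑ e ~ chain C′ l′ δ′ p′ a′ q′ b′ qₑ′ bₑ′ e
    ~-chain hl hδ hp ha hq hb hqₑ hbₑ e = ~-D
      ((λ (j , t) → ~-sel e t (~-cokernel hl hδ hqₑ hbₑ e j) 0#-homo) ∷
       Pointwise-grid _ _ (suc (suc e)) e (λ i s (j , t) →
         ~-sel s t (~-T hl hδ (hp s) (ha s) i j) (~-T hl hδ (hq s) (hb s) i j)))
      (grid _,_ (suc e) (suc e))

    ~-value : ∀ {δ : ℕ → S.Carrier} {δ′ : ℕ → Carrier} {p p′ a a′ q q′ b b′ qₑ qₑ′ bₑ bₑ′} →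
              (∀ m → δ m ~ δ′ m) → (∀ i → p i ~ p′ i) → (∀ i → a i ~ a′ i) →
              (∀ i → q i ~ q′ i) → (∀ i → b i ~ b′ i) → qₑ ~ qₑ′ → bₑ ~ bₑ′ → ∀ e →
              S.value C δ p a q b qₑ bₑ e ~ value C′ δ′ p′ a′ q′ b′ qₑ′ bₑ′ e
    ~-value hδ hp ha hq hb hqₑ hbₑ zero    = 1#-homo
    ~-value hδ hp ha hq hb hqₑ hbₑ (suc m) = ~-* (~-sgn (signExponent m)) (~-*
      (~-∏< (suc m) (λ s → ~-* (~-* hC (hδ (suc m))) (~-- (~-* (hp 0) (hb s)) (~-* (hq s) (ha 0)))))
      (~-* (~-* (~-* hC (hδ m)) (~-- (~-* (hp 0) hbₑ) (~-* hqₑ (ha 0))))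
        (~-value hδ (hp ∘ suc) (ha ∘ suc) (hq ∘ suc) (hb ∘ suc) hqₑ hbₑ m)))

-- The polynomial ring R[x]

module Polynomials {c r} (R : CommutativeRing c r) where
  open CommutativeRing R hiding (zero; isCommutativeRing)
  open IntegerCoefficients R using (module Solver)
  open Solver using (solve; _:=_; _:+_; _:*_; _:-_; :-_)
  open SetoidReasoning setoid
  open RingProperties ring using (-‿distribʳ-*; -1*x≈-x)

  infixl 6 _⊕_
  infixl 7 _⊗_
  infix  4 _≋_

  data Poly : Set c where
    con     : Carrier → Poly
    var     : Poly
    _⊕_ _⊗_ : Poly → Poly → Poly
    ⊖_      : Poly → Poly

  -- Identifying expressions that act equally on all sequences, with the variable as the left shift, gives R[x]
  -- without normal forms: only commutativity needs an argument.
  act : Poly → (ℕ → Carrier) → ℕ → Carrier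
  act (con k) s n = k * s n
  act var     s n = s (suc n)
  act (e ⊕ f) s n = act e s n + act f s n
  act (e ⊗ f) s   = act e (act f s)
  act (⊖ e)   s n = - act e s n

  _≋_ : Poly → Poly → Set (c ⊔ r)
  e ≋ f = ∀ s n → act e s n ≈ act f s n

  act-cong : ∀ e {s t} → (∀ n → s n ≈ t n) → ∀ n → act e s n ≈ act e t n
  act-cong (con k) h n = *-congˡ (h n)
  act-cong var     h n = h (suc n)
  act-cong (e ⊕ f) h n = +-cong (act-cong e h n) (act-cong f h n)
  act-cong (e ⊗ f) h n = act-cong e (act-cong f h) n
  act-cong (⊖ e)   h n = -‿cong (act-cong e h n)

  act-+ : ∀ e s t n → act e (λ i → s i + t i) n ≈ act e s n + act e t n
  act-+ (con k) s t n = distribˡ _ _ _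
  act-+ var     s t n = refl
  act-+ (e ⊕ f) s t n = trans (+-cong (act-+ e s t n) (act-+ f s t n))
    (solve 4 (λ a b c d → (a :+ b) :+ (c :+ d) := (a :+ c) :+ (b :+ d)) refl _ _ _ _)
  act-+ (e ⊗ f) s t n = trans (act-cong e (act-+ f s t) n) (act-+ e _ _ n)
  act-+ (⊖ e)   s t n = trans (-‿cong (act-+ e s t n))
    (solve 2 (λ a b → :- (a :+ b) := :- a :+ :- b) refl _ _)

  act-* : ∀ e k s n → act e (λ i → k * s i) n ≈ k * act e s n
  act-* (con j) k s n = solve 3 (λ a b c → a :* (b :* c) := b :* (a :* c)) refl _ _ _
  act-* var     k s n = refl
  act-* (e ⊕ f) k s n = trans (+-cong (act-* e k s n) (act-* f k s n)) (sym (distribˡ _ _ _))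
  act-* (e ⊗ f) k s n = trans (act-cong e (act-* f k s) n) (act-* e _ _ n)
  act-* (⊖ e)   k s n = trans (-‿cong (act-* e k s n)) (-‿distribʳ-* _ _)

  act-neg : ∀ e s n → act e (λ i → - s i) n ≈ - act e s n
  act-neg e s n = begin
    act e (λ i → - s i) n       ≈⟨ act-cong e (λ i → -1*x≈-x (s i)) n ⟨
    act e (λ i → - 1# * s i) n  ≈⟨ act-* e (- 1#) s n ⟩
    - 1# * act e s n            ≈⟨ -1*x≈-x _ ⟩
    - act e s n                 ∎

  act-shift : ∀ e s n → act e (s ∘ suc) n ≈ act e s (suc n)
  act-shift (con k) s n = refl
  act-shift var     s n = refl
  act-shift (e ⊕ f) s n = +-cong (act-shift e s n) (act-shift f s n)
  act-shift (e ⊗ f) s n = trans (act-cong e (act-shift f s) n) (act-shift e _ n)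
  act-shift (⊖ e)   s n = -‿cong (act-shift e s n)

  -- Scalars and the shift generate all actions, and every action is linear and commutes with the
  -- shift.
  act-comm : ∀ e f s n → act e (act f s) n ≈ act f (act e s) n
  act-comm (con k) f s n = sym (act-* f k s n)
  act-comm var     f s n = sym (act-shift f s n)
  act-comm (e ⊕ g) f s n = trans (+-cong (act-comm e f s n) (act-comm g f s n)) (sym (act-+ f _ _ n))
  act-comm (e ⊗ g) f s n = trans (act-cong e (act-comm g f s) n) (act-comm e f _ n)
  act-comm (⊖ e)   f s n = trans (-‿cong (act-comm e f s n)) (sym (act-neg f _ n))

  isCommutativeRing : IsCommutativeRing _≋_ _⊕_ _⊗_ ⊖_ (con 0#) (con 1#)
  isCommutativeRing = record
    { isRing = record
      { +-isAbelianGroup = record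
        { isGroup = record
          { isMonoid = record
            { isSemigroup = record
              { isMagma = record
                { isEquivalence = record
                  { refl  = λ s n → refl
                  ; sym   = λ e s n → sym (e s n)
                  ; trans = λ e f s n → trans (e s n) (f s n)
                  }
                ; ∙-cong = λ e f s n → +-cong (e s n) (f s n)
                }
              ; assoc = λ e f g s n → +-assoc _ _ _
              }
            ; identity = (λ e s n → trans (+-congʳ (zeroˡ _)) (+-identityˡ _))
                       , (λ e s n → trans (+-congˡ (zeroˡ _)) (+-identityʳ _))
            }
          ; inverse = (λ e s n → trans (-‿inverseˡ _) (sym (zeroˡ _)))
                    , (λ e s n → trans (-‿inverseʳ _) (sym (zeroˡ _)))
          ; ⁻¹-cong = λ e s n → -‿cong (e s n)
          }
        ; comm = λ e f s n → +-comm _ _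
        }
      ; *-cong = λ {e} {e′} {f} {f′} h k s n → trans (act-cong e (k s) n) (h _ n)
      ; *-assoc = λ e f g s n → refl
      ; *-identity = (λ e s n → *-identityˡ _)
                   , (λ e s n → act-cong e (λ i → *-identityˡ (s i)) n)
      ; distrib = (λ e f g s n → act-+ e _ _ n) , (λ e f g s n → refl)
      }
    ; *-comm = act-comm
    }

  polynomialRing : CommutativeRing c (c ⊔ r)
  polynomialRing = record { isCommutativeRing = isCommutativeRing }

  constantTerm : Poly → Carrier
  constantTerm (con k) = k
  constantTerm var     = 0#
  constantTerm (e ⊕ f) = constantTerm e + constantTerm f
  constantTerm (e ⊗ f) = constantTerm e * constantTerm f
  constantTerm (⊖ e)   = - constantTerm e

  unit : ℕ → Carrier
  unit zero    = 1#
  unit (suc n) = 0#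

  -- The shift annihilates `unit`, so a polynomial acts on this sequence by its value at x = 0. This
  -- makes the constant term readable from the action, hence well defined on classes of expressions.
  act-unit : ∀ e n → act e unit n ≈ constantTerm e * unit n
  act-unit (con k) n = refl
  act-unit var     n = sym (zeroˡ _)
  act-unit (e ⊕ f) n = trans (+-cong (act-unit e n) (act-unit f n)) (sym (distribʳ _ _ _))
  act-unit (e ⊗ f) n = begin
    act e (act f unit) n                          ≈⟨ act-cong e (act-unit f) n ⟩
    act e (λ i → constantTerm f * unit i) n       ≈⟨ act-* e _ unit n ⟩
    constantTerm f * act e unit n                 ≈⟨ *-congˡ (act-unit e n) ⟩
    constantTerm f * (constantTerm e * unit n)    ≈⟨ solve 3 (λ a b c → a :* (b :* c) := b :* a :* c) refl _ _ _ ⟩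
    constantTerm e * constantTerm f * unit n      ∎
  act-unit (⊖ e)   n = trans (-‿cong (act-unit e n)) (solve 2 (λ a b → :- (a :* b) := (:- a) :* b) refl _ _)

  constantTerm-cong : ∀ {e f} → e ≋ f → constantTerm e ≈ constantTerm f
  constantTerm-cong {e} {f} h = begin
    constantTerm e           ≈⟨ *-identityʳ _ ⟨
    constantTerm e * 1#      ≈⟨ act-unit e 0 ⟨
    act e unit 0             ≈⟨ h unit 0 ⟩
    act f unit 0             ≈⟨ act-unit f 0 ⟩
    constantTerm f * 1#      ≈⟨ *-identityʳ _ ⟩
    constantTerm f           ∎

  constantTerm-homomorphism : RingMorphisms.IsRingHomomorphism
    (CommutativeRing.rawRing polynomialRing) rawRing constantTerm
  constantTerm-homomorphism = record
    { isSemiringHomomorphism = record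
      { isNearSemiringHomomorphism = record
        { +-isMonoidHomomorphism = record
          { isMagmaHomomorphism = record
            { isRelHomomorphism = record { cong = λ {e} {f} → constantTerm-cong {e} {f} }
            ; homo = λ _ _ → refl
            }
          ; ε-homo = refl
          }
        ; *-homo = λ _ _ → refl
        }
      ; 1#-homo = refl
      }
    ; -‿homo = λ _ → refl
    }

  -- var + k acts surjectively on sequences: a first-order recurrence gives a preimage.
  linear-regular : ∀ u v k → Regularity.Regular polynomialRing (con u ⊗ con v ⊕ (con k ⊕ var))
  linear-regular u v k e f h s n = begin
    act e s n             ≈⟨ act-cong e solution-solves n ⟨
    act e (act X t) n     ≈⟨ act-comm e X t n ⟩
    act X (act e t) n     ≈⟨ h t n ⟩
    act X (act f t) n     ≈⟨ act-comm X f t n ⟩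
    act f (act X t) n     ≈⟨ act-cong f solution-solves n ⟩
    act f s n             ∎
    where
    X = con u ⊗ con v ⊕ (con k ⊕ var)

    t : ℕ → Carrier
    t zero    = 0#
    t (suc i) = s i - (u * v + k) * t i

    solution-solves : ∀ i → act X t i ≈ s i
    solution-solves i = solve 5 (λ u v k t s → u :* (v :* t) :+ (k :* t :+ (s :- (u :* v :+ k) :* t)) := s)
      refl u v k (t i) (s i)

module ChainEvaluation {c r} (R : CommutativeRing c r) (C : CommutativeRing.Carrier R) where
  open CommutativeRing R hiding (zero)
  open Polynomials R
  open Chain R C using (chain)
  open SetoidReasoning setoid
  open RegularChain R C using (value)
  private
    module S = RegularChain polynomialRing (con C)
  open ChainHomomorphism polynomialRing R constantTerm constantTerm-homomorphism

  -- Both sides are constant terms of the corresponding expressions over R[x], where `chain-regular`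
  -- applies because each p_s l_i + a_s + x is regular.
  chain-value : ∀ (l δ p a q b : ℕ → Carrier) (qₑ bₑ : Carrier) →
                (∀ i m → l (suc i) + δ m ≈ l i + δ (suc m)) → ∀ e →
                chain l (δ e) p a q b qₑ bₑ e ≈ value δ p a q b qₑ bₑ e
  chain-value l δ p a q b qₑ bₑ H e = begin
    chain l (δ e) p a q b qₑ bₑ e
      ≈⟨ ~-chain {C = con C} refl {l = con ∘ l} {δ = con (δ e)} {p = con ∘ p} {a = aᵥ} {q = con ∘ q} {b = con ∘ b}
           {qₑ = con qₑ} {bₑ = con bₑ}
           (λ _ → refl) refl (λ _ → refl) (λ _ → +-identityʳ _) (λ _ → refl) (λ _ → refl) refl refl e ⟨
    constantTerm lhs
      ≈⟨ constantTerm-cong {lhs} {rhs}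
           (S.chain-regular e (con ∘ l) (con ∘ δ) (con ∘ p) aᵥ (con ∘ q) (con ∘ b) (con qₑ) (con bₑ)
             (λ i m s n → trans (sym (distribʳ _ _ _)) (trans (*-congʳ (H i m)) (distribʳ _ _ _)))
             (λ s i → linear-regular (p s) (l i) (a s))) ⟩
    constantTerm rhs
      ≈⟨ ~-value {C = con C} refl {δ = con ∘ δ} {p = con ∘ p} {a = aᵥ} {q = con ∘ q} {b = con ∘ b}
           {qₑ = con qₑ} {bₑ = con bₑ}
           (λ _ → refl) (λ _ → refl) (λ _ → +-identityʳ _) (λ _ → refl) (λ _ → refl) refl refl e ⟩
    value δ p a q b qₑ bₑ e ∎
    where
    aᵥ : ℕ → Poly
    aᵥ s = con (a s) ⊕ var
    lhs rhs : Poly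
    lhs = Chain.chain polynomialRing (con C) (con ∘ l) (con (δ e)) (con ∘ p) aᵥ (con ∘ q) (con ∘ b) (con qₑ) (con bₑ) e
    rhs = S.value (con ∘ δ) (con ∘ p) aᵥ (con ∘ q) (con ∘ b) (con qₑ) (con bₑ) e

-- The matrix M as a chain

tabulate-toℕ : ∀ {A : Set ℓ} (h : ℕ → A) n → tabulate {n = n} (h ∘ toℕ) ≡ applyUpTo h n
tabulate-toℕ h zero    = ≡.refl
tabulate-toℕ h (suc n) = ≡.cong (h 0 ∷_) (tabulate-toℕ (h ∘ suc) n)

tabulate-+ : ∀ {A : Set ℓ} m {n} (f : Fin (m ℕ.+ n) → A) →
             tabulate f ≡ tabulate (f ∘ (_↑ˡ n)) ++ tabulate (f ∘ (m ↑ʳ_))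
tabulate-+ zero    f = ≡.refl
tabulate-+ (suc m) f = ≡.cong (f Fin.zero ∷_) (tabulate-+ m (f ∘ Fin.suc))

tabulate-cast : ∀ {A : Set ℓ} {m n} (e : m ≡ n) (f : Fin n → A) → tabulate (f ∘ cast e) ≡ tabulate f
tabulate-cast ≡.refl f = Listₚ.tabulate-cong (λ i → ≡.cong f (Finₚ.cast-is-id ≡.refl i))

toℕ² : ∀ {m n} → Fin m × Fin n → ℕ × ℕ
toℕ² (i , j) = toℕ i , toℕ j

tabulate-remQuot : ∀ {A : Set ℓ} (h : ℕ × ℕ → A) m n →
                   tabulate (h ∘ toℕ² ∘ remQuot {m} n) ≡ grid (λ i j → h (i , j)) m n
tabulate-remQuot h zero    n = ≡.refl
tabulate-remQuot h (suc m) n = ≡.trans (tabulate-+ n (h ∘ toℕ² ∘ remQuot {suc m} n)) (≡.cong₂ _++_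
  (≡.trans (Listₚ.tabulate-cong left) (tabulate-toℕ (λ j → h (0 , j)) n))
  (≡.trans (Listₚ.tabulate-cong right) (tabulate-remQuot (λ (i , j) → h (suc i , j)) m n)))
  where
  left : ∀ j → h (toℕ² (remQuot {suc m} n (j ↑ˡ (m ℕ.* n)))) ≡ h (0 , toℕ j)
  left j rewrite Finₚ.splitAt-↑ˡ n j (m ℕ.* n) = ≡.refl
  right : ∀ i → h (toℕ² (remQuot {suc m} n (n ↑ʳ i))) ≡
                h (suc (toℕ (proj₁ (remQuot {m} n i))) , toℕ (proj₂ (remQuot {m} n i)))
  right i rewrite Finₚ.splitAt-↑ʳ n (m ℕ.* n) i = ≡.refl

module Coefficients {c r} (R : CommutativeRing c r) (C : CommutativeRing.Carrier R) where
  open CommutativeRing R hiding (zero)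
  open Chain R C

  sel-if : ∀ s t {u v} → sel s t u v ≡ (if t ≡ᵇ s then u else if t ≡ᵇ s ℕ.+ 1 then v else 0#)
  sel-if zero    zero          = ≡.refl
  sel-if zero    (suc zero)    = ≡.refl
  sel-if zero    (suc (suc t)) = ≡.refl
  sel-if (suc s) zero          = ≡.refl
  sel-if (suc s) (suc t)       = sel-if s t

  T-if : ∀ l δ p a i j → T l δ p a i j ≡
         (if i ≡ᵇ j then C * η l δ p a j else if i ≡ᵇ j ℕ.+ 1 then - ξ l δ p a j else 0#)
  T-if l δ p a zero    zero          = ≡.refl
  T-if l δ p a zero    (suc j)       = ≡.refl
  T-if l δ p a (suc zero)    zero    = ≡.refl
  T-if l δ p a (suc (suc i)) zero    = ≡.refl
  T-if l δ p a (suc i) (suc j)       = T-if (l ∘ suc) δ p a i j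

  -- Interchanges two case distinctions: `block` looks first at the position of the block,
  -- `equation` first at the position inside the block.
  if-table : ∀ {A B : Set} (b₁ b₂ : Bool) (c₁ c₂ : A → B → Bool) {f₁ f₀ g₁ g₀ : A → Carrier} (s : A) (t : B) {x y z w : Carrier} →
             f₁ s ≈ x → f₀ s ≈ y → g₁ s ≈ z → g₀ s ≈ w →
             (if b₁ then (λ s t → if c₁ s t then f₁ s else if c₂ s t then f₀ s else 0#)
              else if b₂ then (λ s t → if c₁ s t then g₁ s else if c₂ s t then g₀ s else 0#)
              else λ _ _ → 0#) s t ≈
             (if c₁ s t then (if b₁ then x else if b₂ then z else 0#)
              else if c₂ s t then (if b₁ then y else if b₂ then w else 0#) else 0#)
  if-table true  b₂    c₁ c₂ s t hx hy hz hw with c₁ s t | c₂ s t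
  ... | true  | _     = hx
  ... | false | true  = hy
  ... | false | false = refl
  if-table false true  c₁ c₂ s t hx hy hz hw with c₁ s t | c₂ s t
  ... | true  | _     = hz
  ... | false | true  = hw
  ... | false | false = refl
  if-table false false c₁ c₂ s t hx hy hz hw with c₁ s t | c₂ s t
  ... | true  | _     = refl
  ... | false | true  = refl
  ... | false | false = refl

  -- Padding by zeros turns vectors into sequences, for which dropping the first entry is
  -- composition with `suc`.
  extend : ∀ {n} → Vector Carrier n → ℕ → Carrier
  extend {zero}  v i       = 0#
  extend {suc n} v zero    = v Fin.zero
  extend {suc n} v (suc i) = extend (v ∘ Fin.suc) i

  extend-toℕ : ∀ {n} (v : Vector Carrier n) i → extend v (toℕ i) ≡ v i
  extend-toℕ v Fin.zero    = ≡.refl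
  extend-toℕ v (Fin.suc i) = extend-toℕ (v ∘ Fin.suc) i

module Matrix {c r} (R : CommutativeRing c r) (k′ : ℕ) where
  open CommutativeRing R hiding (zero)
  open OverRing R using (ι; det; module BlockMatrix)
  open IntegerCoefficients R
  open Solver using (solve; _:=_; _:+_; _:*_; _:-_; :-_; con)
  open Determinants R
  open SetoidReasoning setoid

  k e : ℕ
  k = suc k′
  e = 4 ℕ.* k ℕ.∸ 1

  open Chain R (ι (-4^ k))
  open Coefficients R (ι (-4^ k))

  -- With n = 4k, l i is the eigenvalue of n z d/dz on z^i. The initial δ is n (n + 1) = N(k), and
  -- each reduction step lowers it by n.
  l δ : ℕ → Carrier
  l i = ι (+ (4 ℕ.* i ℕ.* k))
  δ m = ι (+ (4 ℕ.* k ℕ.* (m ℕ.+ 2)))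

  -- With 1 - n² the factors l_i + δ + bₑ become n (i + 1) + 1 and the factors l_(i+1) + bₑ become 1
  -- - n (n - 1 - i). These are, up to sign, the factors of the two products in `u`.
  bₑ : Carrier
  bₑ = ι (1ℤ ℤ.- + (16 ℕ.* k ℕ.^ 2))

  module _ (X₁ X₂ Y : Vector Carrier e) where
    open BlockMatrix k X₁ X₂ Y

    -- The pairs α_s = (p s , a s) and β_s = (q s , b s), with s counted from 0.
    p a q b : ℕ → Carrier
    p s = ι (ℤ.- + 4) * extend Y s
    a s = ι (+ 4) * extend X₁ s - ι (+ (4 ℕ.* suc s ℕ.+ 2)) * extend Y s
    q s = extend Y s
    b s = ι (+ (s ℕ.+ 2)) * extend Y s - extend X₂ s

    private
      δe≡N : δ e ≡ ι (+ N k)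
      δe≡N = ≡.cong (λ z → ι (+ (4 ℕ.* k ℕ.* z))) (ℕₚ.+-suc e 1)

      ι-ℕ+ : ∀ m n → ι (+ (m ℕ.+ n)) ≈ ι (+ m) + ι (+ n)
      ι-ℕ+ m n = ι-+ (+ m) (+ n)

      ι-ℕ* : ∀ m n → ι (+ (m ℕ.* n)) ≈ ι (+ m) * ι (+ n)
      ι-ℕ* m n = trans (reflexive (≡.cong ι (ℤₚ.pos-* m n))) (ι-* (+ m) (+ n))

      f₁-value : ∀ s ℓ → f₁ s (4 ℕ.* ℓ ℕ.* k ℕ.+ suc (toℕ s)) ≈
                 ι (-4^ k) * η l (δ e) (p (toℕ s)) (a (toℕ s)) ℓ
      f₁-value s ℓ rewrite δe≡N | extend-toℕ Y s | extend-toℕ X₁ s = begin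
        - (ι (+ (4 ℕ.* N k ℕ.+ 4 ℕ.* j ℕ.+ 2)) * Y s - ι (+ 4) * X₁ s) * ι (-4^ k)
          ≡⟨ ≡.cong (λ z → - (ι (+ z) * Y s - ι (+ 4) * X₁ s) * ι (-4^ k)) (arithmetic (N k) (4 ℕ.* ℓ ℕ.* k) (suc (toℕ s))) ⟩
        - (ι (+ (4 ℕ.* (4 ℕ.* ℓ ℕ.* k ℕ.+ N k) ℕ.+ (4 ℕ.* suc (toℕ s) ℕ.+ 2))) * Y s - ι (+ 4) * X₁ s) * ι (-4^ k)
          ≈⟨ *-congʳ (-‿cong (+-congʳ (*-congʳ (trans (ι-ℕ+ (4 ℕ.* (4 ℕ.* ℓ ℕ.* k ℕ.+ N k)) _)
               (+-congʳ (trans (ι-ℕ* 4 (4 ℕ.* ℓ ℕ.* k ℕ.+ N k)) (*-congˡ (ι-ℕ+ (4 ℕ.* ℓ ℕ.* k) (N k))))))))) ⟩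
        - ((ι (+ 4) * (l ℓ + ι (+ N k)) + S) * Y s - ι (+ 4) * X₁ s) * ι (-4^ k)
          ≈⟨ solve 6 (λ l N S Y X C → :- ((con (+ 4) :* (l :+ N) :+ S) :* Y :- con (+ 4) :* X) :* C
                := C :* (con (ℤ.- + 4) :* Y :* (l :+ N) :+ (con (+ 4) :* X :- S :* Y))) refl
               (l ℓ) (ι (+ N k)) S (Y s) (X₁ s) (ι (-4^ k)) ⟩
        ι (-4^ k) * (ι (ℤ.- + 4) * Y s * (l ℓ + ι (+ N k)) + (ι (+ 4) * X₁ s - S * Y s)) ∎
        where
        j = 4 ℕ.* ℓ ℕ.* k ℕ.+ suc (toℕ s)
        S = ι (+ (4 ℕ.* suc (toℕ s) ℕ.+ 2))
        arithmetic : ∀ n l s → 4 ℕ.* n ℕ.+ 4 ℕ.* (l ℕ.+ s) ℕ.+ 2 ≡ 4 ℕ.* (l ℕ.+ n) ℕ.+ (4 ℕ.* s ℕ.+ 2)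
        arithmetic = ℕSolver.solve-∀

      g₁-value : ∀ s ℓ → g₁ s (4 ℕ.* ℓ ℕ.* k ℕ.+ suc (toℕ s)) ≈
                 - ξ l (δ e) (p (toℕ s)) (a (toℕ s)) ℓ
      g₁-value s ℓ rewrite extend-toℕ Y s | extend-toℕ X₁ s = begin
        - (ι (+ 4) * X₁ s - ι (+ (4 ℕ.* j ℕ.+ 2)) * Y s)
          ≡⟨ ≡.cong (λ z → - (ι (+ 4) * X₁ s - ι (+ z) * Y s)) (arithmetic (4 ℕ.* ℓ ℕ.* k) (suc (toℕ s))) ⟩
        - (ι (+ 4) * X₁ s - ι (+ (4 ℕ.* (4 ℕ.* ℓ ℕ.* k) ℕ.+ (4 ℕ.* suc (toℕ s) ℕ.+ 2))) * Y s)
          ≈⟨ -‿cong (+-congˡ (-‿cong (*-congʳ (trans (ι-ℕ+ (4 ℕ.* (4 ℕ.* ℓ ℕ.* k)) _)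
               (+-congʳ (ι-ℕ* 4 (4 ℕ.* ℓ ℕ.* k))))))) ⟩
        - (ι (+ 4) * X₁ s - (ι (+ 4) * l ℓ + S) * Y s)
          ≈⟨ solve 4 (λ l S Y X → :- (con (+ 4) :* X :- (con (+ 4) :* l :+ S) :* Y)
                := :- (con (ℤ.- + 4) :* Y :* l :+ (con (+ 4) :* X :- S :* Y))) refl
               (l ℓ) S (Y s) (X₁ s) ⟩
        - (ι (ℤ.- + 4) * Y s * l ℓ + (ι (+ 4) * X₁ s - S * Y s)) ∎
        where
        j = 4 ℕ.* ℓ ℕ.* k ℕ.+ suc (toℕ s)
        S = ι (+ (4 ℕ.* suc (toℕ s) ℕ.+ 2))
        arithmetic : ∀ l s → 4 ℕ.* (l ℕ.+ s) ℕ.+ 2 ≡ 4 ℕ.* l ℕ.+ (4 ℕ.* s ℕ.+ 2)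
        arithmetic = ℕSolver.solve-∀

      shift-index : ∀ l s → l ℕ.+ suc s ℕ.+ 1 ≡ l ℕ.+ (s ℕ.+ 2)
      shift-index = ℕSolver.solve-∀

      f₀-value : ∀ s ℓ → f₀ s (4 ℕ.* ℓ ℕ.* k ℕ.+ suc (toℕ s) ℕ.+ 1) ≈
                 ι (-4^ k) * η l (δ e) (q (toℕ s)) (b (toℕ s)) ℓ
      f₀-value s ℓ rewrite δe≡N | extend-toℕ Y s | extend-toℕ X₂ s | shift-index (4 ℕ.* ℓ ℕ.* k) (toℕ s) = begin
        (ι (+ (N k ℕ.+ (4 ℕ.* ℓ ℕ.* k ℕ.+ (toℕ s ℕ.+ 2)))) * Y s - X₂ s) * ι (-4^ k)
          ≈⟨ *-congʳ (+-congʳ (*-congʳ (trans (ι-ℕ+ (N k) (4 ℕ.* ℓ ℕ.* k ℕ.+ (toℕ s ℕ.+ 2)))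
               (+-congˡ (ι-ℕ+ (4 ℕ.* ℓ ℕ.* k) (toℕ s ℕ.+ 2)))))) ⟩
        ((ι (+ N k) + (l ℓ + S)) * Y s - X₂ s) * ι (-4^ k)
          ≈⟨ solve 6 (λ l N S Y X C → ((N :+ (l :+ S)) :* Y :- X) :* C := C :* (Y :* (l :+ N) :+ (S :* Y :- X))) refl
               (l ℓ) (ι (+ N k)) S (Y s) (X₂ s) (ι (-4^ k)) ⟩
        ι (-4^ k) * (Y s * (l ℓ + ι (+ N k)) + (S * Y s - X₂ s)) ∎
        where
        S = ι (+ (toℕ s ℕ.+ 2))

      g₀-value : ∀ s ℓ → g₀ s (4 ℕ.* ℓ ℕ.* k ℕ.+ suc (toℕ s) ℕ.+ 1) ≈
                 - ξ l (δ e) (q (toℕ s)) (b (toℕ s)) ℓ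
      g₀-value s ℓ rewrite extend-toℕ Y s | extend-toℕ X₂ s | shift-index (4 ℕ.* ℓ ℕ.* k) (toℕ s) = begin
        X₂ s - ι (+ (4 ℕ.* ℓ ℕ.* k ℕ.+ (toℕ s ℕ.+ 2))) * Y s
          ≈⟨ +-congˡ (-‿cong (*-congʳ (ι-ℕ+ (4 ℕ.* ℓ ℕ.* k) (toℕ s ℕ.+ 2)))) ⟩
        X₂ s - (l ℓ + S) * Y s
          ≈⟨ solve 4 (λ l S Y X → X :- (l :+ S) :* Y := :- (Y :* l :+ (S :* Y :- X))) refl (l ℓ) S (Y s) (X₂ s) ⟩
        - (Y s * l ℓ + (S * Y s - X₂ s)) ∎
        where
        S = ι (+ (toℕ s ℕ.+ 2))

    block-entry : ∀ ρ ℓ (s : Fin e) (t : Fin (4 ℕ.* k)) →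
                  block (suc ρ) (suc ℓ) s t ≈ equation l (δ e) p a q b ρ (toℕ s) (ℓ , toℕ t)
    block-entry ρ ℓ s t = trans
      (if-table (ρ ≡ᵇ ℓ) (ρ ≡ᵇ ℓ ℕ.+ 1) (λ s t → toℕ t ≡ᵇ toℕ s) (λ s t → toℕ t ≡ᵇ toℕ s ℕ.+ 1) s t
        (f₁-value s ℓ) (f₀-value s ℓ) (g₁-value s ℓ) (g₀-value s ℓ))
      (reflexive (≡.sym (≡.trans (sel-if (toℕ s) (toℕ t))
        (≡.cong₂ (λ u v → if toℕ t ≡ᵇ toℕ s then u else if toℕ t ≡ᵇ toℕ s ℕ.+ 1 then v else 0#)
          (T-if l (δ e) (p (toℕ s)) (a (toℕ s)) ρ ℓ) (T-if l (δ e) (q (toℕ s)) (b (toℕ s)) ρ ℓ)))))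

-- The first row of the matrix as a functional over the integers

module IntegerCokernel where
  open ≡.≡-Reasoning
  open Determinants ℤₚ.+-*-commutativeRing using (∏<)

  ∏ℤ≡∏< : ∀ n f → ∏ℤ n f ≡ ∏< n (f ∘ suc)
  ∏ℤ≡∏< zero    f = ≡.refl
  ∏ℤ≡∏< (suc n) f = ≡.cong (f 1 ℤ.*_) (∏ℤ≡∏< n (f ∘ suc))

  ∏ℤ-snoc : ∀ n f → ∏ℤ (suc n) f ≡ f (suc n) ℤ.* ∏ℤ n f
  ∏ℤ-snoc zero    f = ≡.refl
  ∏ℤ-snoc (suc n) f = begin
    f 1 ℤ.* ∏ℤ (suc n) (f ∘ suc)             ≡⟨ ≡.cong (f 1 ℤ.*_) (∏ℤ-snoc n (f ∘ suc)) ⟩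
    f 1 ℤ.* (f (suc (suc n)) ℤ.* ∏ℤ n (f ∘ suc))  ≡⟨ exchange (f 1) (f (suc (suc n))) (∏ℤ n (f ∘ suc)) ⟩
    f (suc (suc n)) ℤ.* (f 1 ℤ.* ∏ℤ n (f ∘ suc))  ∎
    where
    exchange : ∀ x y z → x ℤ.* (y ℤ.* z) ≡ y ℤ.* (x ℤ.* z)
    exchange = solve-∀

  sign² : ∀ n → -1ℤ ℤ.^ n ℤ.* -1ℤ ℤ.^ n ≡ 1ℤ
  sign² zero    = ≡.refl
  sign² (suc n) = ≡.trans (square (-1ℤ ℤ.^ n)) (sign² n)
    where
    square : ∀ x → -1ℤ ℤ.* x ℤ.* (-1ℤ ℤ.* x) ≡ x ℤ.* x
    square = solve-∀

  module _ (k : ℕ) (C δ b : ℤ) (δ+b : δ ℤ.+ b ≡ + (4 ℕ.* k) ℤ.+ 1ℤ) where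
    open Chain ℤₚ.+-*-commutativeRing C using (cokernel; ξ)

    negative positive : ℕ → ℤ
    negative i = + (4 ℕ.* i ℕ.* k) ℤ.- 1ℤ
    positive i = + (4 ℕ.* i ℕ.* k) ℤ.+ 1ℤ

    -- The factors are 1 - 4 (e - i) k, so they run through `negative` from the last one to the
    -- first; hence `∏ℤ-snoc`. The number j counts the shifts of l, and e + j stays fixed in the
    -- induction.
    ∏-ξ : ∀ e j (l : ℕ → ℤ) → (∀ i → l i ≡ + (4 ℕ.* (j ℕ.+ i) ℕ.* k)) →
          b ≡ 1ℤ ℤ.- + (4 ℕ.* (e ℕ.+ suc j) ℕ.* k) →
          ∏< e (λ i → ξ l δ 1ℤ b (suc i)) ≡ -1ℤ ℤ.^ e ℤ.* ∏ℤ e negative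
    ∏-ξ zero    j l hl hb = ≡.refl
    ∏-ξ (suc e) j l hl hb = begin
      (1ℤ ℤ.* l 1 ℤ.+ b) ℤ.* ∏< e (λ i → ξ (l ∘ suc) δ 1ℤ b (suc i))
        ≡⟨ ≡.cong₂ ℤ._*_ (≡.cong₂ (λ u v → 1ℤ ℤ.* u ℤ.+ v) (hl 1) hb)
             (∏-ξ e (suc j) (l ∘ suc)
               (λ i → ≡.trans (hl (suc i)) (≡.cong (λ z → + (4 ℕ.* z ℕ.* k)) (ℕₚ.+-suc j i)))
               (≡.trans hb (≡.cong (λ z → 1ℤ ℤ.- + (4 ℕ.* z ℕ.* k)) (≡.sym (ℕₚ.+-suc e (suc j)))))) ⟩
      (1ℤ ℤ.* + (4 ℕ.* (j ℕ.+ 1) ℕ.* k) ℤ.+ (1ℤ ℤ.- + (4 ℕ.* (suc e ℕ.+ suc j) ℕ.* k))) ℤ.* (-1ℤ ℤ.^ e ℤ.* ∏ℤ e negative)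
        ≡⟨ ≡.cong (λ z → (1ℤ ℤ.* + (4 ℕ.* (j ℕ.+ 1) ℕ.* k) ℤ.+ (1ℤ ℤ.- + z)) ℤ.* (-1ℤ ℤ.^ e ℤ.* ∏ℤ e negative))
             (split e j k) ⟩
      (1ℤ ℤ.* + (4 ℕ.* (j ℕ.+ 1) ℕ.* k) ℤ.+ (1ℤ ℤ.- + (4 ℕ.* (j ℕ.+ 1) ℕ.* k ℕ.+ 4 ℕ.* suc e ℕ.* k))) ℤ.* (-1ℤ ℤ.^ e ℤ.* ∏ℤ e negative)
        ≡⟨ rearrange (+ (4 ℕ.* (j ℕ.+ 1) ℕ.* k)) (+ (4 ℕ.* suc e ℕ.* k)) (-1ℤ ℤ.^ e) (∏ℤ e negative) ⟩
      -1ℤ ℤ.* -1ℤ ℤ.^ e ℤ.* (negative (suc e) ℤ.* ∏ℤ e negative)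
        ≡⟨ ≡.cong (-1ℤ ℤ.* -1ℤ ℤ.^ e ℤ.*_) (∏ℤ-snoc e negative) ⟨
      -1ℤ ℤ.^ suc e ℤ.* ∏ℤ (suc e) negative ∎
      where
      split : ∀ e j k → 4 ℕ.* (suc e ℕ.+ suc j) ℕ.* k ≡ 4 ℕ.* (j ℕ.+ 1) ℕ.* k ℕ.+ 4 ℕ.* suc e ℕ.* k
      split = ℕSolver.solve-∀
      rearrange : ∀ x y s t → (1ℤ ℤ.* x ℤ.+ (1ℤ ℤ.- (x ℤ.+ y))) ℤ.* (s ℤ.* t) ≡ -1ℤ ℤ.* s ℤ.* ((y ℤ.- 1ℤ) ℤ.* t)
      rearrange = solve-∀

    cokernel-value : ∀ e j (l : ℕ → ℤ) → (∀ i → l i ≡ + (4 ℕ.* (j ℕ.+ i) ℕ.* k)) →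
      b ≡ 1ℤ ℤ.- + (4 ℕ.* (e ℕ.+ suc j) ℕ.* k) → ∀ ℓ → ℓ ℕ.≤ e →
      cokernel l δ 1ℤ b e ℓ ≡
      C ℤ.^ ℓ ℤ.* (-1ℤ ℤ.^ (e ℕ.∸ ℓ) ℤ.* ∏ℤ (e ℕ.∸ ℓ) negative) ℤ.* ∏< ℓ (λ i → positive (suc (j ℕ.+ i)))
    cokernel-value e j l hl hb zero _ = ≡.trans (∏-ξ e j l hl hb) (units (-1ℤ ℤ.^ e ℤ.* ∏ℤ e negative))
      where
      units : ∀ x → x ≡ 1ℤ ℤ.* x ℤ.* 1ℤ
      units = solve-∀
    cokernel-value (suc e) j l hl hb (suc ℓ) (ℕ.s≤s ℓ≤e) = begin
      C ℤ.* (1ℤ ℤ.* (l 0 ℤ.+ δ) ℤ.+ b) ℤ.* cokernel (l ∘ suc) δ 1ℤ b e ℓ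
        ≡⟨ ≡.cong₂ (λ u v → C ℤ.* u ℤ.* v) head
             (cokernel-value e (suc j) (l ∘ suc)
               (λ i → ≡.trans (hl (suc i)) (≡.cong (λ z → + (4 ℕ.* z ℕ.* k)) (ℕₚ.+-suc j i)))
               (≡.trans hb (≡.cong (λ z → 1ℤ ℤ.- + (4 ℕ.* z ℕ.* k)) (≡.sym (ℕₚ.+-suc e (suc j)))))
               ℓ ℓ≤e) ⟩
      C ℤ.* positive (suc (j ℕ.+ 0)) ℤ.* (C ℤ.^ ℓ ℤ.* s ℤ.* ∏< ℓ (λ i → positive (suc (suc j ℕ.+ i))))
        ≡⟨ ≡.cong (λ z → C ℤ.* positive (suc (j ℕ.+ 0)) ℤ.* (C ℤ.^ ℓ ℤ.* s ℤ.* z))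
             (∏<-cong-≡ ℓ (λ i → ≡.cong (positive ∘ suc) (≡.sym (ℕₚ.+-suc j i)))) ⟩
      C ℤ.* positive (suc (j ℕ.+ 0)) ℤ.* (C ℤ.^ ℓ ℤ.* s ℤ.* ∏< ℓ (λ i → positive (suc (j ℕ.+ suc i))))
        ≡⟨ rearrange C (positive (suc (j ℕ.+ 0))) (C ℤ.^ ℓ) s (∏< ℓ (λ i → positive (suc (j ℕ.+ suc i)))) ⟩
      C ℤ.* C ℤ.^ ℓ ℤ.* s ℤ.* (positive (suc (j ℕ.+ 0)) ℤ.* ∏< ℓ (λ i → positive (suc (j ℕ.+ suc i)))) ∎
      where
      s = -1ℤ ℤ.^ (e ℕ.∸ ℓ) ℤ.* ∏ℤ (e ℕ.∸ ℓ) negative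

      rearrange : ∀ c x y z w → c ℤ.* x ℤ.* (y ℤ.* z ℤ.* w) ≡ c ℤ.* y ℤ.* z ℤ.* (x ℤ.* w)
      rearrange = solve-∀

      ∏<-cong-≡ : ∀ n {f g : ℕ → ℤ} → (∀ i → f i ≡ g i) → ∏< n f ≡ ∏< n g
      ∏<-cong-≡ n = Determinants.∏<-cong ℤₚ.+-*-commutativeRing n

      head : 1ℤ ℤ.* (l 0 ℤ.+ δ) ℤ.+ b ≡ positive (suc (j ℕ.+ 0))
      head = begin
        1ℤ ℤ.* (l 0 ℤ.+ δ) ℤ.+ b                               ≡⟨ assoc (l 0) δ b ⟩
        l 0 ℤ.+ (δ ℤ.+ b)                                      ≡⟨ ≡.cong₂ ℤ._+_ (hl 0) δ+b ⟩
        + (4 ℕ.* (j ℕ.+ 0) ℕ.* k) ℤ.+ (+ (4 ℕ.* k) ℤ.+ 1ℤ)     ≡⟨ ℤₚ.+-assoc (+ (4 ℕ.* (j ℕ.+ 0) ℕ.* k)) (+ (4 ℕ.* k)) 1ℤ ⟨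
        + (4 ℕ.* (j ℕ.+ 0) ℕ.* k ℕ.+ 4 ℕ.* k) ℤ.+ 1ℤ           ≡⟨ ≡.cong (λ z → + z ℤ.+ 1ℤ) (step (j ℕ.+ 0) k) ⟩
        positive (suc (j ℕ.+ 0))                               ∎
        where
        assoc : ∀ x y z → 1ℤ ℤ.* (x ℤ.+ y) ℤ.+ z ≡ x ℤ.+ (y ℤ.+ z)
        assoc = solve-∀
        step : ∀ j k → 4 ℕ.* j ℕ.* k ℕ.+ 4 ℕ.* k ≡ 4 ℕ.* suc j ℕ.* k
        step = ℕSolver.solve-∀

  odd-sign : ∀ k′ → -1ℤ ℤ.^ (4 ℕ.* suc k′ ℕ.∸ 1) ≡ -1ℤ
  odd-sign k′ = begin
    -1ℤ ℤ.^ (k′ ℕ.+ 3 ℕ.* suc k′)          ≡⟨ ≡.cong (-1ℤ ℤ.^_) (arithmetic k′) ⟩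
    -1ℤ ℤ.^ (3 ℕ.+ (2 ℕ.* k′ ℕ.+ 2 ℕ.* k′)) ≡⟨ ℤₚ.^-distribˡ-+-* -1ℤ 3 (2 ℕ.* k′ ℕ.+ 2 ℕ.* k′) ⟩
    -1ℤ ℤ.* -1ℤ ℤ.^ (2 ℕ.* k′ ℕ.+ 2 ℕ.* k′) ≡⟨ ≡.cong (-1ℤ ℤ.*_) (ℤₚ.^-distribˡ-+-* -1ℤ (2 ℕ.* k′) (2 ℕ.* k′)) ⟩
    -1ℤ ℤ.* (-1ℤ ℤ.^ (2 ℕ.* k′) ℤ.* -1ℤ ℤ.^ (2 ℕ.* k′)) ≡⟨ ≡.cong (-1ℤ ℤ.*_) (sign² (2 ℕ.* k′)) ⟩
    -1ℤ                                    ∎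
    where
    arithmetic : ∀ k → k ℕ.+ 3 ℕ.* (1 ℕ.+ k) ≡ 3 ℕ.+ (2 ℕ.* k ℕ.+ 2 ℕ.* k)
    arithmetic = ℕSolver.solve-∀

  module _ (k′ : ℕ) where
    private
      k = suc k′
      e = 4 ℕ.* k ℕ.∸ 1
      C = -4^ k

    -- The entry `u k (suc ℓ)` has C to the power ℓ + 2, two more than the functional, and the sign
    -- of ℓ instead of that of e - ℓ. As e is odd, these signs are opposite.
    topFactor : ℤ
    topFactor = ℤ.- (+ (8 ℕ.* k ℕ.* (4 ℕ.* k ℕ.+ 1)) ℤ.* C ℤ.^ 2)

    private
      bℤ δℤ : ℤ
      bℤ = 1ℤ ℤ.- + (16 ℕ.* k ℕ.^ 2)
      δℤ = + (4 ℕ.* k ℕ.* (e ℕ.+ 2))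

      16k² : ∀ e k → suc e ≡ 4 ℕ.* k → 16 ℕ.* (k ℕ.* (k ℕ.* 1)) ≡ 4 ℕ.* (e ℕ.+ 1) ℕ.* k
      16k² e k h = ≡.trans (lemma k) (≡.cong (λ z → 4 ℕ.* z ℕ.* k) (≡.trans (≡.sym h) (ℕₚ.+-comm 1 e)))
        where
        lemma : ∀ k → 16 ℕ.* (k ℕ.* (k ℕ.* 1)) ≡ 4 ℕ.* (4 ℕ.* k) ℕ.* k
        lemma = ℕSolver.solve-∀

      δℤ-split : ∀ e k → suc e ≡ 4 ℕ.* k → 4 ℕ.* k ℕ.* (e ℕ.+ 2) ≡ 16 ℕ.* (k ℕ.* (k ℕ.* 1)) ℕ.+ 4 ℕ.* k
      δℤ-split e k h = ≡.trans (≡.cong (4 ℕ.* k ℕ.*_) (≡.trans (ℕₚ.+-comm e 2) (≡.cong suc h))) (lemma k)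
        where
        lemma : ∀ k → 4 ℕ.* k ℕ.* (1 ℕ.+ 4 ℕ.* k) ≡ 16 ℕ.* (k ℕ.* (k ℕ.* 1)) ℕ.+ 4 ℕ.* k
        lemma = ℕSolver.solve-∀

    u≡cokernel : ∀ ℓ → ℓ ℕ.≤ e →
      u k (suc ℓ) ≡ topFactor ℤ.* Chain.cokernel ℤₚ.+-*-commutativeRing C (λ i → + (4 ℕ.* i ℕ.* k)) δℤ 1ℤ bℤ e ℓ
    u≡cokernel ℓ ℓ≤e = begin
      -1ℤ ℤ.^ ℓ ℤ.* -4^ ((suc ℓ ℕ.+ 1) ℕ.* k) ℤ.* c ℤ.* P ℤ.* ∏ℤ ℓ (λ i → + (4 ℕ.* i ℕ.* k) ℤ.+ 1ℤ)
        ≡⟨ ≡.cong₂ ℤ._*_ (≡.cong (λ z → z ℤ.* c ℤ.* P) (≡.cong₂ ℤ._*_ sign power)) (∏ℤ≡∏< ℓ (λ i → + (4 ℕ.* i ℕ.* k) ℤ.+ 1ℤ)) ⟩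
      ℤ.- s ℤ.* (C ℤ.^ ℓ ℤ.* C ℤ.^ 2) ℤ.* c ℤ.* P ℤ.* Q
        ≡⟨ rearrange s (C ℤ.^ ℓ) (C ℤ.^ 2) c P Q ⟩
      ℤ.- (c ℤ.* C ℤ.^ 2) ℤ.* (C ℤ.^ ℓ ℤ.* (s ℤ.* P) ℤ.* Q)
        ≡⟨ ≡.cong (topFactor ℤ.*_) (cokernel-value k C δℤ bℤ δ+b e 0 (λ i → + (4 ℕ.* i ℕ.* k)) (λ _ → ≡.refl)
             (≡.cong (λ z → 1ℤ ℤ.- + z) (16k² e k ≡.refl)) ℓ ℓ≤e) ⟨
      topFactor ℤ.* Chain.cokernel ℤₚ.+-*-commutativeRing C (λ i → + (4 ℕ.* i ℕ.* k)) δℤ 1ℤ bℤ e ℓ ∎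
      where
      c = + (8 ℕ.* k ℕ.* (4 ℕ.* k ℕ.+ 1))
      s = -1ℤ ℤ.^ (e ℕ.∸ ℓ)
      P = ∏ℤ (e ℕ.∸ ℓ) (λ i → + (4 ℕ.* i ℕ.* k) ℤ.- 1ℤ)
      Q = ∏< ℓ (λ i → + (4 ℕ.* suc i ℕ.* k) ℤ.+ 1ℤ)

      rearrange : ∀ s x y c P Q → ℤ.- s ℤ.* (x ℤ.* y) ℤ.* c ℤ.* P ℤ.* Q ≡ ℤ.- (c ℤ.* y) ℤ.* (x ℤ.* (s ℤ.* P) ℤ.* Q)
      rearrange = solve-∀

      sign : -1ℤ ℤ.^ ℓ ≡ ℤ.- s
      sign = begin
        -1ℤ ℤ.^ ℓ                       ≡⟨ ℤₚ.*-identityʳ (-1ℤ ℤ.^ ℓ) ⟨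
        -1ℤ ℤ.^ ℓ ℤ.* 1ℤ                ≡⟨ ≡.cong (-1ℤ ℤ.^ ℓ ℤ.*_) (sign² (e ℕ.∸ ℓ)) ⟨
        -1ℤ ℤ.^ ℓ ℤ.* (s ℤ.* s)         ≡⟨ ℤₚ.*-assoc (-1ℤ ℤ.^ ℓ) s s ⟨
        -1ℤ ℤ.^ ℓ ℤ.* s ℤ.* s           ≡⟨ ≡.cong (ℤ._* s) (ℤₚ.^-distribˡ-+-* -1ℤ ℓ (e ℕ.∸ ℓ)) ⟨
        -1ℤ ℤ.^ (ℓ ℕ.+ (e ℕ.∸ ℓ)) ℤ.* s ≡⟨ ≡.cong (λ z → -1ℤ ℤ.^ z ℤ.* s) (ℕₚ.m+[n∸m]≡n ℓ≤e) ⟩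
        -1ℤ ℤ.^ e ℤ.* s                 ≡⟨ ≡.cong (ℤ._* s) (odd-sign k′) ⟩
        -1ℤ ℤ.* s                       ≡⟨ ℤₚ.-1*i≡-i s ⟩
        ℤ.- s                           ∎

      power : -4^ ((suc ℓ ℕ.+ 1) ℕ.* k) ≡ C ℤ.^ ℓ ℤ.* C ℤ.^ 2
      power = begin
        -4^ ((suc ℓ ℕ.+ 1) ℕ.* k)       ≡⟨ ≡.cong -4^ (ℕₚ.*-comm (suc ℓ ℕ.+ 1) k) ⟩
        -4^ (k ℕ.* (suc ℓ ℕ.+ 1))       ≡⟨ ℤₚ.^-*-assoc -[1+ 3 ] k (suc ℓ ℕ.+ 1) ⟨
        C ℤ.^ (suc ℓ ℕ.+ 1)             ≡⟨ ≡.cong (C ℤ.^_) (ℕₚ.+-suc ℓ 1) ⟨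
        C ℤ.^ (ℓ ℕ.+ 2)                 ≡⟨ ℤₚ.^-distribˡ-+-* C ℓ 2 ⟩
        C ℤ.^ ℓ ℤ.* C ℤ.^ 2             ∎

      δ+b : δℤ ℤ.+ bℤ ≡ + (4 ℕ.* k) ℤ.+ 1ℤ
      δ+b = ≡.trans (≡.cong (λ z → + z ℤ.+ bℤ) (δℤ-split e k ≡.refl)) (cancel (+ (16 ℕ.* k ℕ.^ 2)) (+ (4 ℕ.* k)))
        where
        cancel : ∀ x y → x ℤ.+ y ℤ.+ (1ℤ ℤ.- x) ≡ y ℤ.+ 1ℤ
        cancel = solve-∀

module IntegerHomomorphism {c r} (R : CommutativeRing c r) where
  open CommutativeRing R
  open OverRing R using (ι)
  open IntegerCoefficients R

  ι-isRingHomomorphism : RingMorphisms.IsRingHomomorphism (CommutativeRing.rawRing ℤₚ.+-*-commutativeRing) rawRing ι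
  ι-isRingHomomorphism = record
    { isSemiringHomomorphism = record
      { isNearSemiringHomomorphism = record
        { +-isMonoidHomomorphism = record
          { isMagmaHomomorphism = record
            { isRelHomomorphism = record { cong = λ { ≡.refl → refl } }
            ; homo = ι-+
            }
          ; ε-homo = refl
          }
        ; *-homo = ι-*
        }
      ; 1#-homo = ι-1
      }
    ; -‿homo = ι-neg
    }

module DeterminantOfM {c r} (R : CommutativeRing c r) (k′ : ℕ) where
  open CommutativeRing R hiding (zero)
  open OverRing R using (ι; det; module BlockMatrix)
  open IntegerCoefficients R
  open IntegerHomomorphism R
  open Determinants R
  open SetoidReasoning setoid
  open Matrix R k′
  open Chain R (ι (-4^ k))
  open Coefficients R (ι (-4^ k))
  open ChainHomomorphism ℤₚ.+-*-commutativeRing R ι ι-isRingHomomorphism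
  open IntegerCokernel using (topFactor; u≡cokernel)

  module _ (X₁ X₂ Y : Vector Carrier e) where
    open BlockMatrix k X₁ X₂ Y hiding (x)
    private module B = BlockMatrix k X₁ X₂ Y

    ι-u : ∀ ℓ → ℓ ℕ.≤ e → ι (u k (suc ℓ)) ≈ ι (topFactor k′) * cokernel l (δ e) 1# bₑ e ℓ
    ι-u ℓ ℓ≤e = trans (reflexive (≡.cong ι (u≡cokernel k′ ℓ ℓ≤e)))
      (trans (ι-* (topFactor k′) (Chain.cokernel ℤₚ.+-*-commutativeRing (-4^ k) (λ i → + (4 ℕ.* i ℕ.* k)) (+ (4 ℕ.* k ℕ.* (e ℕ.+ 2))) 1ℤ (1ℤ ℤ.- + (16 ℕ.* k ℕ.^ 2)) e ℓ)) (*-congˡ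
        (~-cokernel refl (λ _ → refl) refl ι-1 refl e ℓ)))

    top-entry : ∀ ((ℓ , t) : Fin (4 ℕ.* k) × Fin (4 ℕ.* k)) →
                B.x (pos₁ ℓ) t ≈ ι (topFactor k′) * top l (δ e) 1# bₑ e (toℕ² (ℓ , t))
    top-entry (ℓ , t) rewrite sel-if e (toℕ t) {cokernel l (δ e) 1# bₑ e (toℕ ℓ)} {0#}
      with toℕ t ≡ᵇ e | toℕ t ≡ᵇ e ℕ.+ 1
    ... | true  | _     = ι-u (toℕ ℓ) (ℕ.s≤s⁻¹ (Finₚ.toℕ<n ℓ))
    ... | false | true  = sym (zeroʳ _)
    ... | false | false = sym (zeroʳ _)

    det-M : det M ≈ ι (topFactor k′) * chain l (δ e) (p X₁ X₂ Y) (a X₁ X₂ Y) (q X₁ X₂ Y) (b X₁ X₂ Y) 1# bₑ e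
    det-M = begin
      det M
        ≈⟨ det≈D (entry ∘ cast (rows k)) (remQuot {4 ℕ.* k} (4 ℕ.* k) ∘ cast (columns k)) ⟩
      D (tabulate (entry ∘ cast (rows k))) (tabulate (remQuot {4 ℕ.* k} (4 ℕ.* k) ∘ cast (columns k)))
        ≡⟨ ≡.cong₂ D (tabulate-cast (rows k) entry) (tabulate-cast (columns k) (remQuot {4 ℕ.* k} (4 ℕ.* k))) ⟩
      D (tabulate entry) columnLabels
        ≈⟨ D-cong {P = λ _ → ⊤} ((λ j _ → top-entry j) ∷ Pointwise.tabulate⁺ {n = (4 ℕ.* k ℕ.+ 1) ℕ.* e} (λ i (ℓ , t) _ →
             let (ρ , s) = remQuot {4 ℕ.* k ℕ.+ 1} e i in block-entry X₁ X₂ Y (toℕ ρ) (toℕ ℓ) s t))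
             (All.universal (λ _ → tt) columnLabels) ⟩
      D ((λ j → ι (topFactor k′) * tp (toℕ² j)) ∷ rest) columnLabels
        ≈⟨ D-row-scaling {P = λ _ → ⊤} [] rest (ι (topFactor k′)) (λ _ _ → refl) (All.universal (λ _ → tt) columnLabels) ⟩
      ι (topFactor k′) * D ((tp ∘ toℕ²) ∷ rest) columnLabels
        ≡⟨ ≡.cong (λ z → ι (topFactor k′) * D ((tp ∘ toℕ²) ∷ z) columnLabels) rest-grid ⟩
      ι (topFactor k′) * D (map (_∘ toℕ²) (tp ∷ grid eq (suc (suc e)) e)) columnLabels
        ≈⟨ *-congˡ (D-relabel toℕ² (tp ∷ grid eq (suc (suc e)) e) columnLabels) ⟨
      ι (topFactor k′) * D (tp ∷ grid eq (suc (suc e)) e) (map toℕ² columnLabels)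
        ≡⟨ ≡.cong (λ z → ι (topFactor k′) * D (tp ∷ grid eq (suc (suc e)) e) z)
             (≡.trans (Listₚ.map-tabulate (remQuot {4 ℕ.* k} (4 ℕ.* k)) toℕ²) (tabulate-remQuot id (4 ℕ.* k) (4 ℕ.* k))) ⟩
      ι (topFactor k′) * D (tp ∷ grid eq (suc (suc e)) e) (grid _,_ (suc e) (suc e)) ∎
      where
      tp : Row (ℕ × ℕ)
      tp = top l (δ e) 1# bₑ e
      eq : ℕ → ℕ → Row (ℕ × ℕ)
      eq = equation l (δ e) (p X₁ X₂ Y) (a X₁ X₂ Y) (q X₁ X₂ Y) (b X₁ X₂ Y)
      columnLabels : List (Fin (4 ℕ.* k) × Fin (4 ℕ.* k))
      columnLabels = tabulate (remQuot {4 ℕ.* k} (4 ℕ.* k))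
      restRow : ℕ × ℕ → Row (Fin (4 ℕ.* k) × Fin (4 ℕ.* k))
      restRow (i , s) j = eq i s (toℕ² j)
      rest : List (Row (Fin (4 ℕ.* k) × Fin (4 ℕ.* k)))
      rest = tabulate (restRow ∘ toℕ² ∘ remQuot {4 ℕ.* k ℕ.+ 1} e)
      rest-grid : rest ≡ map (_∘ toℕ²) (grid eq (suc (suc e)) e)
      rest-grid = ≡.trans (tabulate-remQuot restRow (4 ℕ.* k ℕ.+ 1) e)
        (≡.trans (≡.cong (λ z → grid (λ i s → restRow (i , s)) z e) (ℕₚ.+-comm (4 ℕ.* k) 1))
                 (≡.sym (map-grid (_∘ toℕ²) eq (suc (suc e)) e)))

-- Factors and the integer constant

module Factorisation {c r} (R : CommutativeRing c r) (C : CommutativeRing.Carrier R) where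
  open CommutativeRing R hiding (zero)
  open IntegerCoefficients R using (module Solver)
  open Solver using (solve; _:=_; _:*_)
  open Determinants R
  open RegularChain R C using (value)
  open OverRing R using (∏)
  open SetoidReasoning setoid

  ∏<-* : ∀ n w f → ∏< n (λ i → w * f i) ≈ pow w n * ∏< n f
  ∏<-* zero    w f = sym (*-identityˡ _)
  ∏<-* (suc n) w f = trans (*-congˡ (∏<-* n w (f ∘ suc)))
    (solve 4 (λ w f p q → w :* f :* (p :* q) := w :* p :* (f :* q)) refl w (f 0) _ _)

  -- μ and ν are the numerical contents of the brackets with β_n and with the other β_t,
  -- respectively.
  constant : (δ : ℕ → Carrier) (μ ν : Carrier) → ℕ → Carrier
  constant δ μ ν zero    = 1#
  constant δ μ ν (suc m) =
    sgn (signExponent m) * (pow (C * δ (suc m) * ν) (suc m) * (C * δ m * μ * constant δ μ ν m))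

  triangle : (ℕ → ℕ → Carrier) → ℕ → Carrier
  triangle B zero    = 1#
  triangle B (suc n) = ∏< (suc n) (B 0) * triangle (λ s t → B (suc s) (suc t)) n

  value-factorisation : ∀ δ p a q b qₑ bₑ μ ν A B →
    (∀ s → p s * bₑ - qₑ * a s ≈ μ * A s) → (∀ s t → p s * b t - q t * a s ≈ ν * B s t) → ∀ e →
    value δ p a q b qₑ bₑ e ≈ constant δ μ ν e * ∏< e A * triangle B e
  value-factorisation δ p a q b qₑ bₑ μ ν A B hA hB zero    = sym (trans (*-identityʳ _) (*-identityʳ _))
  value-factorisation δ p a q b qₑ bₑ μ ν A B hA hB (suc m) = begin
    sgn (signExponent m) * (∏< (suc m) (λ s → C * δ (suc m) * (p 0 * b s - q s * a 0)) *
      (C * δ m * (p 0 * bₑ - qₑ * a 0) * value δ (p ∘ suc) (a ∘ suc) (q ∘ suc) (b ∘ suc) qₑ bₑ m))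
      ≈⟨ *-congˡ (*-cong
           (trans (∏<-cong (suc m) (λ s → trans (*-congˡ (hB 0 s)) (sym (*-assoc (C * δ (suc m)) ν (B 0 s))))) (∏<-* (suc m) (C * δ (suc m) * ν) (B 0)))
           (*-cong (*-congˡ (hA 0))
             (value-factorisation δ (p ∘ suc) (a ∘ suc) (q ∘ suc) (b ∘ suc) qₑ bₑ μ ν (A ∘ suc) (λ s t → B (suc s) (suc t))
               (hA ∘ suc) (λ s → hB (suc s) ∘ suc) m))) ⟩
    sgn (signExponent m) * (pow (C * δ (suc m) * ν) (suc m) * ∏< (suc m) (B 0) *
      (C * δ m * (μ * A 0) * (constant δ μ ν m * ∏< m (A ∘ suc) * triangle (λ s t → B (suc s) (suc t)) m)))
      ≈⟨ solve 9 (λ s w B₀ d μ A₀ k A T → s :* (w :* B₀ :* (d :* (μ :* A₀) :* (k :* A :* T))) :=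
                     s :* (w :* (d :* μ :* k)) :* (A₀ :* A) :* (B₀ :* T)) refl
               _ _ _ _ μ (A 0) _ _ _ ⟩
    constant δ μ ν (suc m) * ∏< (suc m) A * triangle B (suc m) ∎

  ∏≈∏< : ∀ {n} (v : Vector Carrier n) (f : ℕ → Carrier) → (∀ i → v i ≈ f (toℕ i)) → ∏ v ≈ ∏< n f
  ∏≈∏< {zero}  v f h = refl
  ∏≈∏< {suc n} v f h = *-cong (h Fin.zero) (∏≈∏< (v ∘ Fin.suc) (f ∘ suc) (h ∘ Fin.suc))

  ∏-cong : ∀ {n} {v w : Vector Carrier n} → (∀ i → v i ≈ w i) → ∏ v ≈ ∏ w
  ∏-cong {zero}  h = refl
  ∏-cong {suc n} h = *-cong (h Fin.zero) (∏-cong (h ∘ Fin.suc))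

  ∏∏≈triangle : ∀ {n} (G : Fin n → Fin n → Carrier) (B : ℕ → ℕ → Carrier) →
    (∀ i j → G i j ≈ B (toℕ i) (toℕ j)) →
    ∏ (λ i → ∏ (λ j → if does (pos₁ i ℕ.≤? pos₁ j) then G i j else 1#)) ≈ triangle B n
  ∏∏≈triangle {zero}  G B h = refl
  ∏∏≈triangle {suc n} G B h = *-cong
    (∏≈∏< (λ j → if does (1 ℕ.≤? pos₁ j) then G Fin.zero j else 1#) (B 0) (h Fin.zero))
    (trans (∏-cong {v = λ i → 1# * inner i} {inner} (λ i → *-identityˡ _))
           (∏∏≈triangle (λ i j → G (Fin.suc i) (Fin.suc j)) (λ s t → B (suc s) (suc t)) (λ i j → h (Fin.suc i) (Fin.suc j))))
    where
    inner : Fin n → Carrier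
    inner i = ∏ (λ j → if does (pos₁ (Fin.suc i) ℕ.≤? pos₁ (Fin.suc j)) then G (Fin.suc i) (Fin.suc j) else 1#)

module ConstantHomomorphism {c r} (R : CommutativeRing c r) where
  open CommutativeRing R hiding (zero)
  open OverRing R using (ι)
  open IntegerCoefficients R
  open IntegerHomomorphism R
  open ChainHomomorphism ℤₚ.+-*-commutativeRing R ι ι-isRingHomomorphism
  private
    module ℤD = Determinants ℤₚ.+-*-commutativeRing
    module ℤF = Factorisation ℤₚ.+-*-commutativeRing
  open Determinants R
  open Factorisation R
  open SetoidReasoning setoid

  ι-pow : ∀ w n → ι (ℤD.pow w n) ≈ pow (ι w) n
  ι-pow w zero    = ι-1
  ι-pow w (suc n) = trans (ι-* w (ℤD.pow w n)) (*-congˡ (ι-pow w n))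

  ι-*₃ : ∀ x y z → ι (x ℤ.* y ℤ.* z) ≈ ι x * ι y * ι z
  ι-*₃ x y z = trans (ι-* (x ℤ.* y) z) (*-congʳ (ι-* x y))

  pow-cong : ∀ {u v} n → u ≈ v → pow u n ≈ pow v n
  pow-cong zero    h = refl
  pow-cong (suc n) h = *-cong h (pow-cong n h)

  ι-constant : ∀ C δ μ ν e → ι (ℤF.constant C δ μ ν e) ≈ constant (ι C) (ι ∘ δ) (ι μ) (ι ν) e
  ι-constant C δ μ ν zero    = ι-1
  ι-constant C δ μ ν (suc m) = begin
    ι (ℤD.sgn (signExponent m) ℤ.* (ℤD.pow x (suc m) ℤ.* (v ℤ.* w)))
      ≈⟨ ι-* (ℤD.sgn (signExponent m)) (ℤD.pow x (suc m) ℤ.* (v ℤ.* w)) ⟩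
    ι (ℤD.sgn (signExponent m)) * ι (ℤD.pow x (suc m) ℤ.* (v ℤ.* w))
      ≈⟨ *-cong (~-sgn (signExponent m)) (ι-* (ℤD.pow x (suc m)) (v ℤ.* w)) ⟩
    sgn (signExponent m) * (ι (ℤD.pow x (suc m)) * ι (v ℤ.* w))
      ≈⟨ *-congˡ (*-cong (trans (ι-pow x (suc m)) (pow-cong (suc m) (ι-*₃ C (δ (suc m)) ν)))
           (trans (ι-* v w) (*-cong (ι-*₃ C (δ m) μ) (ι-constant C δ μ ν m)))) ⟩
    constant (ι C) (ι ∘ δ) (ι μ) (ι ν) (suc m) ∎
    where
    x = C ℤ.* δ (suc m) ℤ.* ν
    v = C ℤ.* δ m ℤ.* μ
    w = ℤF.constant C δ μ ν m

-- The integer constant: sign, powers and shifted factorials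

module IntegerConstant where
  open ≡.≡-Reasoning
  open Determinants ℤₚ.+-*-commutativeRing using (∏<; pow; sgn)
  open IntegerCokernel

  pow≡^ : ∀ w n → pow w n ≡ w ℤ.^ n
  pow≡^ w zero    = ≡.refl
  pow≡^ w (suc n) = ≡.cong (w ℤ.*_) (pow≡^ w n)

  sgn≡^ : ∀ n → sgn n ≡ -1ℤ ℤ.^ n
  sgn≡^ zero    = ≡.refl
  sgn≡^ (suc n) = ≡.trans (≡.cong ℤ.-_ (sgn≡^ n)) (≡.sym (ℤₚ.-1*i≡-i (-1ℤ ℤ.^ n)))

  ^-distribʳ-* : ∀ x y n → (x ℤ.* y) ℤ.^ n ≡ x ℤ.^ n ℤ.* y ℤ.^ n
  ^-distribʳ-* x y zero    = ≡.refl
  ^-distribʳ-* x y (suc n) = ≡.trans (≡.cong (x ℤ.* y ℤ.*_) (^-distribʳ-* x y n)) (exchange x y (x ℤ.^ n) (y ℤ.^ n))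
    where
    exchange : ∀ x y u v → x ℤ.* y ℤ.* (u ℤ.* v) ≡ x ℤ.* u ℤ.* (y ℤ.* v)
    exchange = solve-∀

  pos-^ : ∀ m n → + (m ℕ.^ n) ≡ (+ m) ℤ.^ n
  pos-^ m zero    = ≡.refl
  pos-^ m (suc n) = ≡.trans (ℤₚ.pos-* m (m ℕ.^ n)) (≡.cong (+ m ℤ.*_) (pos-^ m n))

  triangular : ℕ → ℕ
  triangular zero    = 0
  triangular (suc m) = suc m ℕ.+ triangular m

  pullLength≡ : ∀ m n → pullLength m n ≡ triangular m ℕ.* n
  pullLength≡ zero    n = ≡.refl
  pullLength≡ (suc m) n = ≡.trans (≡.cong (suc m ℕ.* n ℕ.+_) (pullLength≡ m n))
                                  (≡.sym (ℕₚ.*-distribʳ-+ n (suc m) (triangular m)))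

  totalSign : ℕ → ℕ
  totalSign zero    = 0
  totalSign (suc m) = signExponent m ℕ.+ totalSign m

  signExponent≡ : ∀ m → signExponent m ≡ suc m ℕ.+ triangular (2 ℕ.+ m) ℕ.* (m ℕ.+ suc m)
  signExponent≡ m = ≡.cong (suc m ℕ.+_) (≡.trans
    (≡.cong₂ ℕ._+_ (pullLength≡ (2 ℕ.+ m) m) (pullLength≡ (2 ℕ.+ m) (suc m)))
    (≡.sym (ℕₚ.*-distribˡ-+ (triangular (2 ℕ.+ m)) m (suc m))))

  -- Four consecutive sign exponents sum to twice halfPeriod.
  halfPeriod : ℕ → ℕ
  halfPeriod m = 6 ℕ.* m ℕ.* m ℕ.+ 41 ℕ.* m ℕ.+ 69 ℕ.+ triangular (2 ℕ.+ m) ℕ.* (4 ℕ.* m ℕ.+ 8)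

  totalSign-period : ∀ m → totalSign (4 ℕ.+ m) ≡ halfPeriod m ℕ.+ halfPeriod m ℕ.+ totalSign m
  totalSign-period m = ≡.trans
    (≡.cong₂ ℕ._+_ (signExponent≡ (3 ℕ.+ m)) (≡.cong₂ ℕ._+_ (signExponent≡ (2 ℕ.+ m))
      (≡.cong₂ ℕ._+_ (signExponent≡ (1 ℕ.+ m)) (≡.cong (ℕ._+ totalSign m) (signExponent≡ m)))))
    (arithmetic m (triangular (2 ℕ.+ m)) (totalSign m))
    where
    arithmetic : ∀ m T z →
      (4 ℕ.+ m ℕ.+ (5 ℕ.+ m ℕ.+ (4 ℕ.+ m ℕ.+ (3 ℕ.+ m ℕ.+ T))) ℕ.* (3 ℕ.+ m ℕ.+ (4 ℕ.+ m))) ℕ.+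
      ((3 ℕ.+ m ℕ.+ (4 ℕ.+ m ℕ.+ (3 ℕ.+ m ℕ.+ T)) ℕ.* (2 ℕ.+ m ℕ.+ (3 ℕ.+ m))) ℕ.+
      ((2 ℕ.+ m ℕ.+ (3 ℕ.+ m ℕ.+ T) ℕ.* (1 ℕ.+ m ℕ.+ (2 ℕ.+ m))) ℕ.+
      ((1 ℕ.+ m ℕ.+ T ℕ.* (m ℕ.+ (1 ℕ.+ m))) ℕ.+ z))) ≡
      (6 ℕ.* m ℕ.* m ℕ.+ 41 ℕ.* m ℕ.+ 69 ℕ.+ T ℕ.* (4 ℕ.* m ℕ.+ 8)) ℕ.+
      (6 ℕ.* m ℕ.* m ℕ.+ 41 ℕ.* m ℕ.+ 69 ℕ.+ T ℕ.* (4 ℕ.* m ℕ.+ 8)) ℕ.+ z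
    arithmetic = ℕSolver.solve-∀

  even-power : ∀ n m → -1ℤ ℤ.^ (n ℕ.+ n ℕ.+ m) ≡ -1ℤ ℤ.^ m
  even-power n m = begin
    -1ℤ ℤ.^ (n ℕ.+ n ℕ.+ m)                    ≡⟨ ℤₚ.^-distribˡ-+-* -1ℤ (n ℕ.+ n) m ⟩
    -1ℤ ℤ.^ (n ℕ.+ n) ℤ.* -1ℤ ℤ.^ m            ≡⟨ ≡.cong (ℤ._* -1ℤ ℤ.^ m) (ℤₚ.^-distribˡ-+-* -1ℤ n n) ⟩
    -1ℤ ℤ.^ n ℤ.* -1ℤ ℤ.^ n ℤ.* -1ℤ ℤ.^ m      ≡⟨ ≡.cong (ℤ._* -1ℤ ℤ.^ m) (sign² n) ⟩
    1ℤ ℤ.* -1ℤ ℤ.^ m                           ≡⟨ ℤₚ.*-identityˡ _ ⟩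
    -1ℤ ℤ.^ m                                  ∎

  -- By `totalSign-period` the parity depends only on the index modulo 4, and `totalSign 3` = 4 + 20
  -- + 53 is odd.
  totalSign-odd : ∀ k′ → -1ℤ ℤ.^ totalSign (4 ℕ.* suc k′ ℕ.∸ 1) ≡ -1ℤ
  totalSign-odd k′ = ≡.trans (≡.cong (λ z → -1ℤ ℤ.^ totalSign z) (arithmetic k′)) (go k′)
    where
    arithmetic : ∀ k → k ℕ.+ 3 ℕ.* (1 ℕ.+ k) ≡ k ℕ.* 4 ℕ.+ 3
    arithmetic = ℕSolver.solve-∀
    go : ∀ k′ → -1ℤ ℤ.^ totalSign (k′ ℕ.* 4 ℕ.+ 3) ≡ -1ℤ
    go zero     = ≡.refl
    go (suc k′) = ≡.trans (≡.cong (-1ℤ ℤ.^_) (totalSign-period (k′ ℕ.* 4 ℕ.+ 3)))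
      (≡.trans (even-power (halfPeriod (k′ ℕ.* 4 ℕ.+ 3)) (totalSign (k′ ℕ.* 4 ℕ.+ 3))) (go k′))

  -- Collects the factors m + 2 of δ m = n (m + 2): the step to m + 1 uses δ (m + 1) with
  -- multiplicity m + 1 for the β_t and δ m once for β_n.
  factorials : ℕ → ℕ
  factorials zero    = 1
  factorials (suc m) = (3 ℕ.+ m) ℕ.^ suc m ℕ.* (2 ℕ.+ m) ℕ.* factorials m

  module _ (n : ℕ) (C : ℤ) where
    open Factorisation ℤₚ.+-*-commutativeRing C using (constant)

    δ : ℕ → ℤ
    δ m = + (n ℕ.* (m ℕ.+ 2))

    constant-value : ∀ m → constant δ (ℤ.- + 2) (+ 2) m ≡
      -1ℤ ℤ.^ totalSign m ℤ.* ((C ℤ.* + n) ℤ.^ (triangular m ℕ.+ m) ℤ.* (+ 2) ℤ.^ triangular m ℤ.*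
        (ℤ.- + 2) ℤ.^ m ℤ.* + factorials m)
    constant-value zero    = ≡.refl
    constant-value (suc m) = begin
      sgn (signExponent m) ℤ.* (pow (C ℤ.* δ (suc m) ℤ.* + 2) (suc m) ℤ.* (C ℤ.* δ m ℤ.* (ℤ.- + 2) ℤ.* constant δ (ℤ.- + 2) (+ 2) m))
        ≡⟨ ≡.cong₂ ℤ._*_ (sgn≡^ (signExponent m)) (≡.cong₂ ℤ._*_ power
             (≡.cong₂ ℤ._*_ (≡.cong (ℤ._* (ℤ.- + 2)) δ-factor) (constant-value m))) ⟩
      s′ ℤ.* (D ℤ.^ suc m ℤ.* (+ 2) ℤ.^ suc m ℤ.* w ℤ.* (D ℤ.* v ℤ.* (ℤ.- + 2) ℤ.*
        (s ℤ.* (D ℤ.^ (triangular m ℕ.+ m) ℤ.* (+ 2) ℤ.^ triangular m ℤ.* (ℤ.- + 2) ℤ.^ m ℤ.* f))))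
        ≡⟨ rearrange s′ (D ℤ.^ suc m) ((+ 2) ℤ.^ suc m) w D v (ℤ.- + 2) s (D ℤ.^ (triangular m ℕ.+ m))
             ((+ 2) ℤ.^ triangular m) ((ℤ.- + 2) ℤ.^ m) f ⟩
      s′ ℤ.* s ℤ.* (D ℤ.^ suc m ℤ.* (D ℤ.* D ℤ.^ (triangular m ℕ.+ m)) ℤ.* ((+ 2) ℤ.^ suc m ℤ.* (+ 2) ℤ.^ triangular m) ℤ.*
        ((ℤ.- + 2) ℤ.* (ℤ.- + 2) ℤ.^ m) ℤ.* (w ℤ.* v ℤ.* f))
        ≡⟨ ≡.cong₂ ℤ._*_ (ℤₚ.^-distribˡ-+-* -1ℤ (signExponent m) (totalSign m))
             (≡.cong₂ ℤ._*_ (≡.cong (ℤ._* (ℤ.- + 2) ℤ.^ suc m) (≡.cong₂ ℤ._*_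
               (≡.trans (≡.cong (D ℤ.^_) (exponent m (triangular m))) (ℤₚ.^-distribˡ-+-* D (suc m) (suc (triangular m ℕ.+ m))))
               (ℤₚ.^-distribˡ-+-* (+ 2) (suc m) (triangular m)))) factorials-step) ⟨
      -1ℤ ℤ.^ totalSign (suc m) ℤ.* (D ℤ.^ (triangular (suc m) ℕ.+ suc m) ℤ.* (+ 2) ℤ.^ triangular (suc m) ℤ.*
        (ℤ.- + 2) ℤ.^ suc m ℤ.* + factorials (suc m)) ∎
      where
      D = C ℤ.* + n
      s′ = -1ℤ ℤ.^ signExponent m
      s = -1ℤ ℤ.^ totalSign m
      w = (+ (3 ℕ.+ m)) ℤ.^ suc m
      v = + (2 ℕ.+ m)
      f = + factorials m

      rearrange : ∀ s′ x y w D v t s X Y Z f →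
        s′ ℤ.* (x ℤ.* y ℤ.* w ℤ.* (D ℤ.* v ℤ.* t ℤ.* (s ℤ.* (X ℤ.* Y ℤ.* Z ℤ.* f)))) ≡
        s′ ℤ.* s ℤ.* (x ℤ.* (D ℤ.* X) ℤ.* (y ℤ.* Y) ℤ.* (t ℤ.* Z) ℤ.* (w ℤ.* v ℤ.* f))
      rearrange = solve-∀

      exponent : ∀ m t → 1 ℕ.+ m ℕ.+ t ℕ.+ (1 ℕ.+ m) ≡ 1 ℕ.+ m ℕ.+ (1 ℕ.+ (t ℕ.+ m))
      exponent = ℕSolver.solve-∀

      δ-factor : ∀ {m} → C ℤ.* δ m ≡ C ℤ.* + n ℤ.* + (2 ℕ.+ m)
      δ-factor {m} = ≡.trans (≡.cong (C ℤ.*_) (≡.trans (ℤₚ.pos-* n (m ℕ.+ 2)) (≡.cong (λ z → + n ℤ.* + z) (ℕₚ.+-comm m 2))))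
        (≡.sym (ℤₚ.*-assoc C (+ n) (+ (2 ℕ.+ m))))

      power : pow (C ℤ.* δ (suc m) ℤ.* + 2) (suc m) ≡ D ℤ.^ suc m ℤ.* (+ 2) ℤ.^ suc m ℤ.* w
      power = begin
        pow (C ℤ.* δ (suc m) ℤ.* + 2) (suc m)                ≡⟨ pow≡^ (C ℤ.* δ (suc m) ℤ.* + 2) (suc m) ⟩
        (C ℤ.* δ (suc m) ℤ.* + 2) ℤ.^ suc m                  ≡⟨ ≡.cong (ℤ._^ suc m) (≡.trans (≡.cong (ℤ._* + 2) (δ-factor {suc m}))
                                                                 (exchange D (+ (3 ℕ.+ m)) (+ 2))) ⟩
        (D ℤ.* + 2 ℤ.* + (3 ℕ.+ m)) ℤ.^ suc m                ≡⟨ ^-distribʳ-* (D ℤ.* + 2) (+ (3 ℕ.+ m)) (suc m) ⟩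
        (D ℤ.* + 2) ℤ.^ suc m ℤ.* w                          ≡⟨ ≡.cong (ℤ._* w) (^-distribʳ-* D (+ 2) (suc m)) ⟩
        D ℤ.^ suc m ℤ.* (+ 2) ℤ.^ suc m ℤ.* w                ∎
        where
        exchange : ∀ x y z → x ℤ.* y ℤ.* z ≡ x ℤ.* z ℤ.* y
        exchange = solve-∀

      factorials-step : + factorials (suc m) ≡ w ℤ.* v ℤ.* f
      factorials-step = ≡.trans (ℤₚ.pos-* ((3 ℕ.+ m) ℕ.^ suc m ℕ.* (2 ℕ.+ m)) (factorials m))
        (≡.cong (ℤ._* f) (≡.trans (ℤₚ.pos-* ((3 ℕ.+ m) ℕ.^ suc m) (2 ℕ.+ m)) (≡.cong (ℤ._* v) (pos-^ (3 ℕ.+ m) (suc m)))))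

  poch-snoc : ∀ α n → poch α (suc n) ≡ poch α n ℕ.* (α ℕ.+ n)
  poch-snoc α zero    = ≡.trans (ℕₚ.*-identityʳ α) (≡.sym (≡.trans (ℕₚ.*-identityˡ _) (ℕₚ.+-identityʳ α)))
  poch-snoc α (suc n) = ≡.trans (≡.cong (α ℕ.*_) (poch-snoc (suc α) n))
    (≡.trans (≡.sym (ℕₚ.*-assoc α (poch (suc α) n) (suc α ℕ.+ n)))
             (≡.cong (poch α (suc n) ℕ.*_) (≡.sym (ℕₚ.+-suc α n))))

  ∏ℤ-*ʳ : ∀ n w (f g : ℕ → ℤ) → (∀ {i} → i ℕ.≤ n → g i ≡ w ℤ.* f i) → ∏ℤ n g ≡ w ℤ.^ n ℤ.* ∏ℤ n f
  ∏ℤ-*ʳ zero    w f g h = ≡.refl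
  ∏ℤ-*ʳ (suc n) w f g h = ≡.trans (≡.cong₂ ℤ._*_ (h (ℕ.s≤s ℕ.z≤n)) (∏ℤ-*ʳ n w (f ∘ suc) (g ∘ suc) (h ∘ ℕ.s≤s)))
    (exchange w (f 1) (w ℤ.^ n) (∏ℤ n (f ∘ suc)))
    where
    exchange : ∀ x y u v → x ℤ.* y ℤ.* (u ℤ.* v) ≡ x ℤ.* u ℤ.* (y ℤ.* v)
    exchange = solve-∀

  -- All shifted factorials end with the same number. Passing to e + 1 appends e + 3 to each of the
  -- e + 1 old ones and adds a new one equal to e + 3.
  ∏ℤ-poch : ∀ e → ∏ℤ (suc e) (λ i → + poch (i ℕ.+ 1) (suc e ℕ.∸ i ℕ.+ 1)) ≡ + ((2 ℕ.+ e) ℕ.* factorials e)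
  ∏ℤ-poch zero    = ≡.refl
  ∏ℤ-poch (suc e) = begin
    ∏ℤ (suc (suc e)) g
      ≡⟨ ∏ℤ-snoc (suc e) g ⟩
    g (suc (suc e)) ℤ.* ∏ℤ (suc e) g
      ≡⟨ ≡.cong₂ ℤ._*_ last (≡.trans (∏ℤ-*ʳ (suc e) v f g step) (≡.cong (v ℤ.^ suc e ℤ.*_) (∏ℤ-poch e))) ⟩
    v ℤ.* (v ℤ.^ suc e ℤ.* + ((2 ℕ.+ e) ℕ.* factorials e))
      ≡⟨ ≡.cong (v ℤ.*_) (≡.trans (≡.cong (ℤ._* + ((2 ℕ.+ e) ℕ.* factorials e)) (≡.sym (pos-^ (3 ℕ.+ e) (suc e))))
           (≡.sym (ℤₚ.pos-* ((3 ℕ.+ e) ℕ.^ suc e) ((2 ℕ.+ e) ℕ.* factorials e)))) ⟩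
    v ℤ.* + ((3 ℕ.+ e) ℕ.^ suc e ℕ.* ((2 ℕ.+ e) ℕ.* factorials e))
      ≡⟨ ≡.cong (λ z → v ℤ.* + z) (ℕₚ.*-assoc ((3 ℕ.+ e) ℕ.^ suc e) (2 ℕ.+ e) (factorials e)) ⟨
    v ℤ.* + factorials (suc e)
      ≡⟨ ℤₚ.pos-* (3 ℕ.+ e) (factorials (suc e)) ⟨
    + ((3 ℕ.+ e) ℕ.* factorials (suc e)) ∎
    where
    v = + (3 ℕ.+ e)
    f g : ℕ → ℤ
    f i = + poch (i ℕ.+ 1) (suc e ℕ.∸ i ℕ.+ 1)
    g i = + poch (i ℕ.+ 1) (suc (suc e) ℕ.∸ i ℕ.+ 1)

    last : g (suc (suc e)) ≡ v
    last rewrite ℕₚ.n∸n≡0 e | ℕₚ.+-comm e 1 = ≡.cong +_ (ℕₚ.*-identityʳ (3 ℕ.+ e))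

    step : ∀ {i} → i ℕ.≤ suc e → g i ≡ v ℤ.* f i
    step {i} i≤ = begin
      + poch (i ℕ.+ 1) (suc (suc e) ℕ.∸ i ℕ.+ 1)
        ≡⟨ ≡.cong (λ z → + poch (i ℕ.+ 1) (z ℕ.+ 1)) (ℕₚ.+-∸-assoc 1 i≤) ⟩
      + poch (i ℕ.+ 1) (suc (suc e ℕ.∸ i ℕ.+ 1))
        ≡⟨ ≡.cong +_ (poch-snoc (i ℕ.+ 1) (suc e ℕ.∸ i ℕ.+ 1)) ⟩
      + (poch (i ℕ.+ 1) (suc e ℕ.∸ i ℕ.+ 1) ℕ.* (i ℕ.+ 1 ℕ.+ (suc e ℕ.∸ i ℕ.+ 1)))
        ≡⟨ ≡.cong (λ z → + (poch (i ℕ.+ 1) (suc e ℕ.∸ i ℕ.+ 1) ℕ.* z))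
             (≡.trans (regroup i (suc e ℕ.∸ i)) (≡.cong (2 ℕ.+_) (ℕₚ.m+[n∸m]≡n i≤))) ⟩
      + (poch (i ℕ.+ 1) (suc e ℕ.∸ i ℕ.+ 1) ℕ.* (3 ℕ.+ e))
        ≡⟨ ≡.cong +_ (ℕₚ.*-comm (poch (i ℕ.+ 1) (suc e ℕ.∸ i ℕ.+ 1)) (3 ℕ.+ e)) ⟩
      + ((3 ℕ.+ e) ℕ.* poch (i ℕ.+ 1) (suc e ℕ.∸ i ℕ.+ 1))
        ≡⟨ ℤₚ.pos-* (3 ℕ.+ e) (poch (i ℕ.+ 1) (suc e ℕ.∸ i ℕ.+ 1)) ⟩
      v ℤ.* f i ∎
      where
      regroup : ∀ i m → i ℕ.+ 1 ℕ.+ (m ℕ.+ 1) ≡ 2 ℕ.+ (i ℕ.+ m)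
      regroup = ℕSolver.solve-∀

  module _ (k′ : ℕ) where
    private
      k e w : ℕ
      k = suc k′
      e = 4 ℕ.* k ℕ.∸ 1
      w = k ℕ.* (4 ℕ.* k ℕ.+ 1)
      C : ℤ
      C = -4^ k

    double-triangular : ∀ m → triangular m ℕ.* 2 ≡ m ℕ.* suc m
    double-triangular zero    = ≡.refl
    double-triangular (suc m) = ≡.trans (ℕₚ.*-distribʳ-+ 2 (suc m) (triangular m))
      (≡.trans (≡.cong (suc m ℕ.* 2 ℕ.+_) (double-triangular m)) (arithmetic m))
      where
      arithmetic : ∀ m → (1 ℕ.+ m) ℕ.* 2 ℕ.+ m ℕ.* (1 ℕ.+ m) ≡ (1 ℕ.+ m) ℕ.* (2 ℕ.+ m)
      arithmetic = ℕSolver.solve-∀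

    -- The left side is 1 + 2 + ... + 4k: the exponent of n in `constant-value`, plus one from
    -- `topFactor`. It is the exponent of k in the theorem.
    triangular-4k : suc (triangular e ℕ.+ e) ≡ w ℕ.+ w
    triangular-4k = ≡.trans (≡.cong suc (ℕₚ.+-comm (triangular e) e))
      (ℕₚ.*-cancelʳ-≡ (triangular (4 ℕ.* k)) (w ℕ.+ w) 2 (≡.trans (double-triangular (4 ℕ.* k)) (arithmetic k)))
      where
      arithmetic : ∀ k → 4 ℕ.* k ℕ.* (1 ℕ.+ 4 ℕ.* k) ≡
                   (k ℕ.* (4 ℕ.* k ℕ.+ 1) ℕ.+ k ℕ.* (4 ℕ.* k ℕ.+ 1)) ℕ.* 2
      arithmetic = ℕSolver.solve-∀

    private
      q t E : ℕ
      q = 2 ℕ.* k ℕ.* (4 ℕ.* k ℕ.+ 1)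
      t = triangular e ℕ.+ e
      E = 2 ℕ.* k ℕ.* (4 ℕ.* k ℕ.^ 2 ℕ.+ 7 ℕ.* k ℕ.+ 2)

      q≡ : w ℕ.+ w ≡ q
      q≡ = arithmetic k
        where
        arithmetic : ∀ k → k ℕ.* (4 ℕ.* k ℕ.+ 1) ℕ.+ k ℕ.* (4 ℕ.* k ℕ.+ 1) ≡ 2 ℕ.* k ℕ.* (4 ℕ.* k ℕ.+ 1)
        arithmetic = ℕSolver.solve-∀

      topFactor-split : topFactor k′ ≡ ℤ.- (+ 2 ℤ.* + (4 ℕ.* k) ℤ.* + (2 ℕ.+ e) ℤ.* C ℤ.^ 2)
      topFactor-split = ≡.cong (λ z → ℤ.- (z ℤ.* C ℤ.^ 2)) (begin
        + (8 ℕ.* k ℕ.* (4 ℕ.* k ℕ.+ 1))          ≡⟨ ≡.cong +_ (arithmetic k) ⟩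
        + (2 ℕ.* (4 ℕ.* k) ℕ.* (1 ℕ.+ 4 ℕ.* k))  ≡⟨ ℤₚ.pos-* (2 ℕ.* (4 ℕ.* k)) (2 ℕ.+ e) ⟩
        + (2 ℕ.* (4 ℕ.* k)) ℤ.* + (2 ℕ.+ e)      ≡⟨ ≡.cong (ℤ._* + (2 ℕ.+ e)) (ℤₚ.pos-* 2 (4 ℕ.* k)) ⟩
        + 2 ℤ.* + (4 ℕ.* k) ℤ.* + (2 ℕ.+ e)      ∎)
        where
        arithmetic : ∀ k → 8 ℕ.* k ℕ.* (4 ℕ.* k ℕ.+ 1) ≡ 2 ℕ.* (4 ℕ.* k) ℕ.* (1 ℕ.+ 4 ℕ.* k)
        arithmetic = ℕSolver.solve-∀

      minus-two : (ℤ.- + 2) ℤ.^ e ≡ -1ℤ ℤ.* (+ 2) ℤ.^ e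
      minus-two = ≡.trans (^-distribʳ-* -1ℤ (+ 2) e) (≡.cong (ℤ._* (+ 2) ℤ.^ e) (odd-sign k′))

      -- q is even, so k (q + 1) has the parity of k.
      C-power : C ℤ.^ suc q ≡ -1ℤ ℤ.^ k ℤ.* (+ 4) ℤ.^ (k ℕ.* suc q)
      C-power = begin
        C ℤ.^ suc q                                            ≡⟨ ℤₚ.^-*-assoc -[1+ 3 ] k (suc q) ⟩
        -[1+ 3 ] ℤ.^ (k ℕ.* suc q)                             ≡⟨ ^-distribʳ-* -1ℤ (+ 4) (k ℕ.* suc q) ⟩
        -1ℤ ℤ.^ (k ℕ.* suc q) ℤ.* (+ 4) ℤ.^ (k ℕ.* suc q)      ≡⟨ ≡.cong (ℤ._* (+ 4) ℤ.^ (k ℕ.* suc q)) (begin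
          -1ℤ ℤ.^ (k ℕ.* suc q)              ≡⟨ ≡.cong (λ z → -1ℤ ℤ.^ (k ℕ.* suc z)) q≡ ⟨
          -1ℤ ℤ.^ (k ℕ.* suc (w ℕ.+ w))      ≡⟨ ≡.cong (-1ℤ ℤ.^_) (arithmetic k w) ⟩
          -1ℤ ℤ.^ (k ℕ.* w ℕ.+ k ℕ.* w ℕ.+ k) ≡⟨ even-power (k ℕ.* w) k ⟩
          -1ℤ ℤ.^ k                          ∎) ⟩
        -1ℤ ℤ.^ k ℤ.* (+ 4) ℤ.^ (k ℕ.* suc q)                  ∎
        where
        arithmetic : ∀ k w → k ℕ.* (1 ℕ.+ (w ℕ.+ w)) ≡ k ℕ.* w ℕ.+ k ℕ.* w ℕ.+ k
        arithmetic = ℕSolver.solve-∀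

      two-power : (+ 2) ℤ.^ q ≡ (+ 4) ℤ.^ w
      two-power = begin
        (+ 2) ℤ.^ q                   ≡⟨ ≡.cong ((+ 2) ℤ.^_) q≡ ⟨
        (+ 2) ℤ.^ (w ℕ.+ w)           ≡⟨ ℤₚ.^-distribˡ-+-* (+ 2) w w ⟩
        (+ 2) ℤ.^ w ℤ.* (+ 2) ℤ.^ w   ≡⟨ ^-distribʳ-* (+ 2) (+ 2) w ⟨
        (+ 4) ℤ.^ w                   ∎

      n-power : (+ (4 ℕ.* k)) ℤ.^ q ≡ (+ 4) ℤ.^ q ℤ.* (+ k) ℤ.^ q
      n-power = ≡.trans (≡.cong (ℤ._^ q) (ℤₚ.pos-* 4 k)) (^-distribʳ-* (+ 4) (+ k) q)

      -- The three powers stem from C^(q+1), from n^q with n = 4k, and from 2^q = 4^w.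
      four-power : + (4 ℕ.^ E) ≡ (+ 4) ℤ.^ (k ℕ.* suc q) ℤ.* (+ 4) ℤ.^ q ℤ.* (+ 4) ℤ.^ w
      four-power = begin
        + (4 ℕ.^ E)                                   ≡⟨ pos-^ 4 E ⟩
        (+ 4) ℤ.^ E                                   ≡⟨ ≡.cong ((+ 4) ℤ.^_) (arithmetic k) ⟩
        (+ 4) ℤ.^ (k ℕ.* suc q ℕ.+ q ℕ.+ w)           ≡⟨ ℤₚ.^-distribˡ-+-* (+ 4) (k ℕ.* suc q ℕ.+ q) w ⟩
        (+ 4) ℤ.^ (k ℕ.* suc q ℕ.+ q) ℤ.* (+ 4) ℤ.^ w ≡⟨ ≡.cong (ℤ._* (+ 4) ℤ.^ w) (ℤₚ.^-distribˡ-+-* (+ 4) (k ℕ.* suc q) q) ⟩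
        (+ 4) ℤ.^ (k ℕ.* suc q) ℤ.* (+ 4) ℤ.^ q ℤ.* (+ 4) ℤ.^ w ∎
        where
        arithmetic : ∀ k → 2 ℕ.* k ℕ.* (4 ℕ.* (k ℕ.* (k ℕ.* 1)) ℕ.+ 7 ℕ.* k ℕ.+ 2) ≡
          k ℕ.* (1 ℕ.+ 2 ℕ.* k ℕ.* (4 ℕ.* k ℕ.+ 1)) ℕ.+ 2 ℕ.* k ℕ.* (4 ℕ.* k ℕ.+ 1) ℕ.+ k ℕ.* (4 ℕ.* k ℕ.+ 1)
        arithmetic = ℕSolver.solve-∀

      suc-t : suc t ≡ q
      suc-t = ≡.trans triangular-4k q≡

    total-constant : topFactor k′ ℤ.* Factorisation.constant ℤₚ.+-*-commutativeRing C (δ (4 ℕ.* k) C) (ℤ.- + 2) (+ 2) e ≡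
      -1ℤ ℤ.^ (k ℕ.∸ 1) ℤ.* + (4 ℕ.^ E) ℤ.* + (k ℕ.^ q) ℤ.*
      ∏ℤ (4 ℕ.* k) (λ i → + poch (i ℕ.+ 1) (4 ℕ.* k ℕ.∸ i ℕ.+ 1))
    total-constant = begin
      topFactor k′ ℤ.* Factorisation.constant ℤₚ.+-*-commutativeRing C (δ (4 ℕ.* k) C) (ℤ.- + 2) (+ 2) e
        ≡⟨ ≡.cong₂ ℤ._*_ topFactor-split (≡.trans (constant-value (4 ℕ.* k) C e)
             (≡.cong₂ ℤ._*_ (totalSign-odd k′) (≡.cong (ℤ._* f) (≡.cong₂ ℤ._*_
               (≡.cong (ℤ._* 2ᵀ) (^-distribʳ-* C n t)) minus-two)))) ⟩
      ℤ.- (+ 2 ℤ.* n ℤ.* v ℤ.* (C ℤ.* (C ℤ.* 1ℤ))) ℤ.* (-1ℤ ℤ.* (C ℤ.^ t ℤ.* n ℤ.^ t ℤ.* 2ᵀ ℤ.* (-1ℤ ℤ.* 2ᴱ) ℤ.* f))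
        ≡⟨ collect (+ 2) n v C (C ℤ.^ t) (n ℤ.^ t) 2ᵀ 2ᴱ f ⟩
      -1ℤ ℤ.* (C ℤ.^ suc (suc t) ℤ.* n ℤ.^ suc t ℤ.* (+ 2 ℤ.* (2ᵀ ℤ.* 2ᴱ)) ℤ.* (v ℤ.* f))
        ≡⟨ ≡.cong (λ z → -1ℤ ℤ.* (C ℤ.^ suc (suc t) ℤ.* n ℤ.^ suc t ℤ.* (+ 2 ℤ.* z) ℤ.* (v ℤ.* f)))
             (ℤₚ.^-distribˡ-+-* (+ 2) (triangular e) e) ⟨
      -1ℤ ℤ.* (C ℤ.^ suc (suc t) ℤ.* n ℤ.^ suc t ℤ.* (+ 2) ℤ.^ suc t ℤ.* (v ℤ.* f))
        ≡⟨ ≡.cong₂ (λ z Φ → -1ℤ ℤ.* (C ℤ.^ suc z ℤ.* n ℤ.^ z ℤ.* (+ 2) ℤ.^ z ℤ.* Φ)) suc-t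
             (≡.trans (≡.sym (ℤₚ.pos-* (2 ℕ.+ e) (factorials e))) (≡.sym (∏ℤ-poch e))) ⟩
      -1ℤ ℤ.* (C ℤ.^ suc q ℤ.* n ℤ.^ q ℤ.* (+ 2) ℤ.^ q ℤ.* P)
        ≡⟨ ≡.cong (λ z → -1ℤ ℤ.* (z ℤ.* P)) (≡.cong₂ ℤ._*_ (≡.cong₂ ℤ._*_ C-power n-power) two-power) ⟩
      -1ℤ ℤ.* (-1ℤ ℤ.* s ℤ.* a ℤ.* (b ℤ.* (+ k) ℤ.^ q) ℤ.* c ℤ.* P)
        -- The minus sign left by the other factors cancels one factor of (-1)^k, which gives the
        -- exponent k - 1.
        ≡⟨ regroup s a b ((+ k) ℤ.^ q) c P ⟩
      s ℤ.* (a ℤ.* b ℤ.* c) ℤ.* (+ k) ℤ.^ q ℤ.* P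
        ≡⟨ ≡.cong₂ (λ y z → s ℤ.* y ℤ.* z ℤ.* P) four-power (pos-^ k q) ⟨
      s ℤ.* + (4 ℕ.^ E) ℤ.* + (k ℕ.^ q) ℤ.* P ∎
      where
      n = + (4 ℕ.* k)
      v = + (2 ℕ.+ e)
      f = + factorials e
      2ᵀ = (+ 2) ℤ.^ triangular e
      2ᴱ = (+ 2) ℤ.^ e
      s = -1ℤ ℤ.^ k′
      a = (+ 4) ℤ.^ (k ℕ.* suc q)
      b = (+ 4) ℤ.^ q
      c = (+ 4) ℤ.^ w
      P = ∏ℤ (4 ℕ.* k) (λ i → + poch (i ℕ.+ 1) (4 ℕ.* k ℕ.∸ i ℕ.+ 1))

      collect : ∀ 2# n v C X Y T U f →
        ℤ.- (2# ℤ.* n ℤ.* v ℤ.* (C ℤ.* (C ℤ.* 1ℤ))) ℤ.* (-1ℤ ℤ.* (X ℤ.* Y ℤ.* T ℤ.* (-1ℤ ℤ.* U) ℤ.* f)) ≡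
        -1ℤ ℤ.* (C ℤ.* (C ℤ.* X) ℤ.* (n ℤ.* Y) ℤ.* (2# ℤ.* (T ℤ.* U)) ℤ.* (v ℤ.* f))
      collect = solve-∀

      regroup : ∀ s a b K c P →
        -1ℤ ℤ.* (-1ℤ ℤ.* s ℤ.* a ℤ.* (b ℤ.* K) ℤ.* c ℤ.* P) ≡ s ℤ.* (a ℤ.* b ℤ.* c) ℤ.* K ℤ.* P
      regroup = solve-∀

-- The linear and quadratic factors

module Evaluation {c r} (R : CommutativeRing c r) (k′ : ℕ)
                  (X₁ X₂ Y : Vector (CommutativeRing.Carrier R) (4 ℕ.* suc k′ ℕ.∸ 1)) where
  open CommutativeRing R hiding (zero)
  open OverRing R using (ι)
  open IntegerCoefficients R
  open Solver using (solve; _:=_; _:+_; _:*_; _:-_; :-_; con)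
  open Matrix R k′
  open Coefficients R (ι (-4^ k)) using (extend; extend-toℕ)
  open SetoidReasoning setoid

  l-step : ∀ i m → l (suc i) + δ m ≈ l i + δ (suc m)
  l-step i m = trans (sym (ι-+ (+ (4 ℕ.* suc i ℕ.* k)) (+ (4 ℕ.* k ℕ.* (m ℕ.+ 2)))))
    (trans (reflexive (≡.cong (ι ∘ +_) (arithmetic i m k)))
           (ι-+ (+ (4 ℕ.* i ℕ.* k)) (+ (4 ℕ.* k ℕ.* (suc m ℕ.+ 2)))))
    where
    arithmetic : ∀ i m k → 4 ℕ.* (1 ℕ.+ i) ℕ.* k ℕ.+ 4 ℕ.* k ℕ.* (m ℕ.+ 2) ≡
                           4 ℕ.* i ℕ.* k ℕ.+ 4 ℕ.* k ℕ.* (1 ℕ.+ m ℕ.+ 2)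
    arithmetic = ℕSolver.solve-∀

  A : ℕ → Carrier
  A s = ι (+ 2) * extend X₁ s - ι (+ (32 ℕ.* k ℕ.^ 2 ℕ.+ 2 ℕ.* suc s) ℤ.- 1ℤ) * extend Y s

  B : ℕ → ℕ → Carrier
  B s t = ι (+ 2) * extend X₂ t * extend Y s - ι (+ 2) * extend X₁ s * extend Y t
          - ι (+ (2 ℕ.* suc t) ℤ.- + (2 ℕ.* suc s) ℤ.+ 1ℤ) * extend Y s * extend Y t

  ι-*-+ : ∀ m n → ι (+ (m ℕ.* n)) ≈ ι (+ m) * ι (+ n)
  ι-*-+ m n = trans (reflexive (≡.cong ι (ℤₚ.pos-* m n))) (ι-* (+ m) (+ n))

  ι-4s+2 : ∀ s → ι (+ (4 ℕ.* suc s ℕ.+ 2)) ≈ ι (+ 4) * ι (+ s) + ι (+ 6)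
  ι-4s+2 s = trans (reflexive (≡.cong (ι ∘ +_) (arithmetic s)))
    (trans (ι-+ (+ (4 ℕ.* s)) (+ 6)) (+-congʳ (ι-*-+ 4 s)))
    where
    arithmetic : ∀ s → 4 ℕ.* (1 ℕ.+ s) ℕ.+ 2 ≡ 4 ℕ.* s ℕ.+ 6
    arithmetic = ℕSolver.solve-∀

  ι-2s+2 : ∀ s → ι (+ (2 ℕ.* suc s)) ≈ ι (+ 2) * ι (+ s) + ι (+ 2)
  ι-2s+2 s = trans (reflexive (≡.cong (ι ∘ +_) (arithmetic s)))
    (trans (ι-+ (+ (2 ℕ.* s)) (+ 2)) (+-congʳ (ι-*-+ 2 s)))
    where
    arithmetic : ∀ s → 2 ℕ.* (1 ℕ.+ s) ≡ 2 ℕ.* s ℕ.+ 2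
    arithmetic = ℕSolver.solve-∀

  -- The bracket [α_s , β_n]. The coefficients of α_s are even, which is why -2 splits off here and
  -- 2 in `factor-B`; their powers are part of `total-constant`.
  factor-A : ∀ s → p X₁ X₂ Y s * bₑ - 1# * a X₁ X₂ Y s ≈ ι (ℤ.- + 2) * A s
  factor-A s = begin
    ι (ℤ.- + 4) * y * ι (1ℤ ℤ.- + (16 ℕ.* k ℕ.^ 2)) - 1# * (ι (+ 4) * x - ι (+ (4 ℕ.* suc s ℕ.+ 2)) * y)
      ≈⟨ +-cong (*-congˡ (trans (ι-+ 1ℤ (ℤ.- + (16 ℕ.* k ℕ.^ 2))) (+-congˡ (ι-neg (+ (16 ℕ.* k ℕ.^ 2))))))
           (-‿cong (trans (*-identityˡ _) (+-congˡ (-‿cong (*-congʳ (ι-4s+2 s)))))) ⟩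
    ι (ℤ.- + 4) * y * (ι 1ℤ - K) - (ι (+ 4) * x - (ι (+ 4) * ι (+ s) + ι (+ 6)) * y)
      ≈⟨ solve 4 (λ x y s K → con (ℤ.- + 4) :* y :* (con 1ℤ :- K) :- (con (+ 4) :* x :- (con (+ 4) :* s :+ con (+ 6)) :* y)
           := con (ℤ.- + 2) :* (con (+ 2) :* x :- (con (+ 2) :* K :+ (con (+ 2) :* s :+ con (+ 2)) :- con 1ℤ) :* y))
           refl x y (ι (+ s)) K ⟩
    ι (ℤ.- + 2) * (ι (+ 2) * x - (ι (+ 2) * K + (ι (+ 2) * ι (+ s) + ι (+ 2)) - ι 1ℤ) * y)
      ≈⟨ *-congˡ (+-congˡ (-‿cong (*-congʳ coefficient))) ⟨
    ι (ℤ.- + 2) * (ι (+ 2) * x - ι (+ (32 ℕ.* k ℕ.^ 2 ℕ.+ 2 ℕ.* suc s) ℤ.- 1ℤ) * y) ∎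
    where
    x = extend X₁ s
    y = extend Y s
    K = ι (+ (16 ℕ.* k ℕ.^ 2))
    coefficient : ι (+ (32 ℕ.* k ℕ.^ 2 ℕ.+ 2 ℕ.* suc s) ℤ.- 1ℤ) ≈ ι (+ 2) * K + (ι (+ 2) * ι (+ s) + ι (+ 2)) - ι 1ℤ
    coefficient = trans (ι-+ (+ (32 ℕ.* k ℕ.^ 2 ℕ.+ 2 ℕ.* suc s)) (ℤ.- 1ℤ)) (+-cong
      (trans (ι-+ (+ (32 ℕ.* k ℕ.^ 2)) (+ (2 ℕ.* suc s))) (+-cong
        (trans (reflexive (≡.cong (ι ∘ +_) (ℕₚ.*-assoc 2 16 (k ℕ.^ 2)))) (ι-*-+ 2 (16 ℕ.* k ℕ.^ 2)))
        (ι-2s+2 s)))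
      (ι-neg 1ℤ))

  factor-B : ∀ s t → p X₁ X₂ Y s * b X₁ X₂ Y t - q X₁ X₂ Y t * a X₁ X₂ Y s ≈ ι (+ 2) * B s t
  factor-B s t = begin
    ι (ℤ.- + 4) * y * (ι (+ (t ℕ.+ 2)) * y′ - x₂) - y′ * (ι (+ 4) * x₁ - ι (+ (4 ℕ.* suc s ℕ.+ 2)) * y)
      ≈⟨ +-cong (*-congˡ (+-congʳ (*-congʳ (ι-+ (+ t) (+ 2)))))
                (-‿cong (*-congˡ (+-congˡ (-‿cong (*-congʳ (ι-4s+2 s)))))) ⟩
    ι (ℤ.- + 4) * y * ((ι (+ t) + ι (+ 2)) * y′ - x₂) - y′ * (ι (+ 4) * x₁ - (ι (+ 4) * ι (+ s) + ι (+ 6)) * y)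
      ≈⟨ solve 6 (λ x₁ x₂ y y′ s t →
           con (ℤ.- + 4) :* y :* ((t :+ con (+ 2)) :* y′ :- x₂) :- y′ :* (con (+ 4) :* x₁ :- (con (+ 4) :* s :+ con (+ 6)) :* y)
           := con (+ 2) :* (con (+ 2) :* x₂ :* y :- con (+ 2) :* x₁ :* y′ :-
                (con (+ 2) :* t :+ con (+ 2) :- (con (+ 2) :* s :+ con (+ 2)) :+ con 1ℤ) :* y :* y′))
           refl x₁ x₂ y y′ (ι (+ s)) (ι (+ t)) ⟩
    ι (+ 2) * (ι (+ 2) * x₂ * y - ι (+ 2) * x₁ * y′ -
      (ι (+ 2) * ι (+ t) + ι (+ 2) - (ι (+ 2) * ι (+ s) + ι (+ 2)) + ι 1ℤ) * y * y′)
      ≈⟨ *-congˡ (+-congˡ (-‿cong (*-congʳ (*-congʳ coefficient)))) ⟨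
    ι (+ 2) * B s t ∎
    where
    x₁ = extend X₁ s
    x₂ = extend X₂ t
    y = extend Y s
    y′ = extend Y t
    coefficient : ι (+ (2 ℕ.* suc t) ℤ.- + (2 ℕ.* suc s) ℤ.+ 1ℤ) ≈
                  ι (+ 2) * ι (+ t) + ι (+ 2) - (ι (+ 2) * ι (+ s) + ι (+ 2)) + ι 1ℤ
    coefficient = trans (ι-+ (+ (2 ℕ.* suc t) ℤ.- + (2 ℕ.* suc s)) 1ℤ) (+-congʳ
      (trans (ι-+ (+ (2 ℕ.* suc t)) (ℤ.- + (2 ℕ.* suc s))) (+-cong (ι-2s+2 t)
        (trans (ι-neg (+ (2 ℕ.* suc s))) (-‿cong (ι-2s+2 s))))))


theorem2 : ∀ {c r} (R : CommutativeRing c r) →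
    let open CommutativeRing R
        open OverRing R
    in (k : ℕ) .{{_ : NonZero k}} (X₁ X₂ Y : Vector Carrier (4 ℕ.* k ℕ.∸ 1)) →
    let open BlockMatrix k X₁ X₂ Y
    in det M ≈
         ι (-1ℤ ℤ.^ (k ℕ.∸ 1)
            ℤ.* + (4 ℕ.^ (2 ℕ.* k ℕ.* (4 ℕ.* k ℕ.^ 2 ℕ.+ 7 ℕ.* k ℕ.+ 2)))
            ℤ.* + (k ℕ.^ (2 ℕ.* k ℕ.* (4 ℕ.* k ℕ.+ 1)))
            ℤ.* ∏ℤ (4 ℕ.* k) (λ i → + poch (i ℕ.+ 1) (4 ℕ.* k ℕ.∸ i ℕ.+ 1)))
         * ∏ (λ a → ι (+ 2) * X₁ a - ι (+ (32 ℕ.* k ℕ.^ 2 ℕ.+ 2 ℕ.* pos₁ a) ℤ.- 1ℤ) * Y a)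
         * ∏ (λ a → ∏ (λ b →
             if does (pos₁ a ℕ.≤? pos₁ b)
             then ι (+ 2) * X₂ b * Y a - ι (+ 2) * X₁ a * Y b
                  - ι (+ (2 ℕ.* pos₁ b) ℤ.- + (2 ℕ.* pos₁ a) ℤ.+ 1ℤ) * Y a * Y b
             else 1#))
theorem2 R (suc k′) X₁ X₂ Y = begin
  det M
    ≈⟨ DeterminantOfM.det-M R k′ X₁ X₂ Y ⟩
  ι (topFactor k′) * Chain.chain R (ι (-4^ k)) l (δ e) (p X₁ X₂ Y) (a X₁ X₂ Y) (q X₁ X₂ Y) (b X₁ X₂ Y) 1# bₑ e
    ≈⟨ *-congˡ (trans
         (ChainEvaluation.chain-value R (ι (-4^ k)) l δ (p X₁ X₂ Y) (a X₁ X₂ Y) (q X₁ X₂ Y) (b X₁ X₂ Y) 1# bₑ l-step e)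
         (value-factorisation δ (p X₁ X₂ Y) (a X₁ X₂ Y) (q X₁ X₂ Y) (b X₁ X₂ Y) 1# bₑ (ι (ℤ.- + 2)) (ι (+ 2)) A B
           factor-A factor-B e)) ⟩
  ι (topFactor k′) * (constant δ (ι (ℤ.- + 2)) (ι (+ 2)) e * ∏< e A * triangle B e)
    ≈⟨ trans (sym (*-assoc _ _ _)) (*-congʳ (sym (*-assoc _ _ _))) ⟩
  ι (topFactor k′) * constant δ (ι (ℤ.- + 2)) (ι (+ 2)) e * ∏< e A * triangle B e
    ≈⟨ *-cong (*-cong constants
         (∏≈∏< (λ i → ι (+ 2) * X₁ i - ι (+ (32 ℕ.* k ℕ.^ 2 ℕ.+ 2 ℕ.* pos₁ i) ℤ.- 1ℤ) * Y i) A (λ i → reflexive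
           (≡.cong₂ (λ x y → ι (+ 2) * x - ι (+ (32 ℕ.* k ℕ.^ 2 ℕ.+ 2 ℕ.* pos₁ i) ℤ.- 1ℤ) * y)
             (≡.sym (extend-toℕ X₁ i)) (≡.sym (extend-toℕ Y i))))))
         (∏∏≈triangle (λ i j → ι (+ 2) * X₂ j * Y i - ι (+ 2) * X₁ i * Y j
             - ι (+ (2 ℕ.* pos₁ j) ℤ.- + (2 ℕ.* pos₁ i) ℤ.+ 1ℤ) * Y i * Y j) B (λ i j → reflexive
           (≡.sym (≡.cong₂ _-_
             (≡.cong₂ _-_
               (≡.cong₂ (λ x y → ι (+ 2) * x * y) (extend-toℕ X₂ j) (extend-toℕ Y i))
               (≡.cong₂ (λ x y → ι (+ 2) * x * y) (extend-toℕ X₁ i) (extend-toℕ Y j)))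
             (≡.cong₂ (λ x y → ι (+ (2 ℕ.* pos₁ j) ℤ.- + (2 ℕ.* pos₁ i) ℤ.+ 1ℤ) * x * y) (extend-toℕ Y i) (extend-toℕ Y j)))))) ⟨
  _ ∎
  where
  open CommutativeRing R
  open OverRing R
  open BlockMatrix (suc k′) X₁ X₂ Y using (M)
  open Evaluation R k′ X₁ X₂ Y
  open Matrix R k′
  open Coefficients R (ι (-4^ k)) using (extend-toℕ)
  open Determinants R using (∏<)
  open Factorisation R (ι (-4^ k))
  open IntegerCoefficients R
  open IntegerCokernel using (topFactor)
  open SetoidReasoning setoid

  constants : ι (-1ℤ ℤ.^ (k ℕ.∸ 1)
            ℤ.* + (4 ℕ.^ (2 ℕ.* k ℕ.* (4 ℕ.* k ℕ.^ 2 ℕ.+ 7 ℕ.* k ℕ.+ 2)))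
            ℤ.* + (k ℕ.^ (2 ℕ.* k ℕ.* (4 ℕ.* k ℕ.+ 1)))
            ℤ.* ∏ℤ (4 ℕ.* k) (λ i → + poch (i ℕ.+ 1) (4 ℕ.* k ℕ.∸ i ℕ.+ 1))) ≈
            ι (topFactor k′) * constant δ (ι (ℤ.- + 2)) (ι (+ 2)) e
  constants = trans (reflexive (≡.cong ι (≡.sym (IntegerConstant.total-constant k′))))
    (trans (ι-* (topFactor k′) (Factorisation.constant ℤₚ.+-*-commutativeRing (-4^ k)
             (IntegerConstant.δ (4 ℕ.* k) (-4^ k)) (ℤ.- + 2) (+ 2) e))
           (*-congˡ (ConstantHomomorphism.ι-constant R (-4^ k) (IntegerConstant.δ (4 ℕ.* k) (-4^ k)) (ℤ.- + 2) (+ 2) e)))
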